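{- Let $m\ge3$ be an integer, written as $m=j2^k$ where either $j$ is odd with $j\ge3$ or $j=4$, and $k\ge0$ is an integer, and let $A\subseteq\{0,\dots,m-1\}$ be non-simple. Let $C$ be a class of two-party functions each having deterministic communication complexity at most $c$. Then any $\mathsf{THR}\circ C$ circuit computing $\mathrm{mod}_m^A\circ\mathsf{XOR}$ must have size \[s\ge2^{\Omega\left(\frac{n-km}{jm}\right)-\frac{2j\log j}{m}-c}.\]
   Context: For positive integer $m<n$ and $A\subseteq\{0,\dots,m-1\}$, $\mathrm{mod}_m^A:\{0,1\}^n\to\{ -1,1\}$ is $-1$ if $\sum_ix_i\equiv a\pmod m$ for some $a\in A$ and $1$ otherwise; $A$ is simple if $\mathrm{mod}_m^A$ is constant, parity, or the negation of parity. $(\mathrm{mod}_m^A\circ\mathsf{XOR})(x,y)=\mathrm{mod}_m^A(x\oplus y)$ on $x,y\in\{0,1\}^n$, with $x$ given to Alice and $y$ to Bob. A $\mathsf{THR}\circ C$ circuit of size $s$ is a single linear threshold gate (sign of a real weighted sum) applied to the outputs of $s$ gates, each computing a function of $(x,y)$ from $C$.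
   Formalization: The weights and the bias of the linear threshold gate are taken rational instead of real; Ω is read with a universal constant, and the bound is stated with denominators cleared. -}

module Defs where

open import Data.Bool using (Bool; true; false; not; _xor_; if_then_else_)
open import Data.Nat as ℕ using (ℕ; zero; suc; NonZero)
open import Data.Nat.DivMod using (_%_; m%n<n)
open import Data.Fin using (Fin; fromℕ<)
open import Data.Fin.Subset using (Subset)
open import Data.Vec using (Vec; []; _∷_; zipWith; lookup)
open import Data.Rational as ℚ using (ℚ; 0ℚ; 1ℚ)
open import Data.Product using (Σ; ∃; _×_; _,_)
open import Data.Sum using (_⊎_)
open import Relation.Binary.PropositionalEquality using (_≡_)

-- Convention: Boolean value `true` encodes the output -1, `false` encodes +1.

weight : ∀ {n} → Vec Bool n → ℕ
weight [] = 0
weight (true ∷ xs) = suc (weight xs)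
weight (false ∷ xs) = weight xs

modA : (m : ℕ) .{{_ : NonZero m}} → Subset m → ∀ {n} → Vec Bool n → Bool
modA m A x = lookup A (fromℕ< (m%n<n (weight x) m))

parity : ∀ {n} → Vec Bool n → Bool
parity [] = false
parity (b ∷ xs) = b xor parity xs

-- A is simple: mod_m^A (on n bits) is constant, parity, or negated parity
Simple : (n : ℕ) → (Vec Bool n → Bool) → Set
Simple n f = (Σ Bool λ b → ∀ x → f x ≡ b)
           ⊎ (∀ x → f x ≡ parity x)
           ⊎ (∀ x → f x ≡ not (parity x))

TwoParty : ℕ → Set
TwoParty n = Vec Bool n → Vec Bool n → Bool

modXOR : (m : ℕ) .{{_ : NonZero m}} → Subset m → ∀ {n} → TwoParty n
modXOR m A x y = modA m A (zipWith _xor_ x y)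

data Protocol (X Y : Set) : Set where
  leaf  : Bool → Protocol X Y
  alice : (X → Bool) → Protocol X Y → Protocol X Y → Protocol X Y
  bob   : (Y → Bool) → Protocol X Y → Protocol X Y → Protocol X Y

depth : ∀ {X Y} → Protocol X Y → ℕ
depth (leaf _) = 0
depth (alice _ l r) = suc (depth l ℕ.⊔ depth r)
depth (bob _ l r) = suc (depth l ℕ.⊔ depth r)

run : ∀ {X Y} → Protocol X Y → X → Y → Bool
run (leaf b) x y = b
run (alice a l r) x y = if a x then run r x y else run l x y
run (bob b l r) x y = if b y then run r x y else run l x y

CCatMost : ∀ {n} → ℕ → TwoParty n → Set
CCatMost {n} c f = Σ (Protocol (Vec Bool n) (Vec Bool n)) λ π →
  (depth π ℕ.≤ c) × (∀ x y → run π x y ≡ f x y)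

pm : Bool → ℚ
pm true = ℚ.- 1ℚ
pm false = 1ℚ

sumFin : (s : ℕ) → (Fin s → ℚ) → ℚ
sumFin zero f = 0ℚ
sumFin (suc s) f = f Fin.zero ℚ.+ sumFin s (λ i → f (Fin.suc i))
  where import Data.Fin as Fin

record THRCircuit (n : ℕ) (C : TwoParty n → Set) (s : ℕ) : Set where
  field
    gate   : Fin s → TwoParty n
    gateC  : ∀ i → C (gate i)
    bias   : ℚ
    weight' : Fin s → ℚ

  total : Vec Bool n → Vec Bool n → ℚ
  total x y = bias ℚ.+ sumFin s (λ i → weight' i ℚ.* pm (gate i x y))

Computes : ∀ {n C s} → THRCircuit n C s → TwoParty n → Set
Computes {n} circ F = ∀ (x y : Vec Bool n) →
  (F x y ≡ true → THRCircuit.total circ x y ℚ.< 0ℚ) ×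
  (F x y ≡ false → 0ℚ ℚ.≤ THRCircuit.total circ x y)

{-# OPTIONS --safe #-}
-- If A is not simple, then the value F w of mod_m^A on inputs of weight w is not 2-periodic in w, so along some
-- progression a + 2u z it is a non-constant function H of z mod p, with p ≤ j and u p ≤ m. Blocks of
-- O(u p) bits embed the matrix H(⟨x, y⟩), x ∈ {0,1}^t, y ∈ (ℤ/p)^t, t = Ω(n/m), into mod_m^A ∘ XOR.
-- Replacing the values of H by a mean-zero function g of the same sign makes the rows of this matrix pairwise orthogonal.
--
-- A circuit of size s writes the sign pattern as a matrix of rank d ≤ 1 + s 2^c. Forster's argument bounds d from
-- below; here it is carried out over ℤ. With D = Σ_T det(u_T)² over all d-tuples T of rows, Cramer's rule and
-- Cauchy–Schwarz give ⟨γ, w⟩² D ≤ d² ‖w‖² E(γ) for w in the column space, where E(γ) = Σ_T′ (Σ_x γ_x det(u_x, u_T′))².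
-- Rescaling the rows until no row carries more than a 12/r share of D (there are r d rows) makes every w flat,
-- which forces r D ≤ 12 d⁴ E(g_y) for every column y, while orthogonality gives Σ_y E(g_y) ≤ p² #columns D.
-- Hence 2^t is at most polynomial in d and p, and the factor p ≤ j ≤ 2^j is absorbed by the exponent j m.
module Submission where

open import Defs
open import Data.Nat using (ℕ; NonZero; _+_; _*_; _^_; _≤_; _<_)
open import Data.Nat.DivMod using (_%_)
open import Data.Fin.Subset using (Subset)
open import Data.Product using (∃-syntax; _×_)
open import Data.Sum using (_⊎_)
open import Relation.Nullary using (¬_)
open import Relation.Binary.PropositionalEquality using (_≡_)

open import Data.Bool using (Bool; true; false; not; _xor_; if_then_else_)
import Data.Bool.Properties as Boolₚ
open import Data.Fin as Fin using (Fin; zero; suc)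
import Data.Fin.Properties as Finₚ
open import Data.Integer as ℤ using (ℤ; +_; 0ℤ; 1ℤ; ∣_∣)
import Data.Integer.Properties as ℤₚ
open import Algebra.Properties.AbelianGroup ℤₚ.+-0-abelianGroup using (∙-cancelˡ)
import Data.Integer.Tactic.RingSolver as ℤ-Solver
open import Data.List as List using (List; []; _∷_; _++_; concatMap)
open import Data.List.Membership.Propositional using (_∈_; lose)
open import Data.List.Membership.Propositional.Properties using (∈-map⁺; ∈-concatMap⁺; ∈-allFin; ∈-cartesianProduct⁺)
import Data.List.Properties as Listₚ
open import Data.List.Relation.Unary.All using (All; []; _∷_)
open import Data.List.Relation.Unary.AllPairs using ([]; _∷_)
open import Data.List.Relation.Unary.Any using (here; there; any?; satisfied)
open import Data.List.Relation.Unary.Unique.Propositional using (Unique)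
open import Data.List.Relation.Unary.Unique.Propositional.Properties using (allFin⁺; cartesianProduct⁺)
open import Data.Nat as ℕ using (zero; suc; z≤n; s≤s; _∸_)
import Data.Nat.Coprimality as Coprimality
open import Data.Nat.DivMod using (_/_; m%n<n; m/n*n≤m; m≡m%n+[m/n]*n; [m+n]%n≡m%n)
import Data.Nat.Properties as ℕₚ
import Data.Nat.Tactic.RingSolver as ℕ-Solver
open import Data.Product using (Σ; _,_; proj₁; proj₂)
open import Data.Product.Properties using (≡-dec)
open import Data.Rational as ℚ using (ℚ; mkℚ; 0ℚ)
import Data.Rational.Properties as ℚₚ
import Data.Rational.Unnormalised as ℚᵘ
import Data.Rational.Unnormalised.Properties as ℚᵘₚ
open import Data.Sum using (inj₁; inj₂)
open import Data.Vec as Vec using (Vec; []; _∷_)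
open import Relation.Binary.Definitions using (DecidableEquality)
open import Relation.Binary.PropositionalEquality using (_≢_; refl; sym; trans; cong; cong₂; subst; module ≡-Reasoning)
open import Relation.Nullary using (Dec; yes; no; contradiction)

-- The weight of x ⊕ y has the parity of |x| + |y|, which the players can compute separately, so a
-- product x y enters the weight only with an even coefficient. Hence the step 2u of the
-- progression, and hence failure of 2-periodicity as the property to exploit.
--
-- Forster's argument usually needs vectors in general position and a limit of linear maps.
-- Integrality replaces both. After clearing denominators every sign condition holds with margin 1,
-- so the row with index (i, c) may be changed from u to M u + e_c, M large, without changing a
-- sign; each of the r blocks of d rows then has determinant 1 modulo M. The limit becomes a finite
-- search over integer row scales l: the potential D^r / ∏ l² is at least 1, because every block
-- contributes to D, and it at least halves whenever a row with more than a 12/r share is scaled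
-- down. Balance up to the constant 12 suffices, since losses polynomial in d only affect the
-- constant in the exponent.

private variable
  A B : Set

-- Finite sums

∑ : List A → (A → ℤ) → ℤ
∑ []       f = 0ℤ
∑ (x ∷ xs) f = f x ℤ.+ ∑ xs f

∑-cong : ∀ (xs : List A) {f g : A → ℤ} → (∀ x → f x ≡ g x) → ∑ xs f ≡ ∑ xs g
∑-cong []       e = refl
∑-cong (x ∷ xs) e = cong₂ ℤ._+_ (e x) (∑-cong xs e)

∑-mono : ∀ (xs : List A) {f g : A → ℤ} → (∀ x → f x ℤ.≤ g x) → ∑ xs f ℤ.≤ ∑ xs g
∑-mono []       e = ℤₚ.≤-refl
∑-mono (x ∷ xs) e = ℤₚ.+-mono-≤ (e x) (∑-mono xs e)

∑-0 : ∀ (xs : List A) {f : A → ℤ} → (∀ x → f x ≡ 0ℤ) → ∑ xs f ≡ 0ℤ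
∑-0 []       e = refl
∑-0 (x ∷ xs) e = cong₂ ℤ._+_ (e x) (∑-0 xs e)

∑-+ : ∀ (xs : List A) (f g : A → ℤ) → ∑ xs (λ x → f x ℤ.+ g x) ≡ ∑ xs f ℤ.+ ∑ xs g
∑-+ []       f g = refl
∑-+ (x ∷ xs) f g = trans (cong (ℤ._+_ (f x ℤ.+ g x)) (∑-+ xs f g)) (interchange (f x) (g x) (∑ xs f) (∑ xs g))
  where
  interchange : ∀ a b c d → a ℤ.+ b ℤ.+ (c ℤ.+ d) ≡ a ℤ.+ c ℤ.+ (b ℤ.+ d)
  interchange = ℤ-Solver.solve-∀

∑-*ˡ : ∀ (xs : List A) c (f : A → ℤ) → ∑ xs (λ x → c ℤ.* f x) ≡ c ℤ.* ∑ xs f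
∑-*ˡ []       c f = sym (ℤₚ.*-zeroʳ c)
∑-*ˡ (x ∷ xs) c f = trans (cong (ℤ._+_ (c ℤ.* f x)) (∑-*ˡ xs c f)) (sym (ℤₚ.*-distribˡ-+ c (f x) (∑ xs f)))

∑-*ʳ : ∀ (xs : List A) c (f : A → ℤ) → ∑ xs (λ x → f x ℤ.* c) ≡ ∑ xs f ℤ.* c
∑-*ʳ xs c f = trans (∑-cong xs (λ x → ℤₚ.*-comm (f x) c)) (trans (∑-*ˡ xs c f) (ℤₚ.*-comm c (∑ xs f)))

∑-const : ∀ (xs : List A) c → ∑ xs (λ _ → c) ≡ + List.length xs ℤ.* c
∑-const []       c = refl
∑-const (x ∷ xs) c = trans (cong (ℤ._+_ c) (∑-const xs c)) (sym (ℤₚ.suc-* (+ List.length xs) c))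

∑-++ : ∀ (xs ys : List A) (f : A → ℤ) → ∑ (xs ++ ys) f ≡ ∑ xs f ℤ.+ ∑ ys f
∑-++ []       ys f = sym (ℤₚ.+-identityˡ _)
∑-++ (x ∷ xs) ys f = trans (cong (ℤ._+_ (f x)) (∑-++ xs ys f)) (sym (ℤₚ.+-assoc (f x) _ _))

∑-map : ∀ (h : A → B) (xs : List A) (f : B → ℤ) → ∑ (List.map h xs) f ≡ ∑ xs (λ x → f (h x))
∑-map h []       f = refl
∑-map h (x ∷ xs) f = cong (ℤ._+_ (f (h x))) (∑-map h xs f)

∑-swap : ∀ (xs : List A) (ys : List B) (f : A → B → ℤ) →
         ∑ xs (λ x → ∑ ys (f x)) ≡ ∑ ys (λ y → ∑ xs (λ x → f x y))
∑-swap []       ys f = sym (∑-0 ys (λ _ → refl))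
∑-swap (x ∷ xs) ys f = trans (cong (ℤ._+_ (∑ ys (f x))) (∑-swap xs ys f)) (sym (∑-+ ys (f x) (λ y → ∑ xs (λ x → f x y))))

∑-* : ∀ (xs : List A) (ys : List B) (f : A → ℤ) (g : B → ℤ) →
      ∑ xs f ℤ.* ∑ ys g ≡ ∑ xs (λ x → ∑ ys (λ y → f x ℤ.* g y))
∑-* xs ys f g = trans (sym (∑-*ʳ xs (∑ ys g) f)) (∑-cong xs (λ x → sym (∑-*ˡ ys (f x) g)))

∑-nonneg : ∀ (xs : List A) {f : A → ℤ} → (∀ x → 0ℤ ℤ.≤ f x) → 0ℤ ℤ.≤ ∑ xs f
∑-nonneg xs {f} e = subst (ℤ._≤ ∑ xs f) (∑-0 xs (λ _ → refl)) (∑-mono xs e)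

∑-term : ∀ {xs : List A} {f : A → ℤ} → (∀ x → 0ℤ ℤ.≤ f x) → ∀ {x} → x ∈ xs → f x ℤ.≤ ∑ xs f
∑-term {xs = z ∷ xs} {f} e (here refl) =
  subst (ℤ._≤ f z ℤ.+ ∑ xs f) (ℤₚ.+-identityʳ (f z)) (ℤₚ.+-monoʳ-≤ (f z) (∑-nonneg xs e))
∑-term {xs = z ∷ xs} {f} e {x} (there x∈) =
  subst (ℤ._≤ f z ℤ.+ ∑ xs f) (ℤₚ.+-identityˡ (f x)) (ℤₚ.+-mono-≤ (e z) (∑-term e x∈))

tuples : List A → (n : ℕ) → List (Vec A n)
tuples xs zero    = [] ∷ []
tuples xs (suc n) = concatMap (λ x → List.map (x ∷_) (tuples xs n)) xs

∑-concatMap : ∀ (h : A → List B) (xs : List A) (f : B → ℤ) → ∑ (concatMap h xs) f ≡ ∑ xs (λ x → ∑ (h x) f)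
∑-concatMap h []       f = refl
∑-concatMap h (x ∷ xs) f = trans (∑-++ (h x) (concatMap h xs) f) (cong (ℤ._+_ (∑ (h x) f)) (∑-concatMap h xs f))

∑-tuples : ∀ (xs : List A) n (f : Vec A (suc n) → ℤ) →
           ∑ (tuples xs (suc n)) f ≡ ∑ xs (λ x → ∑ (tuples xs n) (λ T → f (x ∷ T)))
∑-tuples xs n f = trans (∑-concatMap _ xs f) (∑-cong xs (λ x → ∑-map (x ∷_) (tuples xs n) f))

-- Alternating sums and determinants

-- The cofactor expansion Σ ± f T_i (T without T_i) for an arbitrary f in place of entry times
-- minor. `det` iterates it; tuple entries are the rows and the index k numbers the columns.
alt : ∀ {n} → (A → Vec A n → ℤ) → Vec A (suc n) → ℤ
alt {n = zero}  f (x ∷ T) = f x T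
alt {n = suc n} f (x ∷ T) = f x T ℤ.- alt (λ y T′ → f y (x ∷ T′)) T

alt-cong : ∀ {n} {f g : A → Vec A n → ℤ} → (∀ x T → f x T ≡ g x T) → ∀ T → alt f T ≡ alt g T
alt-cong {n = zero}  e (x ∷ T) = e x T
alt-cong {n = suc n} e (x ∷ T) = cong₂ ℤ._-_ (e x T) (alt-cong (λ y T′ → e y (x ∷ T′)) T)

alt-+ : ∀ {n} (f g : A → Vec A n → ℤ) T → alt (λ x T → f x T ℤ.+ g x T) T ≡ alt f T ℤ.+ alt g T
alt-+ {n = zero}  f g (x ∷ T) = refl
alt-+ {n = suc n} f g (x ∷ T) =
  trans (cong (ℤ._-_ (f x T ℤ.+ g x T)) (alt-+ (λ y T′ → f y (x ∷ T′)) (λ y T′ → g y (x ∷ T′)) T))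
        (interchange (f x T) (g x T) _ _)
  where
  interchange : ∀ a b c d → a ℤ.+ b ℤ.- (c ℤ.+ d) ≡ a ℤ.- c ℤ.+ (b ℤ.- d)
  interchange = ℤ-Solver.solve-∀

alt-minus : ∀ {n} (f g : A → Vec A n → ℤ) T → alt (λ x T → f x T ℤ.- g x T) T ≡ alt f T ℤ.- alt g T
alt-minus {n = zero}  f g (x ∷ T) = refl
alt-minus {n = suc n} f g (x ∷ T) =
  trans (cong (ℤ._-_ (f x T ℤ.- g x T)) (alt-minus (λ y T′ → f y (x ∷ T′)) (λ y T′ → g y (x ∷ T′)) T))
        (interchange (f x T) (g x T) _ _)
  where
  interchange : ∀ a b c d → a ℤ.- b ℤ.- (c ℤ.- d) ≡ a ℤ.- c ℤ.- (b ℤ.- d)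
  interchange = ℤ-Solver.solve-∀

alt-*ˡ : ∀ {n} c (f : A → Vec A n → ℤ) T → alt (λ x T → c ℤ.* f x T) T ≡ c ℤ.* alt f T
alt-*ˡ {n = zero}  c f (x ∷ T) = refl
alt-*ˡ {n = suc n} c f (x ∷ T) =
  trans (cong (ℤ._-_ (c ℤ.* f x T)) (alt-*ˡ c (λ y T′ → f y (x ∷ T′)) T)) (factor c (f x T) _)
  where
  factor : ∀ c a b → c ℤ.* a ℤ.- c ℤ.* b ≡ c ℤ.* (a ℤ.- b)
  factor = ℤ-Solver.solve-∀

alt-0 : ∀ {n} {f : A → Vec A n → ℤ} → (∀ x T → f x T ≡ 0ℤ) → ∀ T → alt f T ≡ 0ℤ
alt-0 {n = zero}  e (x ∷ T) = e x T
alt-0 {n = suc n} e (x ∷ T) = cong₂ ℤ._-_ (e x T) (alt-0 (λ y T′ → e y (x ∷ T′)) T)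

alt-∑ : ∀ {n} (bs : List B) (f : B → A → Vec A n → ℤ) T →
        alt (λ x T → ∑ bs (λ b → f b x T)) T ≡ ∑ bs (λ b → alt (f b) T)
alt-∑ []       f T = alt-0 (λ _ _ → refl) T
alt-∑ (b ∷ bs) f T = trans (alt-+ (f b) (λ x T → ∑ bs (λ b → f b x T)) T) (cong (ℤ._+_ (alt (f b) T)) (alt-∑ bs f T))

-- Removing two entries in the two possible orders gives opposite signs; this is the antisymmetry
-- behind all vanishing determinants below.
alt-alt-swap : ∀ {n} (F : A → A → Vec A n → ℤ) T →
               alt (λ x T → alt (λ y T′ → F x y T′) T) T ≡ ℤ.- alt (λ x T → alt (λ y T′ → F y x T′) T) T
alt-alt-swap {n = zero}  F (x ∷ y ∷ []) = flip (F x y []) (F y x [])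
  where
  flip : ∀ a b → a ℤ.- b ≡ ℤ.- (b ℤ.- a)
  flip = ℤ-Solver.solve-∀
alt-alt-swap {A = A} {n = suc n} F (x ∷ T) = begin
  alt (F x) T ℤ.- alt (λ y T′ → F y x T′ ℤ.- alt (λ z T″ → F y z (x ∷ T″)) T′) T
    ≡⟨ cong (ℤ._-_ a) (alt-minus (λ y T′ → F y x T′) (λ y T′ → alt (λ z T″ → F y z (x ∷ T″)) T′) T) ⟩
  a ℤ.- (b ℤ.- alt (λ y T′ → alt (λ z T″ → F y z (x ∷ T″)) T′) T)
    ≡⟨ cong (λ e → a ℤ.- (b ℤ.- e)) (alt-alt-swap (λ y z T″ → F y z (x ∷ T″)) T) ⟩
  a ℤ.- (b ℤ.- ℤ.- c)
    ≡⟨ rearrange a b c ⟩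
  ℤ.- (b ℤ.- (a ℤ.- c))
    ≡⟨ cong (λ e → ℤ.- (b ℤ.- e)) (alt-minus (F x) (λ y T′ → alt (λ z T″ → F z y (x ∷ T″)) T′) T) ⟨
  ℤ.- (b ℤ.- alt (λ y T′ → F x y T′ ℤ.- alt (λ z T″ → F z y (x ∷ T″)) T′) T) ∎
  where
  open ≡-Reasoning
  a b c : ℤ
  a = alt (F x) T
  b = alt (λ y T′ → F y x T′) T
  c = alt (λ y T′ → alt (λ z T″ → F z y (x ∷ T″)) T′) T
  rearrange : ∀ a b c → a ℤ.- (b ℤ.- ℤ.- c) ≡ ℤ.- (b ℤ.- (a ℤ.- c))
  rearrange = ℤ-Solver.solve-∀

det : ∀ {d} → (Fin d → A → ℤ) → Vec A d → ℤ
det {d = zero}  u T = 1ℤ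
det {d = suc d} u T = alt (λ x T′ → u zero x ℤ.* det (λ k → u (suc k)) T′) T

x≡-x⇒x≡0 : ∀ x → x ≡ ℤ.- x → x ≡ 0ℤ
x≡-x⇒x≡0 (+ zero) _ = refl

-- A (d+1) × (d+1) determinant with two equal columns, expanded along one of them.
alt-coordinate-det : ∀ {d} (u : Fin d → A → ℤ) k T → alt (λ x T′ → u k x ℤ.* det u T′) T ≡ 0ℤ
alt-coordinate-det {d = suc d} u zero T = x≡-x⇒x≡0 _ (begin
  alt (λ x T → u zero x ℤ.* alt (λ y T′ → u zero y ℤ.* det′ T′) T) T
    ≡⟨ alt-cong (λ x T → sym (alt-*ˡ (u zero x) _ T)) T ⟩
  alt (λ x T → alt (λ y T′ → u zero x ℤ.* (u zero y ℤ.* det′ T′)) T) T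
    ≡⟨ alt-alt-swap (λ x y T′ → u zero x ℤ.* (u zero y ℤ.* det′ T′)) T ⟩
  ℤ.- alt (λ x T → alt (λ y T′ → u zero y ℤ.* (u zero x ℤ.* det′ T′)) T) T
    ≡⟨ cong ℤ.-_ (alt-cong (λ x T → trans (alt-cong (λ y T′ → exchange (u zero y) (u zero x) (det′ T′)) T) (alt-*ˡ (u zero x) _ T)) T) ⟩
  ℤ.- alt (λ x T → u zero x ℤ.* alt (λ y T′ → u zero y ℤ.* det′ T′) T) T ∎)
  where
  open ≡-Reasoning
  det′ : Vec _ d → ℤ
  det′ = det (λ k → u (suc k))
  exchange : ∀ a b c → a ℤ.* (b ℤ.* c) ≡ b ℤ.* (a ℤ.* c)
  exchange = ℤ-Solver.solve-∀
alt-coordinate-det {d = suc d} u (suc k) T = begin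
  alt (λ x T → u (suc k) x ℤ.* alt (λ y T′ → u zero y ℤ.* det′ T′) T) T
    ≡⟨ alt-cong (λ x T → sym (alt-*ˡ (u (suc k) x) _ T)) T ⟩
  alt (λ x T → alt (λ y T′ → u (suc k) x ℤ.* (u zero y ℤ.* det′ T′)) T) T
    ≡⟨ alt-alt-swap (λ x y T′ → u (suc k) x ℤ.* (u zero y ℤ.* det′ T′)) T ⟩
  ℤ.- alt (λ x T → alt (λ y T′ → u (suc k) y ℤ.* (u zero x ℤ.* det′ T′)) T) T
    ≡⟨ cong ℤ.-_ (alt-0 (λ x T → trans (trans (alt-cong (λ y T′ → exchange (u (suc k) y) (u zero x) (det′ T′)) T) (alt-*ˡ (u zero x) _ T))
                                     (trans (cong (u zero x ℤ.*_) (alt-coordinate-det (λ k → u (suc k)) k T)) (ℤₚ.*-zeroʳ (u zero x)))) T) ⟩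
  0ℤ ∎
  where
  open ≡-Reasoning
  det′ : Vec _ d → ℤ
  det′ = det (λ k → u (suc k))
  exchange : ∀ a b c → a ℤ.* (b ℤ.* c) ≡ b ℤ.* (a ℤ.* c)
  exchange = ℤ-Solver.solve-∀

combination : ∀ {d} → (Fin d → A → ℤ) → (Fin d → ℤ) → A → ℤ
combination {d = d} u v x = ∑ (List.allFin d) (λ k → u k x ℤ.* v k)

-- Adjoin the combination w as a further column to the matrix with rows x ∷ T. It depends linearly
-- on the other columns, so the determinant vanishes; its expansion along w has the left side as
-- first term and the right side as the rest.
cramer : ∀ {d} (u : Fin (suc d) → A → ℤ) v x T →
         combination u v x ℤ.* det u T ≡ alt (λ y T′ → combination u v y ℤ.* det u (x ∷ T′)) T
cramer {d = d} u v x T = ℤₚ.i-j≡0⇒i≡j _ _ (begin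
  alt (λ y T′ → combination u v y ℤ.* det u T′) (x ∷ T)
    ≡⟨ alt-cong (λ y T′ → trans (sym (∑-*ʳ (List.allFin _) (det u T′) (λ k → u k y ℤ.* v k)))
                                (∑-cong (List.allFin _) (λ k → exchange (u k y) (v k) (det u T′)))) (x ∷ T) ⟩
  alt (λ y T′ → ∑ (List.allFin _) (λ k → v k ℤ.* (u k y ℤ.* det u T′))) (x ∷ T)
    ≡⟨ alt-∑ (List.allFin _) (λ k y T′ → v k ℤ.* (u k y ℤ.* det u T′)) (x ∷ T) ⟩
  ∑ (List.allFin _) (λ k → alt (λ y T′ → v k ℤ.* (u k y ℤ.* det u T′)) (x ∷ T))
    ≡⟨ ∑-0 (List.allFin _) (λ k → trans (alt-*ˡ (v k) (λ y T′ → u k y ℤ.* det u T′) (x ∷ T))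
                                       (trans (cong (v k ℤ.*_) (alt-coordinate-det u k (x ∷ T))) (ℤₚ.*-zeroʳ (v k)))) ⟩
  0ℤ ∎)
  where
  open ≡-Reasoning
  exchange : ∀ a b c → a ℤ.* b ℤ.* c ≡ b ℤ.* (a ℤ.* c)
  exchange = ℤ-Solver.solve-∀

pos : ∀ {n} → (A → Vec A n → ℤ) → Vec A (suc n) → ℤ
pos {n = zero}  f (x ∷ T) = f x T
pos {n = suc n} f (x ∷ T) = f x T ℤ.+ pos (λ y T′ → f y (x ∷ T′)) T

0≤i*i : ∀ i → 0ℤ ℤ.≤ i ℤ.* i
0≤i*i (+ n)        = subst (0ℤ ℤ.≤_) (ℤₚ.pos-* n n) (ℤ.+≤+ z≤n)
0≤i*i (ℤ.-[1+ n ]) = ℤ.+≤+ z≤n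

-- Cauchy-Schwarz for a signed sum of n + 1 terms. In the inductive step the defect, multiplied by
-- `suc n`, is a square plus a multiple of the inductive defect.
alt² : ∀ {n} (f : A → Vec A n → ℤ) T → alt f T ℤ.* alt f T ℤ.≤ + suc n ℤ.* pos (λ x T → f x T ℤ.* f x T) T
alt² {n = zero}  f (x ∷ T) = ℤₚ.≤-reflexive (sym (ℤₚ.*-identityˡ _))
alt² {n = suc n} f (x ∷ T) =
  ℤₚ.*-cancelˡ-≤-pos _ _ (+ suc n) (ℤₚ.0≤i-j⇒j≤i (subst (0ℤ ℤ.≤_) (sym (identity (+ suc n) a b P)) (ℤₚ.+-mono-≤ nonneg₁ nonneg₂)))
  where
  a b P : ℤ
  a = f x T
  b = alt (λ y T′ → f y (x ∷ T′)) T
  P = pos (λ y T′ → f y (x ∷ T′) ℤ.* f y (x ∷ T′)) T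
  nonneg₁ : 0ℤ ℤ.≤ (+ suc n ℤ.* a ℤ.+ b) ℤ.* (+ suc n ℤ.* a ℤ.+ b)
  nonneg₁ = 0≤i*i (+ suc n ℤ.* a ℤ.+ b)
  nonneg₂ : 0ℤ ℤ.≤ + suc (suc n) ℤ.* (+ suc n ℤ.* P ℤ.- b ℤ.* b)
  nonneg₂ = subst (ℤ._≤ + suc (suc n) ℤ.* (+ suc n ℤ.* P ℤ.- b ℤ.* b)) (ℤₚ.*-zeroʳ (+ suc (suc n)))
    (ℤₚ.*-monoˡ-≤-nonNeg (+ suc (suc n)) (ℤₚ.i≤j⇒0≤j-i (alt² (λ y T′ → f y (x ∷ T′)) T)))
  identity : ∀ k a b P → k ℤ.* ((1ℤ ℤ.+ k) ℤ.* (a ℤ.* a ℤ.+ P)) ℤ.- k ℤ.* ((a ℤ.- b) ℤ.* (a ℤ.- b))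
           ≡ (k ℤ.* a ℤ.+ b) ℤ.* (k ℤ.* a ℤ.+ b) ℤ.+ (1ℤ ℤ.+ k) ℤ.* (k ℤ.* P ℤ.- b ℤ.* b)
  identity = ℤ-Solver.solve-∀

-- Each of the n + 1 positions of the removed entry contributes the same sum, because the tuples run
-- through all of xs in every position; `∑-swap` moves the removed entry past the first one.
∑-pos : ∀ (xs : List A) n (f : A → Vec A n → ℤ) →
        ∑ (tuples xs (suc n)) (pos f) ≡ + suc n ℤ.* ∑ xs (λ x → ∑ (tuples xs n) (f x))
∑-pos xs zero    f = trans (∑-tuples xs zero (pos f)) (sym (ℤₚ.*-identityˡ _))
∑-pos xs (suc n) f = begin
  ∑ (tuples xs (suc (suc n))) (pos f)
    ≡⟨ ∑-tuples xs (suc n) (pos f) ⟩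
  ∑ xs (λ x → ∑ (tuples xs (suc n)) (λ T → f x T ℤ.+ pos (λ y T′ → f y (x ∷ T′)) T))
    ≡⟨ ∑-cong xs (λ x → ∑-+ (tuples xs (suc n)) (f x) (pos (λ y T′ → f y (x ∷ T′)))) ⟩
  ∑ xs (λ x → ∑ (tuples xs (suc n)) (f x) ℤ.+ ∑ (tuples xs (suc n)) (pos (λ y T′ → f y (x ∷ T′))))
    ≡⟨ ∑-+ xs (λ x → ∑ (tuples xs (suc n)) (f x)) (λ x → ∑ (tuples xs (suc n)) (pos (λ y T′ → f y (x ∷ T′)))) ⟩
  S ℤ.+ ∑ xs (λ x → ∑ (tuples xs (suc n)) (pos (λ y T′ → f y (x ∷ T′))))
    ≡⟨ cong (ℤ._+_ S) (∑-cong xs (λ x → ∑-pos xs n (λ y T′ → f y (x ∷ T′)))) ⟩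
  S ℤ.+ ∑ xs (λ x → + suc n ℤ.* ∑ xs (λ y → ∑ (tuples xs n) (λ T′ → f y (x ∷ T′))))
    ≡⟨ cong (ℤ._+_ S) (∑-*ˡ xs (+ suc n) (λ x → ∑ xs (λ y → ∑ (tuples xs n) (λ T′ → f y (x ∷ T′))))) ⟩
  S ℤ.+ + suc n ℤ.* ∑ xs (λ x → ∑ xs (λ y → ∑ (tuples xs n) (λ T′ → f y (x ∷ T′))))
    ≡⟨ cong (λ s → S ℤ.+ + suc n ℤ.* s) (∑-swap xs xs (λ x y → ∑ (tuples xs n) (λ T′ → f y (x ∷ T′)))) ⟩
  S ℤ.+ + suc n ℤ.* ∑ xs (λ y → ∑ xs (λ x → ∑ (tuples xs n) (λ T′ → f y (x ∷ T′))))
    ≡⟨ cong (λ s → S ℤ.+ + suc n ℤ.* s) (∑-cong xs (λ y → sym (∑-tuples xs n (f y)))) ⟩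
  S ℤ.+ + suc n ℤ.* S
    ≡⟨ sym (ℤₚ.suc-* (+ suc n) S) ⟩
  + suc (suc n) ℤ.* S ∎
  where
  open ≡-Reasoning
  S : ℤ
  S = ∑ xs (λ x → ∑ (tuples xs (suc n)) (f x))

-- Sums of squared determinants

-- By Cauchy-Binet, d! times the Gram determinant of the columns of u. Ordered tuples with
-- repetition let the first entry be split off freely; a repeated entry gives determinant 0.
volume : ∀ {d} → List A → (Fin d → A → ℤ) → ℤ
volume {d = d} xs u = ∑ (tuples xs d) (λ T → det u T ℤ.* det u T)

-- By linearity in the first row, the determinant whose first row is Σ γ_x u_x.
contraction : ∀ {d} → (Fin (suc d) → A → ℤ) → List A → (A → ℤ) → Vec A d → ℤ
contraction u zs γ T = ∑ zs (λ x → γ x ℤ.* det u (x ∷ T))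

-- For positive volume, the ratio of energy to volume is 1/(d+1) times the squared length of the
-- projection of γ to the column space. For γ concentrated at one row it is that row's leverage
-- score over d + 1.
energy : ∀ {d} → List A → (Fin (suc d) → A → ℤ) → List A → (A → ℤ) → ℤ
energy {d = d} xs u zs γ = ∑ (tuples xs d) (λ T → contraction u zs γ T ℤ.* contraction u zs γ T)

pairing-bound : ∀ {d} (xs zs : List A) (u : Fin (suc d) → A → ℤ) v (γ : A → ℤ) →
  let w = combination u v
      I = ∑ zs (λ x → γ x ℤ.* w x)
  in I ℤ.* I ℤ.* volume xs u ℤ.≤ + suc d ℤ.* (+ suc d ℤ.* (∑ xs (λ x → w x ℤ.* w x) ℤ.* energy xs u zs γ))
pairing-bound {d = d} xs zs u v γ = begin
  I ℤ.* I ℤ.* volume xs u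
    ≡⟨ ∑-*ˡ (tuples xs (suc d)) (I ℤ.* I) (λ T → det u T ℤ.* det u T) ⟨
  ∑ (tuples xs (suc d)) (λ T → I ℤ.* I ℤ.* (det u T ℤ.* det u T))
    ≡⟨ ∑-cong (tuples xs (suc d)) (λ T → trans (square-* I (det u T)) (cong (λ a → a ℤ.* a) (expand T))) ⟩
  ∑ (tuples xs (suc d)) (λ T → alt f T ℤ.* alt f T)
    ≤⟨ ∑-mono (tuples xs (suc d)) (alt² f) ⟩
  ∑ (tuples xs (suc d)) (λ T → + suc d ℤ.* pos (λ y T′ → f y T′ ℤ.* f y T′) T)
    ≡⟨ ∑-*ˡ (tuples xs (suc d)) (+ suc d) (pos (λ y T′ → f y T′ ℤ.* f y T′)) ⟩
  + suc d ℤ.* ∑ (tuples xs (suc d)) (pos (λ y T′ → f y T′ ℤ.* f y T′))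
    ≡⟨ cong (+ suc d ℤ.*_) (∑-pos xs d (λ y T′ → f y T′ ℤ.* f y T′)) ⟩
  + suc d ℤ.* (+ suc d ℤ.* ∑ xs (λ y → ∑ (tuples xs d) (λ T′ → f y T′ ℤ.* f y T′)))
    ≡⟨ cong (λ s → + suc d ℤ.* (+ suc d ℤ.* s)) factor ⟩
  + suc d ℤ.* (+ suc d ℤ.* (∑ xs (λ x → w x ℤ.* w x) ℤ.* energy xs u zs γ)) ∎
  where
  open ℤₚ.≤-Reasoning
  w : _ → ℤ
  w = combination u v
  I : ℤ
  I = ∑ zs (λ x → γ x ℤ.* w x)
  f : _ → Vec _ d → ℤ
  f y T′ = w y ℤ.* contraction u zs γ T′
  square-* : ∀ a b → a ℤ.* a ℤ.* (b ℤ.* b) ≡ a ℤ.* b ℤ.* (a ℤ.* b)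
  square-* = ℤ-Solver.solve-∀
  exchange : ∀ a b c → a ℤ.* (b ℤ.* c) ≡ b ℤ.* (a ℤ.* c)
  exchange = ℤ-Solver.solve-∀
  -- Cramer's rule paired with γ: the sum over x passes inside `alt` and turns the determinants into
  -- `contraction`.
  expand : ∀ T → I ℤ.* det u T ≡ alt f T
  expand T =
    trans (sym (∑-*ʳ zs (det u T) (λ x → γ x ℤ.* w x)))
    (trans (∑-cong zs (λ x → trans (ℤₚ.*-assoc (γ x) (w x) (det u T))
                            (trans (cong (γ x ℤ.*_) (cramer u v x T))
                                   (sym (alt-*ˡ (γ x) (λ y T′ → w y ℤ.* det u (x ∷ T′)) T)))))
    (trans (sym (alt-∑ zs (λ x y T′ → γ x ℤ.* (w y ℤ.* det u (x ∷ T′))) T))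
           (alt-cong (λ y T′ → trans (∑-cong zs (λ x → exchange (γ x) (w y) (det u (x ∷ T′))))
                                     (∑-*ˡ zs (w y) (λ x → γ x ℤ.* det u (x ∷ T′)))) T)))
  factor : ∑ xs (λ y → ∑ (tuples xs d) (λ T′ → f y T′ ℤ.* f y T′)) ≡ ∑ xs (λ x → w x ℤ.* w x) ℤ.* energy xs u zs γ
  factor = trans (∑-cong xs (λ y → trans (∑-cong (tuples xs d) (λ T′ → sym (square-* (w y) (contraction u zs γ T′))))
                                         (∑-*ˡ (tuples xs d) (w y ℤ.* w y) _)))
                 (∑-*ʳ xs (energy xs u zs γ) (λ y → w y ℤ.* w y))

-- Sums, products and growth estimates in ℕ

∑ᴺ : List A → (A → ℕ) → ℕ
∑ᴺ []       f = 0
∑ᴺ (x ∷ xs) f = f x + ∑ᴺ xs f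

∏ᴺ : List A → (A → ℕ) → ℕ
∏ᴺ []       f = 1
∏ᴺ (x ∷ xs) f = f x * ∏ᴺ xs f

∑ᴺ-mono : ∀ (xs : List A) {f g : A → ℕ} → (∀ x → f x ≤ g x) → ∑ᴺ xs f ≤ ∑ᴺ xs g
∑ᴺ-mono []       e = z≤n
∑ᴺ-mono (x ∷ xs) e = ℕₚ.+-mono-≤ (e x) (∑ᴺ-mono xs e)

∑ᴺ-*ˡ : ∀ (xs : List A) c (f : A → ℕ) → ∑ᴺ xs (λ x → c * f x) ≡ c * ∑ᴺ xs f
∑ᴺ-*ˡ []       c f = sym (ℕₚ.*-zeroʳ c)
∑ᴺ-*ˡ (x ∷ xs) c f = trans (cong (_+_ (c * f x)) (∑ᴺ-*ˡ xs c f)) (sym (ℕₚ.*-distribˡ-+ c (f x) (∑ᴺ xs f)))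

∑ᴺ-term : ∀ {xs : List A} (f : A → ℕ) {x} → x ∈ xs → f x ≤ ∑ᴺ xs f
∑ᴺ-term {xs = z ∷ xs} f (here refl) = ℕₚ.m≤m+n (f z) _
∑ᴺ-term {xs = z ∷ xs} f (there x∈)  = ℕₚ.≤-trans (∑ᴺ-term f x∈) (ℕₚ.m≤n+m _ (f z))

∏ᴺ-++ : ∀ (xs ys : List A) f → ∏ᴺ (xs ++ ys) f ≡ ∏ᴺ xs f * ∏ᴺ ys f
∏ᴺ-++ []       ys f = sym (ℕₚ.*-identityˡ _)
∏ᴺ-++ (x ∷ xs) ys f = trans (cong (f x *_) (∏ᴺ-++ xs ys f)) (sym (ℕₚ.*-assoc (f x) _ _))

∏ᴺ-1 : ∀ (xs : List A) {f : A → ℕ} → (∀ x → f x ≡ 1) → ∏ᴺ xs f ≡ 1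
∏ᴺ-1 []       e = refl
∏ᴺ-1 (x ∷ xs) e = cong₂ _*_ (e x) (∏ᴺ-1 xs e)

∏ⱽ : ∀ {n} → (A → ℕ) → Vec A n → ℕ
∏ⱽ c []      = 1
∏ⱽ c (x ∷ T) = c x * ∏ⱽ c T

∏ⱽ-tabulate : ∀ {n} (c : A → ℕ) (h : Fin n → A) → ∏ⱽ c (Vec.tabulate h) ≡ ∏ᴺ (List.tabulate h) c
∏ⱽ-tabulate {n = zero}  c h = refl
∏ⱽ-tabulate {n = suc n} c h = cong (c (h zero) *_) (∏ⱽ-tabulate c (λ i → h (suc i)))

∈-tuples : ∀ {xs : List A} → (∀ x → x ∈ xs) → ∀ {n} (T : Vec A n) → T ∈ tuples xs n
∈-tuples complete []      = here refl
∈-tuples complete (x ∷ T) = ∈-concatMap⁺ (λ x → List.map (x ∷_) (tuples _ _)) (lose (complete x) (∈-map⁺ (x ∷_) (∈-tuples complete T)))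

^-distrib-* : ∀ a b n → (a * b) ^ n ≡ a ^ n * b ^ n
^-distrib-* a b zero    = refl
^-distrib-* a b (suc n) = trans (cong (a * b *_) (^-distrib-* a b n)) (ℕₚ.[m*n]*[o*p]≡[m*o]*[n*p] a b (a ^ n) (b ^ n))

n<2^n : ∀ n → n < 2 ^ n
n<2^n zero    = s≤s z≤n
n<2^n (suc n) = ℕₚ.≤-trans (ℕₚ.+-mono-≤ (ℕₚ.m^n>0 2 n) (n<2^n n))
                           (ℕₚ.≤-reflexive (cong (_+_ (2 ^ n)) (sym (ℕₚ.+-identityʳ (2 ^ n)))))

-- Bernoulli's inequality 1 + n b/a ≤ (1 + b/a)^n with denominators cleared.
bernoulli : ∀ a b n → a ^ n * (a + n * b) ≤ (a + b) ^ n * a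
bernoulli a b zero    = ℕₚ.≤-reflexive (cong (1 *_) (ℕₚ.+-identityʳ a))
bernoulli a b (suc n) = begin
  a * a ^ n * (a + (b + n * b))       ≤⟨ ℕₚ.m≤m+n _ (a ^ n * b * (n * b)) ⟩
  a * a ^ n * (a + (b + n * b)) + a ^ n * b * (n * b) ≡⟨ identity a b (n * b) (a ^ n) ⟩
  (a + b) * (a ^ n * (a + n * b))     ≤⟨ ℕₚ.*-monoʳ-≤ (a + b) (bernoulli a b n) ⟩
  (a + b) * ((a + b) ^ n * a)         ≡⟨ ℕₚ.*-assoc (a + b) _ a ⟨
  (a + b) * (a + b) ^ n * a           ∎
  where
  open ℕₚ.≤-Reasoning
  identity : ∀ a b nb p → a * p * (a + (b + nb)) + p * b * nb ≡ (a + b) * (p * (a + nb))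
  identity = ℕ-Solver.solve-∀

-- Bernoulli gives (1 + 9/r)^r ≥ 10, for every r.
bernoulli-9 : ∀ r x y → 0 < r → (r + 9) * x ≤ r * y → 10 * x ^ r ≤ y ^ r
bernoulli-9 r@(suc _) x y _ le = ℕₚ.*-cancelˡ-≤ (r ^ r) {{ℕₚ.m^n≢0 r r}} (ℕₚ.*-cancelʳ-≤ _ _ r (begin
  r ^ r * (10 * x ^ r) * r          ≡⟨ identity r (r ^ r) (x ^ r) ⟩
  r ^ r * (r + r * 9) * x ^ r       ≤⟨ ℕₚ.*-monoˡ-≤ (x ^ r) (bernoulli r 9 r) ⟩
  (r + 9) ^ r * r * x ^ r           ≡⟨ exchange ((r + 9) ^ r) r (x ^ r) ⟩
  (r + 9) ^ r * x ^ r * r           ≡⟨ cong (_* r) (^-distrib-* (r + 9) x r) ⟨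
  ((r + 9) * x) ^ r * r             ≤⟨ ℕₚ.*-monoˡ-≤ r (ℕₚ.^-monoˡ-≤ r le) ⟩
  (r * y) ^ r * r                   ≡⟨ cong (_* r) (^-distrib-* r y r) ⟩
  r ^ r * y ^ r * r                 ∎))
  where
  open ℕₚ.≤-Reasoning
  identity : ∀ r p q → p * (10 * q) * r ≡ p * (r + r * 9) * q
  identity = ℕ-Solver.solve-∀
  exchange : ∀ a b c → a * b * c ≡ a * c * b
  exchange = ℕ-Solver.solve-∀

-- Balancing the leverage scores

square : (A → ℕ) → A → ℕ
square l x = l x * l x

-- With ω = det², this is the part of volume (l · u) coming from tuples whose first entry is x.
leverage : ∀ {d} → List A → (Vec A (suc d) → ℕ) → (A → ℕ) → A → ℕ
leverage {d = d} xs ω l x = square l x * ∑ᴺ (tuples xs d) (λ T → ∏ⱽ (square l) T * ω (x ∷ T))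

mass : ∀ {d} → List A → (Vec A (suc d) → ℕ) → (A → ℕ) → ℕ
mass xs ω l = ∑ᴺ xs (leverage xs ω l)

-- Up to a common factor this halves the scale of x; doubling all the others keeps the scales
-- integral.
double : DecidableEquality A → A → (A → ℕ) → A → ℕ
double _≟_ x l z with z ≟ x
... | yes _ = l z
... | no  _ = 2 * l z

4-square : ∀ a → 2 * a * (2 * a) ≡ 4 * (a * a)
4-square = ℕ-Solver.solve-∀

square-double-≤ : ∀ (_≟_ : DecidableEquality A) x l z → square (double _≟_ x l) z ≤ 4 * square l z
square-double-≤ _≟_ x l z with z ≟ x
... | yes _ = ℕₚ.m≤m+n (square l z) _
... | no  _ = ℕₚ.≤-reflexive (4-square (l z))

square-double-self : ∀ (_≟_ : DecidableEquality A) x l → square (double _≟_ x l) x ≡ square l x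
square-double-self _≟_ x l with x ≟ x
... | yes _  = refl
... | no x≢x = contradiction refl x≢x

square-double-other : ∀ (_≟_ : DecidableEquality A) x l {z} → z ≢ x → square (double _≟_ x l) z ≡ 4 * square l z
square-double-other _≟_ x l {z} z≢x with z ≟ x
... | yes z≡x = contradiction z≡x z≢x
... | no  _   = 4-square (l z)

∏ⱽ-double-≤ : ∀ (_≟_ : DecidableEquality A) x l {n} (T : Vec A n) →
              ∏ⱽ (square (double _≟_ x l)) T ≤ 4 ^ n * ∏ⱽ (square l) T
∏ⱽ-double-≤ _≟_ x l []      = ℕₚ.≤-refl
∏ⱽ-double-≤ _≟_ x l {suc n} (z ∷ T) = ℕₚ.≤-trans (ℕₚ.*-mono-≤ (square-double-≤ _≟_ x l z) (∏ⱽ-double-≤ _≟_ x l T))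
  (ℕₚ.≤-reflexive (ℕₚ.[m*n]*[o*p]≡[m*o]*[n*p] 4 (square l z) (4 ^ n) (∏ⱽ (square l) T)))

∏ᴺ-double-∉ : ∀ (_≟_ : DecidableEquality A) x l {zs} → All (x ≢_) zs →
              ∏ᴺ zs (square (double _≟_ x l)) ≡ 4 ^ List.length zs * ∏ᴺ zs (square l)
∏ᴺ-double-∉ _≟_ x l []        = refl
∏ᴺ-double-∉ _≟_ x l {z ∷ zs} (p ∷ ps) =
  trans (cong₂ _*_ (square-double-other _≟_ x l (λ z≡x → p (sym z≡x))) (∏ᴺ-double-∉ _≟_ x l ps))
        (ℕₚ.[m*n]*[o*p]≡[m*o]*[n*p] 4 (square l z) (4 ^ List.length zs) (∏ᴺ zs (square l)))

-- By uniqueness x occurs at most once, so at most one factor 4 is missing.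
∏ᴺ-double : ∀ (_≟_ : DecidableEquality A) x l {zs} → Unique zs →
            4 ^ List.length zs * ∏ᴺ zs (square l) ≤ 4 * ∏ᴺ zs (square (double _≟_ x l))
∏ᴺ-double _≟_ x l [] = s≤s z≤n
∏ᴺ-double _≟_ x l {z ∷ zs} (z∉ ∷ uniq) = cases (z ≟ x)
  where
  open ℕₚ.≤-Reasoning
  Π Π′ : ℕ
  Π  = ∏ᴺ zs (square l)
  Π′ = ∏ᴺ zs (square (double _≟_ x l))
  identity₁ : ∀ p a b → 4 * p * (a * b) ≡ 4 * (a * (p * b))
  identity₁ = ℕ-Solver.solve-∀
  identity₂ : ∀ a b → a * (4 * b) ≡ 4 * (a * b)
  identity₂ = ℕ-Solver.solve-∀
  cases : Dec (z ≡ x) → 4 * 4 ^ List.length zs * (square l z * Π) ≤ 4 * (square (double _≟_ x l) z * Π′)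
  cases (yes refl) = begin
    4 * 4 ^ List.length zs * (square l z * Π)     ≡⟨ identity₁ (4 ^ List.length zs) (square l z) Π ⟩
    4 * (square l z * (4 ^ List.length zs * Π))   ≡⟨ cong₂ (λ a b → 4 * (a * b)) (square-double-self _≟_ z l) (∏ᴺ-double-∉ _≟_ z l z∉) ⟨
    4 * (square (double _≟_ x l) z * Π′)          ∎
  cases (no z≢x) = begin
    4 * 4 ^ List.length zs * (square l z * Π)     ≡⟨ ℕₚ.[m*n]*[o*p]≡[m*o]*[n*p] 4 (square l z) (4 ^ List.length zs) Π ⟨
    4 * square l z * (4 ^ List.length zs * Π)     ≤⟨ ℕₚ.*-monoʳ-≤ (4 * square l z) (∏ᴺ-double _≟_ x l uniq) ⟩
    4 * square l z * (4 * Π′)                     ≡⟨ identity₂ (4 * square l z) Π′ ⟩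
    4 * (4 * square l z * Π′)                     ≡⟨ cong (λ a → 4 * (a * Π′)) (square-double-other _≟_ x l z≢x) ⟨
    4 * (square (double _≟_ x l) z * Π′)          ∎

inner-double : ∀ (_≟_ : DecidableEquality A) x l xs {d} (ω : Vec A (suc d) → ℕ) z →
  ∑ᴺ (tuples xs d) (λ T → ∏ⱽ (square (double _≟_ x l)) T * ω (z ∷ T))
  ≤ 4 ^ d * ∑ᴺ (tuples xs d) (λ T → ∏ⱽ (square l) T * ω (z ∷ T))
inner-double _≟_ x l xs {d} ω z = ℕₚ.≤-trans
  (∑ᴺ-mono (tuples xs d) (λ T → ℕₚ.≤-trans (ℕₚ.*-monoˡ-≤ (ω (z ∷ T)) (∏ⱽ-double-≤ _≟_ x l T))
                                           (ℕₚ.≤-reflexive (ℕₚ.*-assoc (4 ^ d) _ _))))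
  (ℕₚ.≤-reflexive (∑ᴺ-*ˡ (tuples xs d) (4 ^ d) _))

leverage-double : ∀ (_≟_ : DecidableEquality A) x l xs {d} (ω : Vec A (suc d) → ℕ) z →
  leverage xs ω (double _≟_ x l) z ≤ 4 ^ suc d * leverage xs ω l z
leverage-double _≟_ x l xs {d} ω z = ℕₚ.≤-trans
  (ℕₚ.*-mono-≤ (square-double-≤ _≟_ x l z) (inner-double _≟_ x l xs ω z))
  (ℕₚ.≤-reflexive (ℕₚ.[m*n]*[o*p]≡[m*o]*[n*p] 4 (square l z) (4 ^ d) _))

leverage-double-self : ∀ (_≟_ : DecidableEquality A) x l xs {d} (ω : Vec A (suc d) → ℕ) →
  4 * leverage xs ω (double _≟_ x l) x ≤ 4 ^ suc d * leverage xs ω l x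
leverage-double-self _≟_ x l xs {d} ω = ℕₚ.≤-trans
  (ℕₚ.*-monoʳ-≤ 4 (ℕₚ.*-mono-≤ (ℕₚ.≤-reflexive (square-double-self _≟_ x l)) (inner-double _≟_ x l xs ω x)))
  (ℕₚ.≤-reflexive (identity (4 ^ d) (square l x) _))
  where
  identity : ∀ p a b → 4 * (a * (p * b)) ≡ 4 * p * (a * b)
  identity = ℕ-Solver.solve-∀

-- Tuples beginning with x gain at most 4^d instead of 4^(d+1), so at least three quarters of the
-- leverage of x is lost against the uniform growth of the mass.
mass-double : ∀ (_≟_ : DecidableEquality A) x l xs {d} (ω : Vec A (suc d) → ℕ) {zs} → x ∈ zs →
  4 * ∑ᴺ zs (leverage xs ω (double _≟_ x l)) + 3 * (4 ^ suc d * leverage xs ω l x)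
  ≤ 4 * (4 ^ suc d * ∑ᴺ zs (leverage xs ω l))
mass-double _≟_ x l xs {d} ω {z ∷ zs} (here refl) = begin
  4 * (E′ + S′) + 3 * (Q * E)       ≡⟨ identity₁ E′ S′ (Q * E) ⟩
  4 * E′ + 4 * S′ + 3 * (Q * E)     ≤⟨ ℕₚ.+-monoˡ-≤ (3 * (Q * E)) (ℕₚ.+-mono-≤ (leverage-double-self _≟_ x l xs ω) (ℕₚ.*-monoʳ-≤ 4 all-double)) ⟩
  Q * E + 4 * (Q * S) + 3 * (Q * E) ≡⟨ identity₂ Q E S ⟩
  4 * (Q * (E + S))                 ∎
  where
  open ℕₚ.≤-Reasoning
  E E′ S S′ Q : ℕ
  E  = leverage xs ω l x
  E′ = leverage xs ω (double _≟_ x l) x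
  S  = ∑ᴺ zs (leverage xs ω l)
  S′ = ∑ᴺ zs (leverage xs ω (double _≟_ x l))
  Q  = 4 ^ suc d
  all-double : S′ ≤ Q * S
  all-double = ℕₚ.≤-trans (∑ᴺ-mono zs (leverage-double _≟_ x l xs ω)) (ℕₚ.≤-reflexive (∑ᴺ-*ˡ zs Q _))
  identity₁ : ∀ a b c → 4 * (a + b) + 3 * c ≡ 4 * a + 4 * b + 3 * c
  identity₁ = ℕ-Solver.solve-∀
  identity₂ : ∀ q a b → q * a + 4 * (q * b) + 3 * (q * a) ≡ 4 * (q * (a + b))
  identity₂ = ℕ-Solver.solve-∀
mass-double _≟_ x l xs {d} ω {z ∷ zs} (there x∈) = begin
  4 * (Ez′ + S′) + 3 * (Q * E)      ≡⟨ identity₁ Ez′ S′ (Q * E) ⟩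
  4 * Ez′ + (4 * S′ + 3 * (Q * E))  ≤⟨ ℕₚ.+-mono-≤ (ℕₚ.*-monoʳ-≤ 4 (leverage-double _≟_ x l xs ω z)) (mass-double _≟_ x l xs ω x∈) ⟩
  4 * (Q * Ez) + 4 * (Q * S)        ≡⟨ identity₂ Q Ez S ⟩
  4 * (Q * (Ez + S))                ∎
  where
  open ℕₚ.≤-Reasoning
  E Ez Ez′ S S′ Q : ℕ
  E   = leverage xs ω l x
  Ez  = leverage xs ω l z
  Ez′ = leverage xs ω (double _≟_ x l) z
  S   = ∑ᴺ zs (leverage xs ω l)
  S′  = ∑ᴺ zs (leverage xs ω (double _≟_ x l))
  Q   = 4 ^ suc d
  identity₁ : ∀ a b c → 4 * (a + b) + 3 * c ≡ 4 * a + (4 * b + 3 * c)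
  identity₁ = ℕ-Solver.solve-∀
  identity₂ : ∀ q a b → 4 * (q * a) + 4 * (q * b) ≡ 4 * (q * (a + b))
  identity₂ = ℕ-Solver.solve-∀

double-positive : ∀ (_≟_ : DecidableEquality A) x l → (∀ z → 1 ≤ l z) → ∀ z → 1 ≤ double _≟_ x l z
double-positive _≟_ x l l≥1 z with z ≟ x
... | yes _ = l≥1 z
... | no  _ = ℕₚ.≤-trans (l≥1 z) (ℕₚ.m≤m+n (l z) _)

-- Doubling every scale but that of x multiplies massʳ / ∏ l² by at most 4 / 10.
potential-drop : ∀ (_≟_ : DecidableEquality A) {xs : List A} (complete : ∀ x → x ∈ xs) (uniq : Unique xs)
  {d} (ω : Vec A (suc d) → ℕ) r → 0 < r → List.length xs ≡ r * suc d →
  ∀ f l x → 12 * mass xs ω l < r * leverage xs ω l x →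
  mass xs ω l ^ r < 2 ^ suc f * ∏ᴺ xs (square l) →
  mass xs ω (double _≟_ x l) ^ r < 2 ^ f * ∏ᴺ xs (square (double _≟_ x l))
potential-drop _≟_ {xs} complete uniq {d} ω r 0<r len f l x bad below =
  -- 8 = 4 * 2: the factor 4 pays for the undoubled scale of x in the product, the factor 2 for one
  -- unit of f.
  ℕₚ.*-cancelˡ-< 8 _ _ (begin-strict
    8 * D′ ^ r                       ≤⟨ ℕₚ.*-monoˡ-≤ (D′ ^ r) (ℕₚ.m≤m+n 8 2) ⟩
    10 * D′ ^ r                      ≤⟨ bernoulli-9 r D′ (Q * D) 0<r drop ⟩
    (Q * D) ^ r                      ≡⟨ ^-distrib-* Q D r ⟩
    Q ^ r * D ^ r                    <⟨ ℕₚ.*-monoʳ-< (Q ^ r) {{ℕₚ.m^n≢0 Q r {{ℕₚ.m^n≢0 4 (suc d)}}}} below ⟩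
    Q ^ r * (2 * 2 ^ f * Π)          ≡⟨ cong (_* (2 * 2 ^ f * Π)) Q^r ⟩
    4 ^ List.length xs * (2 * 2 ^ f * Π) ≡⟨ identity₁ (4 ^ List.length xs) (2 ^ f) Π ⟩
    2 * 2 ^ f * (4 ^ List.length xs * Π) ≤⟨ ℕₚ.*-monoʳ-≤ (2 * 2 ^ f) (∏ᴺ-double _≟_ x l uniq) ⟩
    2 * 2 ^ f * (4 * Π′)             ≡⟨ identity₂ (2 ^ f) Π′ ⟩
    8 * (2 ^ f * Π′)                 ∎)
  where
  open ℕₚ.≤-Reasoning
  D D′ Q Π Π′ E : ℕ
  D  = mass xs ω l
  D′ = mass xs ω (double _≟_ x l)
  E  = leverage xs ω l x
  Q  = 4 ^ suc d
  Π  = ∏ᴺ xs (square l)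
  Π′ = ∏ᴺ xs (square (double _≟_ x l))
  Q^r : Q ^ r ≡ 4 ^ List.length xs
  Q^r = trans (ℕₚ.^-*-assoc 4 (suc d) r) (cong (4 ^_) (trans (ℕₚ.*-comm (suc d) r) (sym len)))
  D′≤QD : D′ ≤ Q * D
  D′≤QD = ℕₚ.≤-trans (∑ᴺ-mono xs (leverage-double _≟_ x l xs ω)) (ℕₚ.≤-reflexive (∑ᴺ-*ˡ xs Q _))
  -- Three quarters of a share above 12/r is a fraction 9/r of the mass, so the mass falls below Q D
  -- by the factor 1 + 9/r. The r-th power of this factor is at least 10, hence above the 8 that is
  -- required.
  drop : (r + 9) * D′ ≤ r * (Q * D)
  drop = ℕₚ.*-cancelˡ-≤ 4 (begin
    4 * ((r + 9) * D′)               ≡⟨ identity₃ r D′ ⟩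
    r * (4 * D′) + 36 * D′           ≤⟨ ℕₚ.+-monoʳ-≤ (r * (4 * D′)) (ℕₚ.*-monoʳ-≤ 36 D′≤QD) ⟩
    r * (4 * D′) + 36 * (Q * D)      ≡⟨ cong (_+_ (r * (4 * D′))) (identity₄ Q D) ⟩
    r * (4 * D′) + 3 * (Q * (12 * D)) ≤⟨ ℕₚ.+-monoʳ-≤ (r * (4 * D′)) (ℕₚ.*-monoʳ-≤ 3 (ℕₚ.*-monoʳ-≤ Q (ℕₚ.<⇒≤ bad))) ⟩
    r * (4 * D′) + 3 * (Q * (r * E)) ≡⟨ identity₅ r D′ Q E ⟩
    r * (4 * D′ + 3 * (Q * E))       ≤⟨ ℕₚ.*-monoʳ-≤ r (mass-double _≟_ x l xs ω (complete x)) ⟩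
    r * (4 * (Q * D))                ≡⟨ identity₆ r (Q * D) ⟩
    4 * (r * (Q * D))                ∎)
    where
    identity₃ : ∀ r a → 4 * ((r + 9) * a) ≡ r * (4 * a) + 36 * a
    identity₃ = ℕ-Solver.solve-∀
    identity₄ : ∀ q a → 36 * (q * a) ≡ 3 * (q * (12 * a))
    identity₄ = ℕ-Solver.solve-∀
    identity₅ : ∀ r a q e → r * (4 * a) + 3 * (q * (r * e)) ≡ r * (4 * a + 3 * (q * e))
    identity₅ = ℕ-Solver.solve-∀
    identity₆ : ∀ r a → r * (4 * a) ≡ 4 * (r * a)
    identity₆ = ℕ-Solver.solve-∀
  identity₁ : ∀ q f p → q * (2 * f * p) ≡ 2 * f * (q * p)
  identity₁ = ℕ-Solver.solve-∀
  identity₂ : ∀ f p → 2 * f * (4 * p) ≡ 8 * (f * p)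
  identity₂ = ℕ-Solver.solve-∀

-- The fuel f bounds the binary logarithm of the potential. Each bad row costs one unit, and `lower`
-- keeps the potential at 1 or more, so a balanced scaling appears before the fuel runs out.
search : ∀ (_≟_ : DecidableEquality A) {xs : List A} (complete : ∀ x → x ∈ xs) (uniq : Unique xs)
  {d} (ω : Vec A (suc d) → ℕ) r → 0 < r → List.length xs ≡ r * suc d →
  (∀ l → ∏ᴺ xs (square l) ≤ mass xs ω l ^ r) →
  ∀ f l → (∀ x → 1 ≤ l x) → mass xs ω l ^ r < 2 ^ f * ∏ᴺ xs (square l) →
  ∃[ l′ ] ((∀ x → 1 ≤ l′ x) × (∀ x → r * leverage xs ω l′ x ≤ 12 * mass xs ω l′))
search _≟_ complete uniq ω r 0<r len lower zero l l≥1 below =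
  contradiction (ℕₚ.<-≤-trans below (ℕₚ.≤-trans (ℕₚ.≤-reflexive (ℕₚ.*-identityˡ _)) (lower l))) (ℕₚ.<-irrefl refl)
search _≟_ {xs} complete uniq ω r 0<r len lower (suc f) l l≥1 below
  with any? (λ x → 12 * mass xs ω l ℕ.<? r * leverage xs ω l x) xs
... | no none = l , l≥1 , λ x → ℕₚ.≮⇒≥ (λ bad → none (lose (complete x) bad))
... | yes some with satisfied some
...   | x , bad = search _≟_ complete uniq ω r 0<r len lower f (double _≟_ x l) (double-positive _≟_ x l l≥1)
                    (potential-drop _≟_ complete uniq ω r 0<r len f l x bad below)

-- The r (d+1) shares of the mass sum to 1, so the allowance 12/r exceeds the average share by a
-- factor of order d + 1. That slack is paid for in powers of the dimension.
balanced-scaling : ∀ (_≟_ : DecidableEquality A) {xs : List A} (complete : ∀ x → x ∈ xs) (uniq : Unique xs)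
  {d} (ω : Vec A (suc d) → ℕ) r → 0 < r → List.length xs ≡ r * suc d →
  (∀ l → ∏ᴺ xs (square l) ≤ mass xs ω l ^ r) →
  ∃[ l ] ((∀ x → 1 ≤ l x) × (∀ x → r * leverage xs ω l x ≤ 12 * mass xs ω l))
balanced-scaling _≟_ {xs} complete uniq ω r 0<r len lower =
  -- With all scales 1 the potential is D^r, and D^r < 2^(D^r) makes D^r itself enough fuel.
  search _≟_ complete uniq ω r 0<r len lower (D ^ r) (λ _ → 1) (λ _ → ℕₚ.≤-refl)
    (subst (λ p → D ^ r < 2 ^ (D ^ r) * p) (sym (∏ᴺ-1 xs (λ _ → refl)))
      (subst (D ^ r <_) (sym (ℕₚ.*-identityʳ _)) (n<2^n (D ^ r))))
  where
  D : ℕ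
  D = mass xs ω (λ _ → 1)

-- Flat vectors and the lower bound on the energy

*-monoˡ-≤-0≤ : ∀ {c a b} → 0ℤ ℤ.≤ c → a ℤ.≤ b → c ℤ.* a ℤ.≤ c ℤ.* b
*-monoˡ-≤-0≤ {c} 0≤c = ℤₚ.*-monoˡ-≤-nonNeg c {{ℤ.nonNegative 0≤c}}

*-cancelˡ-≤-0< : ∀ {c a b} → 0ℤ ℤ.< c → c ℤ.* a ℤ.≤ c ℤ.* b → a ℤ.≤ b
*-cancelˡ-≤-0< {c} 0<c = ℤₚ.*-cancelˡ-≤-pos _ _ c {{ℤ.positive 0<c}}

0≤-* : ∀ {a b} → 0ℤ ℤ.≤ a → 0ℤ ℤ.≤ b → 0ℤ ℤ.≤ a ℤ.* b
0≤-* {a} {b} 0≤a 0≤b = subst (ℤ._≤ a ℤ.* b) (ℤₚ.*-zeroʳ a) (*-monoˡ-≤-0≤ 0≤a 0≤b)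

0<-* : ∀ {a b} → 0ℤ ℤ.< a → 0ℤ ℤ.< b → 0ℤ ℤ.< a ℤ.* b
0<-* {a} {b} 0<a 0<b = subst (ℤ._< a ℤ.* b) (ℤₚ.*-zeroʳ a) (ℤₚ.*-monoˡ-<-pos a {{ℤ.positive 0<a}} 0<b)

*-mono-≤-0≤ : ∀ {a b c e} → 0ℤ ℤ.≤ b → 0ℤ ℤ.≤ c → a ℤ.≤ b → c ℤ.≤ e → a ℤ.* c ℤ.≤ b ℤ.* e
*-mono-≤-0≤ {a} {b} {c} {e} 0≤b 0≤c a≤b c≤e =
  ℤₚ.≤-trans (ℤₚ.*-monoʳ-≤-nonNeg c {{ℤ.nonNegative 0≤c}} a≤b) (*-monoˡ-≤-0≤ 0≤b c≤e)

∣i∣*∣i∣ : ∀ i → + ∣ i ∣ ℤ.* + ∣ i ∣ ≡ i ℤ.* i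
∣i∣*∣i∣ (+ n)        = refl
∣i∣*∣i∣ (ℤ.-[1+ n ]) = refl

-- If no entry dominates, the sum of the entries is large compared with their Euclidean norm.
-- Bounding the products n x * n y by the arithmetic-geometric mean, rather than n x by a maximum,
-- avoids square roots.
∑-flat : ∀ (xs : List A) (n : A → ℤ) r B → (∀ x → 0ℤ ℤ.≤ n x) → 0ℤ ℤ.≤ r →
         (∀ x → r ℤ.* (n x ℤ.* n x) ℤ.≤ B) →
         let W = ∑ xs (λ x → n x ℤ.* n x) ; S = ∑ xs n in r ℤ.* (W ℤ.* W) ℤ.≤ B ℤ.* (S ℤ.* S)
∑-flat xs n r B 0≤n 0≤r bound = begin
  r ℤ.* (W ℤ.* W)
    ≡⟨ cong (r ℤ.*_) (∑-* xs xs (λ x → n x ℤ.* n x) (λ x → n x ℤ.* n x)) ⟩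
  r ℤ.* ∑ xs (λ x → ∑ xs (λ y → n x ℤ.* n x ℤ.* (n y ℤ.* n y)))
    ≡⟨ scaled (λ x y → n x ℤ.* n x ℤ.* (n y ℤ.* n y)) r ⟨
  ∑ xs (λ x → ∑ xs (λ y → r ℤ.* (n x ℤ.* n x ℤ.* (n y ℤ.* n y))))
    ≤⟨ ∑-mono xs (λ x → ∑-mono xs (λ y → pointwise x y)) ⟩
  ∑ xs (λ x → ∑ xs (λ y → B ℤ.* (n x ℤ.* n y)))
    ≡⟨ scaled (λ x y → n x ℤ.* n y) B ⟩
  B ℤ.* ∑ xs (λ x → ∑ xs (λ y → n x ℤ.* n y))
    ≡⟨ cong (B ℤ.*_) (∑-* xs xs n n) ⟨
  B ℤ.* (S ℤ.* S) ∎
  where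
  open ℤₚ.≤-Reasoning
  W S : ℤ
  W = ∑ xs (λ x → n x ℤ.* n x)
  S = ∑ xs n
  scaled : ∀ f c → ∑ xs (λ x → ∑ xs (λ y → c ℤ.* f x y)) ≡ c ℤ.* ∑ xs (λ x → ∑ xs (f x))
  scaled f c = trans (∑-cong xs (λ x → ∑-*ˡ xs c (f x))) (∑-*ˡ xs c _)
  regroup : ∀ r a b → r ℤ.* (a ℤ.* a ℤ.* (b ℤ.* b)) ≡ a ℤ.* b ℤ.* (r ℤ.* (a ℤ.* b))
  regroup = ℤ-Solver.solve-∀
  am-gm : ∀ r a b → r ℤ.* (a ℤ.* a) ℤ.+ r ℤ.* (b ℤ.* b) ℤ.- + 2 ℤ.* (r ℤ.* (a ℤ.* b)) ≡ r ℤ.* ((a ℤ.- b) ℤ.* (a ℤ.- b))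
  am-gm = ℤ-Solver.solve-∀
  two : ∀ a → a ℤ.+ a ≡ + 2 ℤ.* a
  two = ℤ-Solver.solve-∀
  product-bound : ∀ x y → r ℤ.* (n x ℤ.* n y) ℤ.≤ B
  product-bound x y = *-cancelˡ-≤-0< {+ 2} (ℤ.+<+ (s≤s z≤n)) (begin
    + 2 ℤ.* (r ℤ.* (n x ℤ.* n y))
      ≤⟨ ℤₚ.0≤i-j⇒j≤i (subst (0ℤ ℤ.≤_) (sym (am-gm r (n x) (n y))) (0≤-* 0≤r (0≤i*i (n x ℤ.- n y)))) ⟩
    r ℤ.* (n x ℤ.* n x) ℤ.+ r ℤ.* (n y ℤ.* n y)
      ≤⟨ ℤₚ.+-mono-≤ (bound x) (bound y) ⟩
    B ℤ.+ B ≡⟨ two B ⟩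
    + 2 ℤ.* B ∎)
  pointwise : ∀ x y → r ℤ.* (n x ℤ.* n x ℤ.* (n y ℤ.* n y)) ℤ.≤ B ℤ.* (n x ℤ.* n y)
  pointwise x y = begin
    r ℤ.* (n x ℤ.* n x ℤ.* (n y ℤ.* n y)) ≡⟨ regroup r (n x) (n y) ⟩
    n x ℤ.* n y ℤ.* (r ℤ.* (n x ℤ.* n y)) ≤⟨ *-monoˡ-≤-0≤ (0≤-* (0≤n x) (0≤n y)) (product-bound x y) ⟩
    n x ℤ.* n y ℤ.* B                     ≡⟨ ℤₚ.*-comm (n x ℤ.* n y) B ⟩
    B ℤ.* (n x ℤ.* n y)                   ∎

Balanced : ∀ {d} → ℕ → List A → (Fin (suc d) → A → ℤ) → Set
Balanced r xs u = ∀ x → + r ℤ.* energy xs u (x ∷ []) (λ _ → 1ℤ) ℤ.≤ + 12 ℤ.* volume xs u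

-- Balance and `pairing-bound` at a single row bound each entry of w, so w is flat and its absolute
-- sum S is large. Agreement of signs gives S ≤ ⟨g, w⟩, which `pairing-bound` limits by the energy
-- of g. Both uses cost a factor (d+1)², hence the fourth power.
energy-lower : ∀ {d} r (xs : List A) (u : Fin (suc d) → A → ℤ) → 0ℤ ℤ.< volume xs u → Balanced r xs u →
  ∀ v (g : A → ℤ) → (∀ x → + ∣ combination u v x ∣ ℤ.≤ g x ℤ.* combination u v x) →
  0ℤ ℤ.< ∑ xs (λ x → combination u v x ℤ.* combination u v x) →
  + r ℤ.* volume xs u ℤ.≤ + 12 ℤ.* (+ suc d) ℤ.^ 4 ℤ.* energy xs u xs g
energy-lower {d = d} r xs u 0<D balanced v g sign 0<W = *-cancelˡ-≤-0< (0<-* 0<W 0<W) (begin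
  W ℤ.* W ℤ.* (+ r ℤ.* D)                          ≡⟨ regroup₁ W (+ r) D ⟩
  D ℤ.* (+ r ℤ.* (W ℤ.* W))                        ≤⟨ *-monoˡ-≤-0≤ 0≤D flat ⟩
  D ℤ.* (K ℤ.* (S ℤ.* S))                          ≤⟨ *-monoˡ-≤-0≤ 0≤D (*-monoˡ-≤-0≤ 0≤K (*-mono-≤-0≤ 0≤I 0≤S S≤I S≤I)) ⟩
  D ℤ.* (K ℤ.* (I ℤ.* I))                          ≡⟨ regroup₂ D K (I ℤ.* I) ⟩
  K ℤ.* (I ℤ.* I ℤ.* D)                            ≤⟨ *-monoˡ-≤-0≤ 0≤K (pairing-bound xs xs u v g) ⟩
  K ℤ.* (e ℤ.* (e ℤ.* (W ℤ.* energy xs u xs g)))   ≡⟨ regroup₃ e W (energy xs u xs g) ⟩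
  W ℤ.* W ℤ.* (+ 12 ℤ.* e ℤ.^ 4 ℤ.* energy xs u xs g) ∎)
  where
  open ℤₚ.≤-Reasoning
  w : _ → ℤ
  w = combination u v
  D W S I e K : ℤ
  D = volume xs u
  W = ∑ xs (λ x → w x ℤ.* w x)
  S = ∑ xs (λ x → + ∣ w x ∣)
  I = ∑ xs (λ x → g x ℤ.* w x)
  e = + suc d
  K = + 12 ℤ.* (e ℤ.* (e ℤ.* W))
  0≤D : 0ℤ ℤ.≤ D
  0≤D = ℤₚ.<⇒≤ 0<D
  0≤W : 0ℤ ℤ.≤ W
  0≤W = ℤₚ.<⇒≤ 0<W
  0≤K : 0ℤ ℤ.≤ K
  0≤K = 0≤-* {+ 12} (ℤ.+≤+ z≤n) (0≤-* {e} (ℤ.+≤+ z≤n) (0≤-* {e} (ℤ.+≤+ z≤n) 0≤W))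
  0≤S : 0ℤ ℤ.≤ S
  0≤S = ∑-nonneg xs (λ _ → ℤ.+≤+ z≤n)
  S≤I : S ℤ.≤ I
  S≤I = ∑-mono xs sign
  0≤I : 0ℤ ℤ.≤ I
  0≤I = ℤₚ.≤-trans 0≤S S≤I
  regroup₁ : ∀ W r D → W ℤ.* W ℤ.* (r ℤ.* D) ≡ D ℤ.* (r ℤ.* (W ℤ.* W))
  regroup₁ = ℤ-Solver.solve-∀
  regroup₂ : ∀ D K I → D ℤ.* (K ℤ.* I) ≡ K ℤ.* (I ℤ.* D)
  regroup₂ = ℤ-Solver.solve-∀
  regroup₃ : ∀ e W E → + 12 ℤ.* (e ℤ.* (e ℤ.* W)) ℤ.* (e ℤ.* (e ℤ.* (W ℤ.* E)))
           ≡ W ℤ.* W ℤ.* (+ 12 ℤ.* (e ℤ.* (e ℤ.* (e ℤ.* (e ℤ.* 1ℤ)))) ℤ.* E)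
  regroup₃ = ℤ-Solver.solve-∀
  regroup₄ : ∀ D r w → D ℤ.* (r ℤ.* (w ℤ.* w)) ≡ r ℤ.* ((1ℤ ℤ.* w ℤ.+ 0ℤ) ℤ.* (1ℤ ℤ.* w ℤ.+ 0ℤ) ℤ.* D)
  regroup₄ = ℤ-Solver.solve-∀
  regroup₅ : ∀ r e W E → r ℤ.* (e ℤ.* (e ℤ.* (W ℤ.* E))) ≡ e ℤ.* (e ℤ.* W) ℤ.* (r ℤ.* E)
  regroup₅ = ℤ-Solver.solve-∀
  regroup₆ : ∀ e W D → e ℤ.* (e ℤ.* W) ℤ.* (+ 12 ℤ.* D) ≡ D ℤ.* (+ 12 ℤ.* (e ℤ.* (e ℤ.* W)))
  regroup₆ = ℤ-Solver.solve-∀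
  coordinate : ∀ x → + r ℤ.* (w x ℤ.* w x) ℤ.≤ K
  coordinate x = *-cancelˡ-≤-0< 0<D (begin
    D ℤ.* (+ r ℤ.* (w x ℤ.* w x))
      ≡⟨ regroup₄ D (+ r) (w x) ⟩
    + r ℤ.* ((1ℤ ℤ.* w x ℤ.+ 0ℤ) ℤ.* (1ℤ ℤ.* w x ℤ.+ 0ℤ) ℤ.* D)
      ≤⟨ *-monoˡ-≤-0≤ {+ r} (ℤ.+≤+ z≤n) (pairing-bound xs (x ∷ []) u v (λ _ → 1ℤ)) ⟩
    + r ℤ.* (e ℤ.* (e ℤ.* (W ℤ.* energy xs u (x ∷ []) (λ _ → 1ℤ))))
      ≡⟨ regroup₅ (+ r) e W (energy xs u (x ∷ []) (λ _ → 1ℤ)) ⟩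
    e ℤ.* (e ℤ.* W) ℤ.* (+ r ℤ.* energy xs u (x ∷ []) (λ _ → 1ℤ))
      ≤⟨ *-monoˡ-≤-0≤ (0≤-* {e} (ℤ.+≤+ z≤n) (0≤-* {e} (ℤ.+≤+ z≤n) 0≤W)) (balanced x) ⟩
    e ℤ.* (e ℤ.* W) ℤ.* (+ 12 ℤ.* D)
      ≡⟨ regroup₆ e W D ⟩
    D ℤ.* K ∎)
  flat : + r ℤ.* (W ℤ.* W) ℤ.≤ K ℤ.* (S ℤ.* S)
  flat = subst (λ a → + r ℤ.* (a ℤ.* a) ℤ.≤ K ℤ.* (S ℤ.* S)) (∑-cong xs (λ x → ∣i∣*∣i∣ (w x)))
    (∑-flat xs (λ x → + ∣ w x ∣) (+ r) K (λ _ → ℤ.+≤+ z≤n) (ℤ.+≤+ z≤n)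
      (λ x → subst (λ a → + r ℤ.* a ℤ.≤ K) (sym (∣i∣*∣i∣ (w x))) (coordinate x)))

-- Matrices with orthogonal rows

-- The rows g x are orthogonal with squared norm at most P, so c ↦ Σ c_x g_x stretches squared
-- lengths by at most P. Rows are added one at a time and the cross term vanishes.
bessel : ∀ {zs : List A} (ys : List B) (g : A → B → ℤ) P → Unique zs →
  (∀ {x x′} → x ≢ x′ → ∑ ys (λ y → g x y ℤ.* g x′ y) ≡ 0ℤ) →
  (∀ x → ∑ ys (λ y → g x y ℤ.* g x y) ℤ.≤ P) → ∀ (c : A → ℤ) →
  ∑ ys (λ y → ∑ zs (λ x → g x y ℤ.* c x) ℤ.* ∑ zs (λ x → g x y ℤ.* c x)) ℤ.≤ P ℤ.* ∑ zs (λ x → c x ℤ.* c x)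
bessel {zs = []} ys g P uniq orth norm c =
  ℤₚ.≤-reflexive (trans (∑-0 ys (λ _ → refl)) (sym (ℤₚ.*-zeroʳ P)))
bessel {zs = z ∷ zs} ys g P (z∉ ∷ uniq) orth norm c = begin
  ∑ ys (λ y → (g z y ℤ.* c z ℤ.+ s y) ℤ.* (g z y ℤ.* c z ℤ.+ s y))
    ≡⟨ ∑-cong ys (λ y → expand (g z y) (c z) (s y)) ⟩
  ∑ ys (λ y → c z ℤ.* c z ℤ.* (g z y ℤ.* g z y) ℤ.+ (+ 2 ℤ.* c z ℤ.* (g z y ℤ.* s y) ℤ.+ s y ℤ.* s y))
    ≡⟨ trans (∑-+ ys s₁ (λ y → s₂ y ℤ.+ s y ℤ.* s y)) (cong (ℤ._+_ (∑ ys s₁)) (∑-+ ys s₂ (λ y → s y ℤ.* s y))) ⟩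
  ∑ ys (λ y → c z ℤ.* c z ℤ.* (g z y ℤ.* g z y)) ℤ.+ (∑ ys (λ y → + 2 ℤ.* c z ℤ.* (g z y ℤ.* s y)) ℤ.+ ∑ ys (λ y → s y ℤ.* s y))
    ≡⟨ cong₂ ℤ._+_ (∑-*ˡ ys (c z ℤ.* c z) _) (cong (λ a → a ℤ.+ ∑ ys (λ y → s y ℤ.* s y))
         (trans (∑-*ˡ ys (+ 2 ℤ.* c z) _) (trans (cong ((+ 2 ℤ.* c z) ℤ.*_) (cross z∉)) (ℤₚ.*-zeroʳ (+ 2 ℤ.* c z))))) ⟩
  c z ℤ.* c z ℤ.* ∑ ys (λ y → g z y ℤ.* g z y) ℤ.+ (0ℤ ℤ.+ ∑ ys (λ y → s y ℤ.* s y))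
    ≤⟨ ℤₚ.+-mono-≤ (*-monoˡ-≤-0≤ (0≤i*i (c z)) (norm z)) (ℤₚ.+-monoʳ-≤ 0ℤ (bessel ys g P uniq orth norm c)) ⟩
  c z ℤ.* c z ℤ.* P ℤ.+ (0ℤ ℤ.+ P ℤ.* ∑ zs (λ x → c x ℤ.* c x))
    ≡⟨ collect (c z ℤ.* c z) P _ ⟩
  P ℤ.* (c z ℤ.* c z ℤ.+ ∑ zs (λ x → c x ℤ.* c x)) ∎
  where
  open ℤₚ.≤-Reasoning
  s s₁ s₂ : _ → ℤ
  s  y = ∑ zs (λ x → g x y ℤ.* c x)
  s₁ y = c z ℤ.* c z ℤ.* (g z y ℤ.* g z y)
  s₂ y = + 2 ℤ.* c z ℤ.* (g z y ℤ.* s y)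
  expand : ∀ g c s → (g ℤ.* c ℤ.+ s) ℤ.* (g ℤ.* c ℤ.+ s) ≡ c ℤ.* c ℤ.* (g ℤ.* g) ℤ.+ (+ 2 ℤ.* c ℤ.* (g ℤ.* s) ℤ.+ s ℤ.* s)
  expand = ℤ-Solver.solve-∀
  collect : ∀ a P b → a ℤ.* P ℤ.+ (0ℤ ℤ.+ P ℤ.* b) ≡ P ℤ.* (a ℤ.+ b)
  collect = ℤ-Solver.solve-∀
  cross : ∀ {zs} → All (z ≢_) zs → ∑ ys (λ y → g z y ℤ.* ∑ zs (λ x → g x y ℤ.* c x)) ≡ 0ℤ
  cross [] = ∑-0 ys (λ y → ℤₚ.*-zeroʳ (g z y))
  cross {x ∷ xs} (z≢x ∷ ps) =
    trans (∑-cong ys (λ y → distribute (g z y) (g x y) (c x) _))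
    (trans (∑-+ ys (λ y → c x ℤ.* (g z y ℤ.* g x y)) (λ y → g z y ℤ.* ∑ xs (λ x → g x y ℤ.* c x)))
           (cong₂ ℤ._+_ (trans (∑-*ˡ ys (c x) (λ y → g z y ℤ.* g x y)) (trans (cong (c x ℤ.*_) (orth z≢x)) (ℤₚ.*-zeroʳ (c x)))) (cross ps)))
    where
    distribute : ∀ a b c s → a ℤ.* (b ℤ.* c ℤ.+ s) ≡ c ℤ.* (a ℤ.* b) ℤ.+ a ℤ.* s
    distribute = ℤ-Solver.solve-∀

energy-upper : ∀ {d} {xs : List A} (ys : List B) (u : Fin (suc d) → A → ℤ) (g : A → B → ℤ) P → Unique xs →
  (∀ {x x′} → x ≢ x′ → ∑ ys (λ y → g x y ℤ.* g x′ y) ≡ 0ℤ) →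
  (∀ x → ∑ ys (λ y → g x y ℤ.* g x y) ℤ.≤ P) →
  ∑ ys (λ y → energy xs u xs (λ x → g x y)) ℤ.≤ P ℤ.* volume xs u
energy-upper {d = d} {xs} ys u g P uniq orth norm = begin
  ∑ ys (λ y → energy xs u xs (λ x → g x y))
    ≡⟨ ∑-swap ys (tuples xs d) (λ y T → contraction u xs (λ x → g x y) T ℤ.* contraction u xs (λ x → g x y) T) ⟩
  ∑ (tuples xs d) (λ T → ∑ ys (λ y → contraction u xs (λ x → g x y) T ℤ.* contraction u xs (λ x → g x y) T))
    -- For fixed T the cofactors det u (x ∷ T) serve as the coefficients c.
    ≤⟨ ∑-mono (tuples xs d) (λ T → bessel ys g P uniq orth norm (λ x → det u (x ∷ T))) ⟩
  ∑ (tuples xs d) (λ T → P ℤ.* ∑ xs (λ x → det u (x ∷ T) ℤ.* det u (x ∷ T)))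
    ≡⟨ ∑-*ˡ (tuples xs d) P _ ⟩
  P ℤ.* ∑ (tuples xs d) (λ T → ∑ xs (λ x → det u (x ∷ T) ℤ.* det u (x ∷ T)))
    ≡⟨ cong (P ℤ.*_) (∑-swap (tuples xs d) xs (λ T x → det u (x ∷ T) ℤ.* det u (x ∷ T))) ⟩
  P ℤ.* ∑ xs (λ x → ∑ (tuples xs d) (λ T → det u (x ∷ T) ℤ.* det u (x ∷ T)))
    ≡⟨ cong (P ℤ.*_) (∑-tuples xs d (λ T → det u T ℤ.* det u T)) ⟨
  P ℤ.* volume xs u ∎
  where
  open ℤₚ.≤-Reasoning

balanced-bound : ∀ {d} r p {xs : List A} (ys : List B) (u : Fin (suc d) → A → ℤ) (v : B → Fin (suc d) → ℤ) (g : A → B → ℤ) →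
  Unique xs → 0ℤ ℤ.< volume xs u → Balanced r xs u → 0 < List.length ys →
  (∀ {x x′} → x ≢ x′ → ∑ ys (λ y → g x y ℤ.* g x′ y) ≡ 0ℤ) →
  (∀ x → ∑ ys (λ y → g x y ℤ.* g x y) ℤ.≤ + p ℤ.* + List.length ys) →
  (∀ x y → + ∣ combination u (v y) x ∣ ℤ.≤ g x y ℤ.* combination u (v y) x) →
  (∀ y → 0ℤ ℤ.< ∑ xs (λ x → combination u (v y) x ℤ.* combination u (v y) x)) →
  + r ℤ.≤ + 12 ℤ.* (+ suc d) ℤ.^ 4 ℤ.* + p
balanced-bound {d = d} r p {xs} ys u v g uniq 0<D balanced 0<len orth norm sign nonzero =
  *-cancelˡ-≤-0< (0<-* (ℤ.+<+ 0<len) 0<D) (begin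
    N ℤ.* D ℤ.* + r                                          ≡⟨ regroup₁ N D (+ r) ⟩
    N ℤ.* (+ r ℤ.* D)                                        ≡⟨ ∑-const ys (+ r ℤ.* D) ⟨
    ∑ ys (λ _ → + r ℤ.* D)                                   ≤⟨ ∑-mono ys (λ y → energy-lower r xs u 0<D balanced (v y) (λ x → g x y) (λ x → sign x y) (nonzero y)) ⟩
    ∑ ys (λ y → K ℤ.* energy xs u xs (λ x → g x y))          ≡⟨ ∑-*ˡ ys K _ ⟩
    K ℤ.* ∑ ys (λ y → energy xs u xs (λ x → g x y))          ≤⟨ *-monoˡ-≤-0≤ 0≤K (energy-upper ys u g (+ p ℤ.* N) uniq orth norm) ⟩
    K ℤ.* (+ p ℤ.* N ℤ.* D)                                  ≡⟨ regroup₂ K (+ p) N D ⟩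
    N ℤ.* D ℤ.* (K ℤ.* + p)                                  ∎)
  where
  open ℤₚ.≤-Reasoning
  N D K : ℤ
  N = + List.length ys
  D = volume xs u
  K = + 12 ℤ.* (+ suc d) ℤ.^ 4
  0≤K : 0ℤ ℤ.≤ K
  0≤K = 0≤-* {+ 12} (ℤ.+≤+ z≤n) (subst (0ℤ ℤ.≤_) (fourth (+ suc d)) (0≤i*i (+ suc d ℤ.* + suc d)))
    where
    fourth : ∀ e → e ℤ.* e ℤ.* (e ℤ.* e) ≡ e ℤ.* (e ℤ.* (e ℤ.* (e ℤ.* 1ℤ)))
    fourth = ℤ-Solver.solve-∀
  regroup₁ : ∀ N D r → N ℤ.* D ℤ.* r ≡ N ℤ.* (r ℤ.* D)
  regroup₁ = ℤ-Solver.solve-∀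
  regroup₂ : ∀ K p N D → K ℤ.* (p ℤ.* N ℤ.* D) ≡ N ℤ.* D ℤ.* (K ℤ.* p)
  regroup₂ = ℤ-Solver.solve-∀

-- Determinants under row scaling

alt-scale : ∀ {n} (l : A → ℕ) {f h : A → Vec A n → ℤ} → (∀ x T → f x T ≡ + ∏ⱽ l (x ∷ T) ℤ.* h x T) →
            ∀ T → alt f T ≡ + ∏ⱽ l T ℤ.* alt h T
alt-scale {n = zero}  l e (x ∷ []) = e x []
alt-scale {n = suc n} l {f} {h} e (x ∷ T) = begin
  f x T ℤ.- alt (λ y T′ → f y (x ∷ T′)) T
    ≡⟨ cong₂ ℤ._-_ (e x T) (alt-scale l {h = λ y T′ → + l x ℤ.* h y (x ∷ T′)} (λ y T′ → trans (e y (x ∷ T′)) (move y T′)) T) ⟩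
  + ∏ⱽ l (x ∷ T) ℤ.* h x T ℤ.- + ∏ⱽ l T ℤ.* alt (λ y T′ → + l x ℤ.* h y (x ∷ T′)) T
    ≡⟨ cong₂ (λ a b → a ℤ.* h x T ℤ.- + ∏ⱽ l T ℤ.* b) (ℤₚ.pos-* (l x) (∏ⱽ l T)) (alt-*ˡ (+ l x) (λ y T′ → h y (x ∷ T′)) T) ⟩
  + l x ℤ.* + ∏ⱽ l T ℤ.* h x T ℤ.- + ∏ⱽ l T ℤ.* (+ l x ℤ.* alt (λ y T′ → h y (x ∷ T′)) T)
    ≡⟨ factor (+ l x) (+ ∏ⱽ l T) (h x T) _ ⟩
  + l x ℤ.* + ∏ⱽ l T ℤ.* (h x T ℤ.- alt (λ y T′ → h y (x ∷ T′)) T)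
    ≡⟨ cong (λ a → a ℤ.* (h x T ℤ.- alt (λ y T′ → h y (x ∷ T′)) T)) (ℤₚ.pos-* (l x) (∏ⱽ l T)) ⟨
  + ∏ⱽ l (x ∷ T) ℤ.* (h x T ℤ.- alt (λ y T′ → h y (x ∷ T′)) T) ∎
  where
  open ≡-Reasoning
  factor : ∀ a b c e → a ℤ.* b ℤ.* c ℤ.- b ℤ.* (a ℤ.* e) ≡ a ℤ.* b ℤ.* (c ℤ.- e)
  factor = ℤ-Solver.solve-∀
  exchange : ∀ a b c → a * (b * c) ≡ a * c * b
  exchange = ℕ-Solver.solve-∀
  move : ∀ y T′ → + (l y * (l x * ∏ⱽ l T′)) ℤ.* h y (x ∷ T′) ≡ + (l y * ∏ⱽ l T′) ℤ.* (+ l x ℤ.* h y (x ∷ T′))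
  move y T′ = trans (cong (λ a → + a ℤ.* h y (x ∷ T′)) (exchange (l y) (l x) (∏ⱽ l T′)))
             (trans (cong (ℤ._* h y (x ∷ T′)) (ℤₚ.pos-* (l y * ∏ⱽ l T′) (l x))) (ℤₚ.*-assoc (+ (l y * ∏ⱽ l T′)) (+ l x) _))

det-scale : ∀ {d} (l : A → ℕ) (u : Fin d → A → ℤ) T → det (λ k x → + l x ℤ.* u k x) T ≡ + ∏ⱽ l T ℤ.* det u T
det-scale {d = zero}  l u [] = refl
det-scale {d = suc d} l u T  = alt-scale l (λ x T′ → trans
  (cong ((+ l x ℤ.* u zero x) ℤ.*_) (det-scale l (λ k → u (suc k)) T′))
  (trans (regroup (+ l x) (u zero x) (+ ∏ⱽ l T′) _) (cong (ℤ._* (u zero x ℤ.* det (λ k → u (suc k)) T′)) (sym (ℤₚ.pos-* (l x) (∏ⱽ l T′)))))) T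
  where
  regroup : ∀ a b c e → a ℤ.* b ℤ.* (c ℤ.* e) ≡ a ℤ.* c ℤ.* (b ℤ.* e)
  regroup = ℤ-Solver.solve-∀

∏ⱽ-square : ∀ {n} (l : A → ℕ) (T : Vec A n) → ∏ⱽ (square l) T ≡ ∏ⱽ l T * ∏ⱽ l T
∏ⱽ-square l []      = refl
∏ⱽ-square l (x ∷ T) = trans (cong (square l x *_) (∏ⱽ-square l T)) (ℕₚ.[m*n]*[o*p]≡[m*o]*[n*p] (l x) (l x) (∏ⱽ l T) (∏ⱽ l T))

det² : ∀ {d} → (Fin d → A → ℤ) → Vec A d → ℕ
det² u T = ∣ det u T ∣ * ∣ det u T ∣

det²-scale : ∀ {d} (l : A → ℕ) (u : Fin d → A → ℤ) T →
  det (λ k x → + l x ℤ.* u k x) T ℤ.* det (λ k x → + l x ℤ.* u k x) T ≡ + (∏ⱽ (square l) T * det² u T)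
det²-scale l u T = begin
  det U T ℤ.* det U T                                            ≡⟨ cong (λ a → a ℤ.* a) (det-scale l u T) ⟩
  + ∏ⱽ l T ℤ.* det u T ℤ.* (+ ∏ⱽ l T ℤ.* det u T)                ≡⟨ regroup (+ ∏ⱽ l T) (det u T) ⟩
  + ∏ⱽ l T ℤ.* + ∏ⱽ l T ℤ.* (det u T ℤ.* det u T)                ≡⟨ cong₂ ℤ._*_ (trans (cong +_ (∏ⱽ-square l T)) (ℤₚ.pos-* (∏ⱽ l T) (∏ⱽ l T))) (trans (ℤₚ.pos-* ∣ det u T ∣ ∣ det u T ∣) (∣i∣*∣i∣ (det u T))) ⟨
  + ∏ⱽ (square l) T ℤ.* + det² u T                               ≡⟨ ℤₚ.pos-* (∏ⱽ (square l) T) (det² u T) ⟨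
  + (∏ⱽ (square l) T * det² u T)                                 ∎
  where
  open ≡-Reasoning
  U : Fin _ → _ → ℤ
  U k x = + l x ℤ.* u k x
  regroup : ∀ a b → a ℤ.* b ℤ.* (a ℤ.* b) ≡ a ℤ.* a ℤ.* (b ℤ.* b)
  regroup = ℤ-Solver.solve-∀

pos-∑ᴺ : ∀ (xs : List A) (f : A → ℕ) → + ∑ᴺ xs f ≡ ∑ xs (λ x → + f x)
pos-∑ᴺ []       f = refl
pos-∑ᴺ (x ∷ xs) f = trans (ℤₚ.pos-+ (f x) (∑ᴺ xs f)) (cong (ℤ._+_ (+ f x)) (pos-∑ᴺ xs f))

leverage-∑ : ∀ {d} (xs : List A) (u : Fin (suc d) → A → ℤ) l x →
  ∑ (tuples xs d) (λ T → det (λ k x → + l x ℤ.* u k x) (x ∷ T) ℤ.* det (λ k x → + l x ℤ.* u k x) (x ∷ T)) ≡ + leverage xs (det² u) l x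
leverage-∑ {d = d} xs u l x = begin
  ∑ (tuples xs d) (λ T → det U (x ∷ T) ℤ.* det U (x ∷ T))
    ≡⟨ ∑-cong (tuples xs d) (λ T → trans (det²-scale l u (x ∷ T)) (cong +_ (ℕₚ.*-assoc (square l x) (∏ⱽ (square l) T) _))) ⟩
  ∑ (tuples xs d) (λ T → + (square l x * (∏ⱽ (square l) T * det² u (x ∷ T))))
    ≡⟨ pos-∑ᴺ (tuples xs d) _ ⟨
  + ∑ᴺ (tuples xs d) (λ T → square l x * (∏ⱽ (square l) T * det² u (x ∷ T)))
    ≡⟨ cong +_ (∑ᴺ-*ˡ (tuples xs d) (square l x) _) ⟩
  + leverage xs (det² u) l x ∎
  where
  open ≡-Reasoning
  U : Fin (suc d) → _ → ℤ
  U k x = + l x ℤ.* u k x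

volume-scale : ∀ {d} (xs : List A) (u : Fin (suc d) → A → ℤ) l → volume xs (λ k x → + l x ℤ.* u k x) ≡ + mass xs (det² u) l
volume-scale {d = d} xs u l =
  trans (∑-tuples xs d (λ T → det (λ k x → + l x ℤ.* u k x) T ℤ.* det (λ k x → + l x ℤ.* u k x) T))
  (trans (∑-cong xs (leverage-∑ xs u l)) (sym (pos-∑ᴺ xs (leverage xs (det² u) l))))

energy-scale : ∀ {d} (xs : List A) (u : Fin (suc d) → A → ℤ) l x →
  energy xs (λ k x → + l x ℤ.* u k x) (x ∷ []) (λ _ → 1ℤ) ≡ + leverage xs (det² u) l x
energy-scale {d = d} xs u l x =
  trans (∑-cong (tuples xs d) (λ T → cong (λ a → a ℤ.* a) (unit (det (λ k x → + l x ℤ.* u k x) (x ∷ T))))) (leverage-∑ xs u l x)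
  where
  unit : ∀ a → 1ℤ ℤ.* a ℤ.+ 0ℤ ≡ a
  unit = ℤ-Solver.solve-∀

-- Determinants modulo M

alt-mod : ∀ {n} M {f h : A → Vec A n → ℤ} → (∀ x T → ∃[ q ] (f x T ≡ M ℤ.* q ℤ.+ h x T)) →
          ∀ T → ∃[ q ] (alt f T ≡ M ℤ.* q ℤ.+ alt h T)
alt-mod {n = zero}  M e (x ∷ T) = e x T
alt-mod {n = suc n} M {f} {h} e (x ∷ T) with e x T | alt-mod M (λ y T′ → e y (x ∷ T′)) T
... | q , eq | q′ , eq′ = q ℤ.- q′ , trans (cong₂ ℤ._-_ eq eq′) (collect M q q′ (h x T) _)
  where
  collect : ∀ M q q′ a b → M ℤ.* q ℤ.+ a ℤ.- (M ℤ.* q′ ℤ.+ b) ≡ M ℤ.* (q ℤ.- q′) ℤ.+ (a ℤ.- b)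
  collect = ℤ-Solver.solve-∀

-- A determinant is an integer polynomial in its entries, hence respects congruence. The quotient is
-- carried explicitly as the witness q.
det-mod : ∀ {d} M (u z : Fin d → A → ℤ) T → ∃[ q ] (det (λ k x → M ℤ.* u k x ℤ.+ z k x) T ≡ M ℤ.* q ℤ.+ det z T)
det-mod {d = zero}  M u z T = 0ℤ , sym (trans (cong (ℤ._+ 1ℤ) (ℤₚ.*-zeroʳ M)) refl)
det-mod {d = suc d} M u z T = alt-mod M step T
  where
  expand : ∀ M a b q e → (M ℤ.* a ℤ.+ b) ℤ.* (M ℤ.* q ℤ.+ e) ≡ M ℤ.* (a ℤ.* (M ℤ.* q ℤ.+ e) ℤ.+ b ℤ.* q) ℤ.+ b ℤ.* e
  expand = ℤ-Solver.solve-∀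
  step : ∀ x T′ → ∃[ q ] ((M ℤ.* u zero x ℤ.+ z zero x) ℤ.* det (λ k x → M ℤ.* u (suc k) x ℤ.+ z (suc k) x) T′
                          ≡ M ℤ.* q ℤ.+ z zero x ℤ.* det (λ k → z (suc k)) T′)
  step x T′ with det-mod M (λ k → u (suc k)) (λ k → z (suc k)) T′
  ... | q , eq = _ , trans (cong ((M ℤ.* u zero x ℤ.+ z zero x) ℤ.*_) eq) (expand M (u zero x) (z zero x) q _)

alt-tabulate-0 : ∀ {n} {f : A → Vec A n → ℤ} (h : Fin (suc n) → A) → (∀ c T → f (h c) T ≡ 0ℤ) → alt f (Vec.tabulate h) ≡ 0ℤ
alt-tabulate-0 {n = zero}  h e = e zero _
alt-tabulate-0 {n = suc n} h e = cong₂ ℤ._-_ (e zero _) (alt-tabulate-0 (λ c → h (suc c)) (λ c T → e (suc c) (h zero ∷ T)))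

det-identity : ∀ {d} (z : Fin d → A → ℤ) (h : Fin d → A) → (∀ k → z k (h k) ≡ 1ℤ) → (∀ {k c} → k ≢ c → z k (h c) ≡ 0ℤ) →
               det z (Vec.tabulate h) ≡ 1ℤ
det-identity {d = zero}        z h diag off = refl
det-identity {d = suc zero}    z h diag off = trans (ℤₚ.*-identityʳ _) (diag zero)
det-identity {d = suc (suc d)} z h diag off = cong₂ ℤ._-_
  (cong₂ ℤ._*_ (diag zero) (det-identity (λ k → z (suc k)) (λ c → h (suc c)) (λ k → diag (suc k)) (λ k≢c → off (λ eq → k≢c (Finₚ.suc-injective eq)))))
  (alt-tabulate-0 (λ c → h (suc c)) (λ c T → trans (cong (ℤ._* det (λ k → z (suc k)) (h zero ∷ T)) (off (λ ()))) refl))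

∑-tabulate-0 : ∀ {n} (h : Fin n → A) {F : A → ℤ} → (∀ k → F (h k) ≡ 0ℤ) → ∑ (List.tabulate h) F ≡ 0ℤ
∑-tabulate-0 {n = zero}  h e = refl
∑-tabulate-0 {n = suc n} h e = cong₂ ℤ._+_ (e zero) (∑-tabulate-0 (λ k → h (suc k)) (λ k → e (suc k)))

∑-tabulate-single : ∀ {n} (h : Fin n → A) {F : A → ℤ} c → (∀ k → k ≢ c → F (h k) ≡ 0ℤ) → ∑ (List.tabulate h) F ≡ F (h c)
∑-tabulate-single h {F} zero e =
  trans (cong (ℤ._+_ (F (h zero))) (∑-tabulate-0 (λ k → h (suc k)) (λ k → e (suc k) (λ ())))) (ℤₚ.+-identityʳ _)
∑-tabulate-single h (suc c) e =
  trans (cong₂ ℤ._+_ (e zero (λ ())) (∑-tabulate-single (λ k → h (suc k)) c (λ k k≢c → e (suc k) (λ eq → k≢c (Finₚ.suc-injective eq)))))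
        (ℤₚ.+-identityˡ _)

δ : ∀ {d} → Fin d → Fin d → ℤ
δ k c with k Fin.≟ c
... | yes _ = 1ℤ
... | no  _ = 0ℤ

δ-diag : ∀ {d} (k : Fin d) → δ k k ≡ 1ℤ
δ-diag k with k Fin.≟ k
... | yes _  = refl
... | no k≢k = contradiction refl k≢k

δ-off : ∀ {d} {k c : Fin d} → k ≢ c → δ k c ≡ 0ℤ
δ-off {k = k} {c} k≢c with k Fin.≟ c
... | yes k≡c = contradiction k≡c k≢c
... | no  _   = refl

∑-δ : ∀ {d} (f : Fin d → ℤ) c → ∑ (List.allFin d) (λ k → δ k c ℤ.* f k) ≡ f c
∑-δ f c = trans (∑-tabulate-single (λ k → k) c (λ k k≢c → trans (cong (ℤ._* f k) (δ-off k≢c)) (ℤₚ.*-zeroˡ (f k))))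
                (trans (cong (ℤ._* f c) (δ-diag c)) (ℤₚ.*-identityˡ (f c)))

length-cartesianProduct : ∀ (xs : List A) (ys : List B) → List.length (List.cartesianProduct xs ys) ≡ List.length xs * List.length ys
length-cartesianProduct []       ys = refl
length-cartesianProduct (x ∷ xs) ys = trans (Listₚ.length-++ (List.map (x ,_) ys))
  (cong₂ _+_ (Listₚ.length-map (x ,_) ys) (length-cartesianProduct xs ys))

-- The tuple listing block i is one term of the mass, and its weight is at least 1, so the mass is
-- at least the product of l² over that block. Multiplying over the r blocks gives the claim; this
-- is why rows are indexed by pairs.
blocks-lower : ∀ {r d} (ω : Vec (Fin r × Fin (suc d)) (suc d) → ℕ) → (∀ i → 1 ≤ ω (Vec.tabulate (i ,_))) →
  ∀ l → ∏ᴺ (List.cartesianProduct (List.allFin r) (List.allFin (suc d))) (square l)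
        ≤ mass (List.cartesianProduct (List.allFin r) (List.allFin (suc d))) ω l ^ r
blocks-lower {r} {d} ω ω≥1 l = subst (λ e → ∏ᴺ xs (square l) ≤ mass xs ω l ^ e) (Listₚ.length-tabulate {n = r} (λ i → i)) (go (List.allFin r))
  where
  open ℕₚ.≤-Reasoning
  xs : List (Fin r × Fin (suc d))
  xs = List.cartesianProduct (List.allFin r) (List.allFin (suc d))
  complete : ∀ x → x ∈ xs
  complete (i , c) = ∈-cartesianProduct⁺ (∈-allFin i) (∈-allFin c)
  term : ∀ T → ∏ⱽ (square l) T * ω T ≤ mass xs ω l
  term (x ∷ T) = begin
    square l x * ∏ⱽ (square l) T * ω (x ∷ T)    ≡⟨ ℕₚ.*-assoc (square l x) _ _ ⟩
    square l x * (∏ⱽ (square l) T * ω (x ∷ T))  ≤⟨ ℕₚ.*-monoʳ-≤ (square l x) (∑ᴺ-term (λ T → ∏ⱽ (square l) T * ω (x ∷ T)) (∈-tuples complete T)) ⟩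
    leverage xs ω l x                           ≤⟨ ∑ᴺ-term (leverage xs ω l) (complete x) ⟩
    mass xs ω l                                 ∎
  block : ∀ i → ∏ᴺ (List.map (i ,_) (List.allFin (suc d))) (square l) ≤ mass xs ω l
  block i = begin
    ∏ᴺ (List.map (i ,_) (List.allFin (suc d))) (square l) ≡⟨ cong (λ zs → ∏ᴺ zs (square l)) (Listₚ.map-tabulate (λ c → c) (i ,_)) ⟩
    ∏ᴺ (List.tabulate (i ,_)) (square l)                  ≡⟨ ∏ⱽ-tabulate (square l) (i ,_) ⟨
    ∏ⱽ (square l) (Vec.tabulate (i ,_))                   ≡⟨ ℕₚ.*-identityʳ _ ⟨
    ∏ⱽ (square l) (Vec.tabulate (i ,_)) * 1               ≤⟨ ℕₚ.*-monoʳ-≤ (∏ⱽ (square l) (Vec.tabulate (i ,_))) (ω≥1 i) ⟩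
    ∏ⱽ (square l) (Vec.tabulate (i ,_)) * ω (Vec.tabulate (i ,_)) ≤⟨ term (Vec.tabulate (i ,_)) ⟩
    mass xs ω l                                           ∎
  go : ∀ is → ∏ᴺ (List.cartesianProduct is (List.allFin (suc d))) (square l) ≤ mass xs ω l ^ List.length is
  go []       = ℕₚ.≤-refl
  go (i ∷ is) = ℕₚ.≤-trans (ℕₚ.≤-reflexive (∏ᴺ-++ (List.map (i ,_) (List.allFin (suc d))) _ (square l))) (ℕₚ.*-mono-≤ (block i) (go is))

-- Signs and their stability under perturbation

sgn : Bool → ℤ
sgn true  = ℤ.-1ℤ
sgn false = 1ℤ

∣i∣≤ : ∀ b {g w} → 1ℤ ℤ.≤ sgn b ℤ.* g → 1ℤ ℤ.≤ sgn b ℤ.* w → + ∣ w ∣ ℤ.≤ g ℤ.* w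
∣i∣≤ b {g} {w} g≥1 w≥1 = subst (ℤ._≤ g ℤ.* w) (sym (abs b w w≥1)) (begin
  sgn b ℤ.* w                        ≡⟨ ℤₚ.*-identityʳ (sgn b ℤ.* w) ⟨
  sgn b ℤ.* w ℤ.* 1ℤ                 ≤⟨ *-monoˡ-≤-0≤ (ℤₚ.≤-trans (ℤ.+≤+ z≤n) w≥1) g≥1 ⟩
  sgn b ℤ.* w ℤ.* (sgn b ℤ.* g)      ≡⟨ cancel b ⟩
  g ℤ.* w                            ∎)
  where
  open ℤₚ.≤-Reasoning
  negs : ∀ w g → ℤ.-1ℤ ℤ.* w ℤ.* (ℤ.-1ℤ ℤ.* g) ≡ g ℤ.* w
  negs = ℤ-Solver.solve-∀
  ones : ∀ w g → 1ℤ ℤ.* w ℤ.* (1ℤ ℤ.* g) ≡ g ℤ.* w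
  ones = ℤ-Solver.solve-∀
  cancel : ∀ b → sgn b ℤ.* w ℤ.* (sgn b ℤ.* g) ≡ g ℤ.* w
  cancel true  = negs w g
  cancel false = ones w g
  abs : ∀ b w → 1ℤ ℤ.≤ sgn b ℤ.* w → + ∣ w ∣ ≡ sgn b ℤ.* w
  abs false (+ n)        _ = sym (ℤₚ.*-identityˡ (+ n))
  abs true  (+ zero)     (ℤ.+≤+ ())
  abs true  (+ suc n)    ()
  abs false ℤ.-[1+ n ]   ()
  abs true  ℤ.-[1+ n ]   _ = cong +_ (cong suc (sym (ℕₚ.+-identityʳ n)))

-- The integer w has the right sign with margin 1, hence M w with margin M, which outweighs e.
perturb : ∀ b {w e} M l → 1ℤ ℤ.≤ sgn b ℤ.* w → ∣ e ∣ < M → 1 ≤ l → 1ℤ ℤ.≤ sgn b ℤ.* (+ l ℤ.* (+ M ℤ.* w ℤ.+ e))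
perturb b {w} {e} M l w≥1 e<M l≥1 = begin
  1ℤ                                                ≡⟨⟩
  1ℤ ℤ.* 1ℤ                                         ≤⟨ *-mono-≤-0≤ {b = + l} (ℤ.+≤+ z≤n) (ℤ.+≤+ z≤n) (ℤ.+≤+ l≥1) main ⟩
  + l ℤ.* (+ M ℤ.* (sgn b ℤ.* w) ℤ.+ sgn b ℤ.* e)   ≡⟨ regroup (+ l) (+ M) (sgn b) w e ⟩
  sgn b ℤ.* (+ l ℤ.* (+ M ℤ.* w ℤ.+ e))             ∎
  where
  open ℤₚ.≤-Reasoning
  regroup : ∀ l M s w e → l ℤ.* (M ℤ.* (s ℤ.* w) ℤ.+ s ℤ.* e) ≡ s ℤ.* (l ℤ.* (M ℤ.* w ℤ.+ e))
  regroup = ℤ-Solver.solve-∀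
  lower : ∀ i → ℤ.- + ∣ i ∣ ℤ.≤ i
  lower (+ zero)     = ℤₚ.≤-refl
  lower (+ suc n)    = ℤ.-≤+
  lower ℤ.-[1+ n ]   = ℤₚ.≤-refl
  abs-sgn : ∀ b i → ∣ sgn b ℤ.* i ∣ ≡ ∣ i ∣
  abs-sgn true  i = trans (cong ∣_∣ (ℤₚ.-1*i≡-i i)) (ℤₚ.∣-i∣≡∣i∣ i)
  abs-sgn false i = cong ∣_∣ (ℤₚ.*-identityˡ i)
  split : ∀ a → 1ℤ ℤ.+ a ℤ.- a ≡ 1ℤ
  split = ℤ-Solver.solve-∀
  main : 1ℤ ℤ.≤ + M ℤ.* (sgn b ℤ.* w) ℤ.+ sgn b ℤ.* e
  main = begin
    1ℤ                                      ≡⟨ split (+ ∣ e ∣) ⟨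
    + suc ∣ e ∣ ℤ.- + ∣ e ∣                 ≤⟨ ℤₚ.+-mono-≤ (ℤ.+≤+ e<M) (subst (λ a → ℤ.- + a ℤ.≤ sgn b ℤ.* e) (abs-sgn b e) (lower (sgn b ℤ.* e))) ⟩
    + M ℤ.+ sgn b ℤ.* e                     ≡⟨ cong (ℤ._+ sgn b ℤ.* e) (ℤₚ.*-identityʳ (+ M)) ⟨
    + M ℤ.* 1ℤ ℤ.+ sgn b ℤ.* e              ≤⟨ ℤₚ.+-monoˡ-≤ (sgn b ℤ.* e) (*-monoˡ-≤-0≤ {+ M} (ℤ.+≤+ z≤n) w≥1) ⟩
    + M ℤ.* (sgn b ℤ.* w) ℤ.+ sgn b ℤ.* e   ∎

1≤∣Mq+1∣ : ∀ M q → 2 ≤ M → 1 ≤ ∣ + M ℤ.* q ℤ.+ 1ℤ ∣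
1≤∣Mq+1∣ M q M≥2 with + M ℤ.* q ℤ.+ 1ℤ in eq
... | + suc n      = s≤s z≤n
... | ℤ.-[1+ n ]   = s≤s z≤n
... | + zero       = contradiction (ℕₚ.m*n≡1⇒m≡1 M ∣ q ∣ (trans (sym (ℤₚ.abs-* (+ M) q)) (cong ∣_∣ Mq≡-1))) (λ M≡1 → ℕₚ.<-irrefl (sym M≡1) M≥2)
  where
  shift : ∀ a → a ≡ a ℤ.+ 1ℤ ℤ.+ ℤ.-1ℤ
  shift = ℤ-Solver.solve-∀
  Mq≡-1 : + M ℤ.* q ≡ ℤ.-1ℤ
  Mq≡-1 = trans (shift (+ M ℤ.* q)) (cong (ℤ._+ ℤ.-1ℤ) eq)

-- The perturbed block is the identity matrix modulo M, so its determinant is non-zero whatever u is.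
block-det² : ∀ {r d} M → 2 ≤ M → (u : Fin d → Fin r × Fin d → ℤ) → ∀ i →
  1 ≤ det² (λ k x → + M ℤ.* u k x ℤ.+ δ k (proj₂ x)) (Vec.tabulate (i ,_))
block-det² {r} {d} M M≥2 u i = conclude (det-mod (+ M) u z (Vec.tabulate (i ,_)))
  where
  z : Fin d → Fin r × Fin d → ℤ
  z k x = δ k (proj₂ x)
  Δ : ℤ
  Δ = det (λ k x → + M ℤ.* u k x ℤ.+ z k x) (Vec.tabulate (i ,_))
  conclude : ∃[ q ] (Δ ≡ + M ℤ.* q ℤ.+ det z (Vec.tabulate (i ,_))) → 1 ≤ ∣ Δ ∣ * ∣ Δ ∣
  conclude (q , eq) = ℕₚ.*-mono-≤ ∣Δ∣≥1 ∣Δ∣≥1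
    where
    Δ≡ : Δ ≡ + M ℤ.* q ℤ.+ 1ℤ
    Δ≡ = trans eq (cong (ℤ._+_ (+ M ℤ.* q)) (det-identity z (i ,_) δ-diag δ-off))
    ∣Δ∣≥1 : 1 ≤ ∣ Δ ∣
    ∣Δ∣≥1 = ℕₚ.≤-trans (1≤∣Mq+1∣ M q M≥2) (ℕₚ.≤-reflexive (cong ∣_∣ (sym Δ≡)))

-- The bound on the dimension of a sign representation

∏ᴺ-≥1 : ∀ (zs : List A) {f : A → ℕ} → (∀ x → 1 ≤ f x) → 1 ≤ ∏ᴺ zs f
∏ᴺ-≥1 []       f≥1 = ℕₚ.≤-refl
∏ᴺ-≥1 (z ∷ zs) f≥1 = ℕₚ.*-mono-≤ (f≥1 z) (∏ᴺ-≥1 zs f≥1)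

1≤m^n⇒0<m : ∀ m n → 0 < n → 1 ≤ m ^ n → 0 < m
1≤m^n⇒0<m zero    (suc n) _ ()
1≤m^n⇒0<m (suc m) n       _ _ = s≤s z≤n

-- Adding the unit vector of index proj₂ x to the row x changes its entry in column y only by the
-- single coordinate v (proj₂ x).
combination-perturb : ∀ {r d} (l : Fin r × Fin d → ℕ) M (u : Fin d → Fin r × Fin d → ℤ) (v : Fin d → ℤ) x →
  combination (λ k x → + l x ℤ.* (+ M ℤ.* u k x ℤ.+ δ k (proj₂ x))) v x ≡ + l x ℤ.* (+ M ℤ.* combination u v x ℤ.+ v (proj₂ x))
combination-perturb {d = d} l M u v x = begin
  ∑ ks (λ k → + l x ℤ.* (+ M ℤ.* u k x ℤ.+ δ k (proj₂ x)) ℤ.* v k)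
    ≡⟨ ∑-cong ks (λ k → distribute (+ l x) (+ M) (u k x) (δ k (proj₂ x)) (v k)) ⟩
  ∑ ks (λ k → + l x ℤ.* (+ M ℤ.* (u k x ℤ.* v k) ℤ.+ δ k (proj₂ x) ℤ.* v k))
    ≡⟨ ∑-*ˡ ks (+ l x) (λ k → + M ℤ.* (u k x ℤ.* v k) ℤ.+ δ k (proj₂ x) ℤ.* v k) ⟩
  + l x ℤ.* ∑ ks (λ k → + M ℤ.* (u k x ℤ.* v k) ℤ.+ δ k (proj₂ x) ℤ.* v k)
    ≡⟨ cong (+ l x ℤ.*_) (∑-+ ks (λ k → + M ℤ.* (u k x ℤ.* v k)) (λ k → δ k (proj₂ x) ℤ.* v k)) ⟩
  + l x ℤ.* (∑ ks (λ k → + M ℤ.* (u k x ℤ.* v k)) ℤ.+ ∑ ks (λ k → δ k (proj₂ x) ℤ.* v k))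
    ≡⟨ cong₂ (λ a b → + l x ℤ.* (a ℤ.+ b)) (∑-*ˡ ks (+ M) (λ k → u k x ℤ.* v k)) (∑-δ v (proj₂ x)) ⟩
  + l x ℤ.* (+ M ℤ.* combination u v x ℤ.+ v (proj₂ x)) ∎
  where
  open ≡-Reasoning
  ks : List (Fin d)
  ks = List.allFin d
  distribute : ∀ l M u z v → l ℤ.* (M ℤ.* u ℤ.+ z) ℤ.* v ≡ l ℤ.* (M ℤ.* (u ℤ.* v) ℤ.+ z ℤ.* v)
  distribute = ℤ-Solver.solve-∀

0<square : ∀ b {w} → 1ℤ ℤ.≤ sgn b ℤ.* w → 0ℤ ℤ.< w ℤ.* w
0<square b {w} w≥1 = subst (0ℤ ℤ.<_) (squares b) (0<-* 0<bw 0<bw)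
  where
  0<bw : 0ℤ ℤ.< sgn b ℤ.* w
  0<bw = ℤₚ.<-≤-trans (ℤ.+<+ (s≤s z≤n)) w≥1
  negs : ∀ w → ℤ.-1ℤ ℤ.* w ℤ.* (ℤ.-1ℤ ℤ.* w) ≡ w ℤ.* w
  negs = ℤ-Solver.solve-∀
  ones : ∀ w → 1ℤ ℤ.* w ℤ.* (1ℤ ℤ.* w) ≡ w ℤ.* w
  ones = ℤ-Solver.solve-∀
  squares : ∀ b → sgn b ℤ.* w ℤ.* (sgn b ℤ.* w) ≡ w ℤ.* w
  squares true  = negs w
  squares false = ones w

balanced-of-scaling : ∀ {d} r (xs : List A) (u : Fin (suc d) → A → ℤ) l →
  (∀ x → r * leverage xs (det² u) l x ≤ 12 * mass xs (det² u) l) → Balanced r xs (λ k x → + l x ℤ.* u k x)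
balanced-of-scaling r xs u l scaled x = begin
  + r ℤ.* energy xs (λ k x → + l x ℤ.* u k x) (x ∷ []) (λ _ → 1ℤ) ≡⟨ cong (+ r ℤ.*_) (energy-scale xs u l x) ⟩
  + r ℤ.* + leverage xs (det² u) l x          ≡⟨ ℤₚ.pos-* r _ ⟨
  + (r * leverage xs (det² u) l x)            ≤⟨ ℤ.+≤+ (scaled x) ⟩
  + (12 * mass xs (det² u) l)                 ≡⟨ ℤₚ.pos-* 12 (mass xs (det² u) l) ⟩
  + 12 ℤ.* + mass xs (det² u) l               ≡⟨ cong (+ 12 ℤ.*_) (volume-scale xs u l) ⟨
  + 12 ℤ.* volume xs (λ k x → + l x ℤ.* u k x) ∎
  where open ℤₚ.≤-Reasoning

pos-^ : ∀ a n → (+ a) ℤ.^ n ≡ + (a ^ n)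
pos-^ a zero    = refl
pos-^ a (suc n) = trans (cong (+ a ℤ.*_) (pos-^ a n)) (sym (ℤₚ.pos-* a (a ^ n)))

sign-rank-bound : ∀ r d p (ys : List B) → 0 < r → (∀ y → y ∈ ys) → 0 < List.length ys →
  (u : Fin (suc d) → Fin r × Fin (suc d) → ℤ) (v : B → Fin (suc d) → ℤ)
  (σ : Fin r × Fin (suc d) → B → Bool) (g : Fin r × Fin (suc d) → B → ℤ) →
  (∀ x y → 1ℤ ℤ.≤ sgn (σ x y) ℤ.* combination u (v y) x) →
  (∀ x y → 1ℤ ℤ.≤ sgn (σ x y) ℤ.* g x y) →
  (∀ {x x′} → x ≢ x′ → ∑ ys (λ y → g x y ℤ.* g x′ y) ≡ 0ℤ) →
  (∀ x → ∑ ys (λ y → g x y ℤ.* g x y) ℤ.≤ + p ℤ.* + List.length ys) →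
  r ≤ 12 * suc d ^ 4 * p
sign-rank-bound {B = B} r d p ys 0<r yComplete 0<len u v σ g sign gsign orth norm =
  -- M exceeds every |v y k|, the error that the perturbation causes, and M ≥ 2 keeps an integer
  -- congruent to 1 modulo M away from 0.
  perturbed (2 + ∑ᴺ ys (λ y → ∑ᴺ (List.allFin (suc d)) (λ k → ∣ v y k ∣))) (s≤s (s≤s z≤n))
    (λ y k → s≤s (ℕₚ.m≤n⇒m≤1+n (ℕₚ.≤-trans (∑ᴺ-term (λ k → ∣ v y k ∣) (∈-allFin k))
                                          (∑ᴺ-term (λ y → ∑ᴺ (List.allFin (suc d)) (λ k → ∣ v y k ∣)) (yComplete y)))))
  where
  X : Set
  X = Fin r × Fin (suc d)
  xs : List X
  xs = List.cartesianProduct (List.allFin r) (List.allFin (suc d))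
  complete : ∀ x → x ∈ xs
  complete (i , c) = ∈-cartesianProduct⁺ (∈-allFin i) (∈-allFin c)
  uniq : Unique xs
  uniq = cartesianProduct⁺ (allFin⁺ r) (allFin⁺ (suc d))
  len : List.length xs ≡ r * suc d
  len = trans (length-cartesianProduct (List.allFin r) (List.allFin (suc d)))
              (cong₂ _*_ (Listₚ.length-tabulate {n = r} (λ i → i)) (Listₚ.length-tabulate {n = suc d} (λ i → i)))
  cast : + 12 ℤ.* (+ suc d) ℤ.^ 4 ℤ.* + p ≡ + (12 * suc d ^ 4 * p)
  cast = trans (cong (λ a → + 12 ℤ.* a ℤ.* + p) (pos-^ (suc d) 4))
               (trans (cong (ℤ._* + p) (sym (ℤₚ.pos-* 12 (suc d ^ 4)))) (sym (ℤₚ.pos-* (12 * suc d ^ 4) p)))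
  scaled : ∀ M → (∀ y k → ∣ v y k ∣ < M) → (l : X → ℕ) → (∀ x → 1 ≤ l x) →
    let u′ = λ k x → + M ℤ.* u k x ℤ.+ δ k (proj₂ x) in
    0 < mass xs (det² u′) l → (∀ x → r * leverage xs (det² u′) l x ≤ 12 * mass xs (det² u′) l) →
    + r ℤ.≤ + 12 ℤ.* (+ suc d) ℤ.^ 4 ℤ.* + p
  scaled M v<M l l≥1 0<mass balanced =
    balanced-bound r p ys U v g uniq
      (subst (0ℤ ℤ.<_) (sym (volume-scale xs u′ l)) (ℤ.+<+ 0<mass))
      (balanced-of-scaling r xs u′ l balanced) 0<len orth norm
      (λ x y → ∣i∣≤ (σ x y) (gsign x y) (U-sign x y))
      (λ y → ℤₚ.<-≤-trans (0<square (σ x₀ y) (U-sign x₀ y)) (∑-term (λ x → 0≤i*i (combination U (v y) x)) (complete x₀)))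
    where
    u′ U : Fin (suc d) → X → ℤ
    u′ k x = + M ℤ.* u k x ℤ.+ δ k (proj₂ x)
    U k x = + l x ℤ.* u′ k x
    -- An arbitrary row; its nonzero entry shows that the column has positive norm.
    x₀ : X
    x₀ = Fin.fromℕ< 0<r , zero
    U-sign : ∀ x y → 1ℤ ℤ.≤ sgn (σ x y) ℤ.* combination U (v y) x
    U-sign x y = subst (λ a → 1ℤ ℤ.≤ sgn (σ x y) ℤ.* a) (sym (combination-perturb l M u (v y) x))
      (perturb (σ x y) M (l x) (sign x y) (v<M y (proj₂ x)) (l≥1 x))
  perturbed : ∀ M → 2 ≤ M → (∀ y k → ∣ v y k ∣ < M) → r ≤ 12 * suc d ^ 4 * p
  perturbed M M≥2 v<M = conclude (balanced-scaling (≡-dec Fin._≟_ Fin._≟_) complete uniq ω r 0<r len lower)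
    where
    ω : Vec X (suc d) → ℕ
    ω = det² (λ k x → + M ℤ.* u k x ℤ.+ δ k (proj₂ x))
    lower : ∀ l → ∏ᴺ xs (square l) ≤ mass xs ω l ^ r
    lower = blocks-lower ω (block-det² M M≥2 u)
    conclude : ∃[ l ] ((∀ x → 1 ≤ l x) × (∀ x → r * leverage xs ω l x ≤ 12 * mass xs ω l)) → r ≤ 12 * suc d ^ 4 * p
    conclude (l , l≥1 , balanced) = ℤₚ.drop‿+≤+ (ℤₚ.≤-trans
      (scaled M v<M l l≥1
        -- Positivity of the volume comes from the same block bound: 1 ≤ ∏ l² ≤ mass^r.
        (1≤m^n⇒0<m _ r 0<r (ℕₚ.≤-trans (∏ᴺ-≥1 xs (λ x → ℕₚ.*-mono-≤ (l≥1 x) (l≥1 x))) (lower l))) balanced)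
      (ℤₚ.≤-reflexive cast))

-- Orthogonality of the inner product matrix

dot : ∀ {p t} → Vec Bool t → Vec (Fin p) t → ℕ
dot []          []       = 0
dot (true  ∷ x) (i ∷ y)  = Fin.toℕ i + dot x y
dot (false ∷ x) (i ∷ y)  = dot x y

∑-tabulate : ∀ {n} (h : Fin n → A) (f : A → ℤ) → ∑ (List.tabulate h) f ≡ ∑ (List.allFin n) (λ i → f (h i))
∑-tabulate h f = trans (cong (λ zs → ∑ zs f) (sym (Listₚ.map-tabulate (λ i → i) h))) (∑-map h (List.allFin _) f)

∑-shift : ∀ p (f : ℕ → ℤ) → f 0 ℤ.+ ∑ (List.allFin p) (λ i → f (suc (Fin.toℕ i))) ≡ ∑ (List.allFin p) (λ i → f (Fin.toℕ i)) ℤ.+ f p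
∑-shift zero    f = ℤₚ.+-comm (f 0) 0ℤ
∑-shift (suc p) f = begin
  f 0 ℤ.+ (f 1 ℤ.+ ∑ (List.tabulate (suc {p})) (λ i → f (suc (Fin.toℕ i))))
    ≡⟨ cong (λ a → f 0 ℤ.+ (f 1 ℤ.+ a)) (∑-tabulate (suc {p}) (λ i → f (suc (Fin.toℕ i)))) ⟩
  f 0 ℤ.+ (f 1 ℤ.+ ∑ (List.allFin p) (λ i → f (suc (suc (Fin.toℕ i)))))
    ≡⟨ cong (ℤ._+_ (f 0)) (∑-shift p (λ n → f (suc n))) ⟩
  f 0 ℤ.+ (∑ (List.allFin p) (λ i → f (suc (Fin.toℕ i))) ℤ.+ f (suc p))
    ≡⟨ ℤₚ.+-assoc (f 0) _ _ ⟨
  f 0 ℤ.+ ∑ (List.allFin p) (λ i → f (suc (Fin.toℕ i))) ℤ.+ f (suc p)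
    ≡⟨ cong (λ a → f 0 ℤ.+ a ℤ.+ f (suc p)) (∑-tabulate (suc {p}) (λ i → f (Fin.toℕ i))) ⟨
  f 0 ℤ.+ ∑ (List.tabulate (suc {p})) (λ i → f (Fin.toℕ i)) ℤ.+ f (suc p) ∎
  where open ≡-Reasoning

-- Moving the window by one step trades its first value for the equal value one period later.
∑-period : ∀ p (g : ℕ → ℤ) → (∀ z → g (z + p) ≡ g z) → ∀ s →
           ∑ (List.allFin p) (λ i → g (s + Fin.toℕ i)) ≡ ∑ (List.allFin p) (λ i → g (Fin.toℕ i))
∑-period p g periodic zero    = refl
∑-period p g periodic (suc s) = trans (∙-cancelˡ (g (s + 0)) _ _ (begin
  g (s + 0) ℤ.+ ∑ (List.allFin p) (λ i → g (suc s + Fin.toℕ i))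
    ≡⟨ cong (ℤ._+_ (g (s + 0))) (∑-cong (List.allFin p) (λ i → cong g (sym (ℕₚ.+-suc s (Fin.toℕ i))))) ⟩
  g (s + 0) ℤ.+ ∑ (List.allFin p) (λ i → g (s + suc (Fin.toℕ i)))
    ≡⟨ ∑-shift p (λ n → g (s + n)) ⟩
  ∑ (List.allFin p) (λ i → g (s + Fin.toℕ i)) ℤ.+ g (s + p)
    ≡⟨ cong (ℤ._+_ (∑ (List.allFin p) (λ i → g (s + Fin.toℕ i)))) (trans (periodic s) (cong g (sym (ℕₚ.+-identityʳ s)))) ⟩
  ∑ (List.allFin p) (λ i → g (s + Fin.toℕ i)) ℤ.+ g (s + 0)
    ≡⟨ ℤₚ.+-comm (∑ (List.allFin p) (λ i → g (s + Fin.toℕ i))) (g (s + 0)) ⟩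
  g (s + 0) ℤ.+ ∑ (List.allFin p) (λ i → g (s + Fin.toℕ i)) ∎)) (∑-period p g periodic s)
  where open ≡-Reasoning

-- At a coordinate where x and x′ differ, the entry of y enters only one of the two factors, and
-- summing over it runs through a full period of g, which gives 0. Coordinates passed before are
-- absorbed in the offsets s and s′.
rows-orthogonal : ∀ p (g : ℕ → ℤ) → (∀ s → ∑ (List.allFin p) (λ i → g (s + Fin.toℕ i)) ≡ 0ℤ) →
  ∀ {t} {x x′ : Vec Bool t} → x ≢ x′ → ∀ s s′ → ∑ (tuples (List.allFin p) t) (λ y → g (s + dot x y) ℤ.* g (s′ + dot x′ y)) ≡ 0ℤ
rows-orthogonal p g mean {x = []} {[]} x≢x′ s s′ = contradiction refl x≢x′
rows-orthogonal p g mean {suc t} {b ∷ x} {b′ ∷ x′} x≢x′ s s′ =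
  trans (∑-tuples (List.allFin p) t (λ y → g (s + dot (b ∷ x) y) ℤ.* g (s′ + dot (b′ ∷ x′) y))) (heads b b′ x≢x′)
  where
  Y : List (Vec (Fin p) t)
  Y = tuples (List.allFin p) t
  move : ∀ a b c → a + (b + c) ≡ a + c + b
  move = ℕ-Solver.solve-∀
  heads : ∀ b b′ → b ∷ x ≢ b′ ∷ x′ →
    ∑ (List.allFin p) (λ i → ∑ Y (λ y → g (s + dot (b ∷ x) (i ∷ y)) ℤ.* g (s′ + dot (b′ ∷ x′) (i ∷ y)))) ≡ 0ℤ
  heads false false ne = ∑-0 (List.allFin p) (λ i → rows-orthogonal p g mean (λ eq → ne (cong (false ∷_) eq)) s s′)
  heads true  true  ne = ∑-0 (List.allFin p) (λ i → trans
    (∑-cong Y (λ y → cong₂ (λ a a′ → g a ℤ.* g a′) (sym (ℕₚ.+-assoc s (Fin.toℕ i) (dot x y))) (sym (ℕₚ.+-assoc s′ (Fin.toℕ i) (dot x′ y)))))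
    (rows-orthogonal p g mean (λ eq → ne (cong (true ∷_) eq)) (s + Fin.toℕ i) (s′ + Fin.toℕ i)))
  heads true  false ne = trans (∑-swap (List.allFin p) Y (λ i y → g (s + (Fin.toℕ i + dot x y)) ℤ.* g (s′ + dot x′ y)))
    (∑-0 Y (λ y → trans (∑-*ʳ (List.allFin p) (g (s′ + dot x′ y)) (λ i → g (s + (Fin.toℕ i + dot x y))))
      (trans (cong (ℤ._* g (s′ + dot x′ y)) (trans (∑-cong (List.allFin p) (λ i → cong g (move s (Fin.toℕ i) (dot x y)))) (mean (s + dot x y))))
             (ℤₚ.*-zeroˡ (g (s′ + dot x′ y))))))
  heads false true  ne = trans (∑-swap (List.allFin p) Y (λ i y → g (s + dot x y) ℤ.* g (s′ + (Fin.toℕ i + dot x′ y))))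
    (∑-0 Y (λ y → trans (∑-*ˡ (List.allFin p) (g (s + dot x y)) (λ i → g (s′ + (Fin.toℕ i + dot x′ y))))
      (trans (cong (g (s + dot x y) ℤ.*_) (trans (∑-cong (List.allFin p) (λ i → cong g (move s′ (Fin.toℕ i) (dot x′ y)))) (mean (s′ + dot x′ y))))
             (ℤₚ.*-zeroʳ (g (s + dot x y))))))

-- A mean-zero function with a prescribed sign pattern

if-eq : Bool → Bool → ℕ
if-eq true  true  = 1
if-eq false false = 1
if-eq _     _     = 0

count : Bool → List A → (A → Bool) → ℕ
count b zs h = ∑ᴺ zs (λ z → if-eq b (h z))

-- With nT and nF the numbers of `true` and `false` values in a period, the crossed weights sum to
-- nT nF - nF nT = 0.
balance : ℕ → ℕ → Bool → ℤ
balance nT nF true  = ℤ.- + nF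
balance nT nF false = + nT

∑-balance : ∀ (zs : List A) h nT nF → ∑ zs (λ z → balance nT nF (h z)) ≡ + nT ℤ.* + count false zs h ℤ.- + nF ℤ.* + count true zs h
∑-balance [] h nT nF = sym (trans (cong₂ ℤ._-_ (ℤₚ.*-zeroʳ (+ nT)) (ℤₚ.*-zeroʳ (+ nF))) refl)
∑-balance (z ∷ zs) h nT nF with h z
... | true  = trans (cong (ℤ._+_ (ℤ.- + nF)) (∑-balance zs h nT nF)) (identity (+ nT) (+ nF) (+ count false zs h) (+ count true zs h))
  where
  identity : ∀ a b f t → ℤ.- b ℤ.+ (a ℤ.* f ℤ.- b ℤ.* t) ≡ a ℤ.* f ℤ.- b ℤ.* (1ℤ ℤ.+ t)
  identity = ℤ-Solver.solve-∀
... | false = trans (cong (ℤ._+_ (+ nT)) (∑-balance zs h nT nF)) (identity (+ nT) (+ nF) (+ count false zs h) (+ count true zs h))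
  where
  identity : ∀ a b f t → a ℤ.+ (a ℤ.* f ℤ.- b ℤ.* t) ≡ a ℤ.* (1ℤ ℤ.+ f) ℤ.- b ℤ.* t
  identity = ℤ-Solver.solve-∀

count-≤ : ∀ b (zs : List A) h → count b zs h ≤ List.length zs
count-≤ b []       h = z≤n
count-≤ b (z ∷ zs) h = ℕₚ.+-mono-≤ (if-eq-≤ b (h z)) (count-≤ b zs h)
  where
  if-eq-≤ : ∀ b b′ → if-eq b b′ ≤ 1
  if-eq-≤ true  true  = ℕₚ.≤-refl
  if-eq-≤ true  false = z≤n
  if-eq-≤ false true  = z≤n
  if-eq-≤ false false = ℕₚ.≤-refl

count-≥1 : ∀ {zs : List A} (h : A → Bool) {z} → z ∈ zs → 1 ≤ count (h z) zs h
count-≥1 h {z} z∈ = ℕₚ.≤-trans (ℕₚ.≤-reflexive (sym (if-eq-refl (h z)))) (∑ᴺ-term (λ x → if-eq (h z) (h x)) z∈)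
  where
  if-eq-refl : ∀ b → if-eq b b ≡ 1
  if-eq-refl true  = refl
  if-eq-refl false = refl

balance-sgn : ∀ nT nF b → 1 ≤ nT → 1 ≤ nF → 1ℤ ℤ.≤ sgn b ℤ.* balance nT nF b
balance-sgn nT nF true  nT≥1 nF≥1 = subst (1ℤ ℤ.≤_) (negs (+ nF)) (ℤ.+≤+ nF≥1)
  where
  negs : ∀ a → a ≡ ℤ.-1ℤ ℤ.* (ℤ.- a)
  negs = ℤ-Solver.solve-∀
balance-sgn nT nF false nT≥1 nF≥1 = subst (1ℤ ℤ.≤_) (sym (ℤₚ.*-identityˡ (+ nT))) (ℤ.+≤+ nT≥1)

balance² : ∀ nT nF p b → nT ≤ p → nF ≤ p → balance nT nF b ℤ.* balance nT nF b ℤ.≤ + (p * p)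
balance² nT nF p true  nT≤p nF≤p = subst (ℤ._≤ + (p * p)) (trans (ℤₚ.pos-* nF nF) (negs (+ nF))) (ℤ.+≤+ (ℕₚ.*-mono-≤ nF≤p nF≤p))
  where
  negs : ∀ a → a ℤ.* a ≡ ℤ.- a ℤ.* ℤ.- a
  negs = ℤ-Solver.solve-∀
balance² nT nF p false nT≤p nF≤p = subst (ℤ._≤ + (p * p)) (ℤₚ.pos-* nT nT) (ℤ.+≤+ (ℕₚ.*-mono-≤ nT≤p nT≤p))

-- Distinct rows from binary expansions

digit : Fin 2 → Bool
digit zero    = false
digit (suc _) = true

digit-injective : ∀ {i j} → digit i ≡ digit j → i ≡ j
digit-injective {zero}     {zero}     _ = refl
digit-injective {suc zero} {suc zero} _ = refl

bits : ∀ t → Fin (2 ^ t) → Vec Bool t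
bits zero    i = []
bits (suc t) i = digit (proj₁ (Fin.remQuot {2} (2 ^ t) i)) ∷ bits t (proj₂ (Fin.remQuot {2} (2 ^ t) i))

bits-injective : ∀ t {i j} → bits t i ≡ bits t j → i ≡ j
bits-injective zero    {zero} {zero} _ = refl
bits-injective (suc t) {i} {j} eq = begin
  i                                                   ≡⟨ Finₚ.combine-remQuot {2} (2 ^ t) i ⟨
  Fin.combine (proj₁ (remQuot i)) (proj₂ (remQuot i)) ≡⟨ cong₂ Fin.combine (digit-injective (cong Vec.head eq)) (bits-injective t (cong Vec.tail eq)) ⟩
  Fin.combine (proj₁ (remQuot j)) (proj₂ (remQuot j)) ≡⟨ Finₚ.combine-remQuot {2} (2 ^ t) j ⟩
  j                                                   ∎
  where
  open ≡-Reasoning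
  remQuot : Fin (2 * 2 ^ t) → Fin 2 × Fin (2 ^ t)
  remQuot = Fin.remQuot {2} (2 ^ t)

row : ∀ {r d t} → r * d ≤ 2 ^ t → Fin r × Fin d → Vec Bool t
row {t = t} le (i , c) = bits t (Fin.inject≤ (Fin.combine i c) le)

row-injective : ∀ {r d t} (le : r * d ≤ 2 ^ t) {x x′} → row {r} {d} {t} le x ≡ row le x′ → x ≡ x′
row-injective {t = t} le {i , c} {i′ , c′} eq =
  let ii , cc = Finₚ.combine-injective i c i′ c′ (Finₚ.inject≤-injective le le _ _ (bits-injective t eq)) in cong₂ _,_ ii cc

-- Otherwise {0,1}^t has room for r (d+1) distinct rows with r too large for `sign-rank-bound`.
-- Since `dot` is taken in ℕ, the period of H does the reduction modulo p.
inner-product-bound : ∀ p t d (H : ℕ → Bool) → 2 ≤ p → (∀ z → H (z + p) ≡ H z) → H 0 ≢ H 1 →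
  (u : Fin (suc d) → Vec Bool t → ℤ) (v : Vec (Fin p) t → Fin (suc d) → ℤ) →
  (∀ x y → 1ℤ ℤ.≤ sgn (H (dot x y)) ℤ.* combination u (v y) x) →
  2 ^ t < suc (12 * suc d ^ 4 * (p * p)) * suc d
inner-product-bound (suc zero) t d H (s≤s ())
inner-product-bound p@(suc (suc p′)) t d H p≥2 periodic H0≢H1 u v sign = ℕₚ.≰⇒> (λ le → ℕₚ.<-irrefl refl (bound le))
  where
  ys : List (Vec (Fin p) t)
  ys = tuples (List.allFin p) t
  complete : ∀ y → y ∈ ys
  complete = ∈-tuples ∈-allFin
  h : Fin p → Bool
  h i = H (Fin.toℕ i)
  nT nF : ℕ
  nT = count true  (List.allFin p) h
  nF = count false (List.allFin p) h
  counts : ∀ b₀ b₁ → b₀ ≢ b₁ → 1 ≤ count b₀ (List.allFin p) h → 1 ≤ count b₁ (List.allFin p) h → 1 ≤ nT × 1 ≤ nF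
  counts true  true  ne _ _ = contradiction refl ne
  counts false false ne _ _ = contradiction refl ne
  counts true  false _ a b  = a , b
  counts false true  _ a b  = b , a
  positive : 1 ≤ nT × 1 ≤ nF
  positive = counts (H 0) (H 1) H0≢H1 (count-≥1 h (∈-allFin zero)) (count-≥1 h (∈-allFin (suc zero)))
  count≤p : ∀ b → count b (List.allFin p) h ≤ p
  count≤p b = ℕₚ.≤-trans (count-≤ b (List.allFin p) h) (ℕₚ.≤-reflexive (Listₚ.length-tabulate {n = p} (λ i → i)))
  g : ℕ → ℤ
  g z = balance nT nF (H z)
  mean : ∀ s → ∑ (List.allFin p) (λ i → g (s + Fin.toℕ i)) ≡ 0ℤ
  mean s = trans (∑-period p g (λ z → cong (balance nT nF) (periodic z)) s)
    (trans (∑-balance (List.allFin p) h nT nF) (cancel (+ nT) (+ nF)))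
    where
    cancel : ∀ a b → a ℤ.* b ℤ.- b ℤ.* a ≡ 0ℤ
    cancel = ℤ-Solver.solve-∀
  0<len : 0 < List.length ys
  0<len = nonempty (complete (Vec.replicate t zero))
    where
    nonempty : ∀ {y} {ys : List (Vec (Fin p) t)} → y ∈ ys → 0 < List.length ys
    nonempty (here _)  = s≤s z≤n
    nonempty (there _) = s≤s z≤n
  r : ℕ
  -- One more than `sign-rank-bound` permits for rows of squared norm at most p² per column.
  r = suc (12 * suc d ^ 4 * (p * p))
  bound : r * suc d ≤ 2 ^ t → r ≤ 12 * suc d ^ 4 * (p * p)
  bound le = sign-rank-bound r d (p * p) ys (s≤s z≤n) complete 0<len
    (λ k x → u k (row le x)) v (λ x y → H (dot (row le x) y)) (λ x y → g (dot (row le x) y))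
    (λ x y → sign (row le x) y)
    (λ x y → balance-sgn nT nF (H (dot (row le x) y)) (proj₁ positive) (proj₂ positive))
    (λ {x} {x′} x≢x′ → rows-orthogonal p g mean {t} {row le x} {row le x′} (λ eq → x≢x′ (row-injective {t = t} le eq)) 0 0)
    (λ x → ℤₚ.≤-trans (∑-mono ys (λ y → balance² nT nF p (H (dot (row le x) y)) (count≤p true) (count≤p false)))
      (ℤₚ.≤-reflexive (trans (∑-const ys (+ (p * p))) (ℤₚ.*-comm (+ List.length ys) (+ (p * p))))))

-- Clearing denominators

-- The denominator 1 is built in, so numerator and denominator reduce by computation.
fromℤ : ℤ → ℚ
fromℤ z = mkℚ z 0 (Coprimality.sym (Coprimality.1-coprimeTo ∣ z ∣))

fromℤ-+ : ∀ a b → fromℤ (a ℤ.+ b) ≡ fromℤ a ℚ.+ fromℤ b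
fromℤ-+ a b = ℚₚ.toℚᵘ-injective (ℚᵘₚ.≃-trans (ℚᵘ.*≡* (identity a b)) (ℚᵘₚ.≃-sym (ℚₚ.toℚᵘ-homo-+ (fromℤ a) (fromℤ b))))
  where
  identity : ∀ a b → (a ℤ.+ b) ℤ.* 1ℤ ≡ (a ℤ.* 1ℤ ℤ.+ b ℤ.* 1ℤ) ℤ.* 1ℤ
  identity = ℤ-Solver.solve-∀

fromℤ-* : ∀ a b → fromℤ (a ℤ.* b) ≡ fromℤ a ℚ.* fromℤ b
fromℤ-* a b = ℚₚ.toℚᵘ-injective (ℚᵘₚ.≃-trans (ℚᵘ.*≡* refl) (ℚᵘₚ.≃-sym (ℚₚ.toℚᵘ-homo-* (fromℤ a) (fromℤ b))))

denominator-* : ∀ q → fromℤ (ℚ.↧ q) ℚ.* q ≡ fromℤ (ℚ.↥ q)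
denominator-* q@(mkℚ n d c) = ℚₚ.toℚᵘ-injective (ℚᵘₚ.≃-trans (ℚₚ.toℚᵘ-homo-* (fromℤ (ℚ.↧ q)) q)
  (ℚᵘ.*≡* (trans (identity (+ suc d) n) (cong (λ e → n ℤ.* + suc e) (sym (ℕₚ.+-identityʳ d))))))
  where
  identity : ∀ a b → a ℤ.* b ℤ.* 1ℤ ≡ b ℤ.* a
  identity = ℤ-Solver.solve-∀

pm-fromℤ : ∀ b → pm b ≡ fromℤ (sgn b)
pm-fromℤ true  = refl
pm-fromℤ false = refl

-- Multiplier and integer weights are chosen before b, so one integral form serves all inputs.
sum-integral : ∀ s (w : Fin s → ℚ) → Σ ℕ λ D → Σ (Fin s → ℤ) λ W → (b : Fin s → Bool) →
  fromℤ (+ suc D) ℚ.* sumFin s (λ i → w i ℚ.* pm (b i)) ≡ fromℤ (∑ (List.allFin s) (λ i → W i ℤ.* sgn (b i)))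
sum-integral zero    w = 0 , (λ ()) , λ b → refl
sum-integral (suc s) w with sum-integral s (λ i → w (suc i))
-- The first component is the predecessor of suc D * suc D₀, the product of all denominators.
... | D , W , eq = D₀ + D * suc D₀ , W′ , λ b → begin
    fromℤ (+ (suc D * suc D₀)) ℚ.* (w zero ℚ.* pm (b zero) ℚ.+ S b)
      ≡⟨ cong (ℚ._* (w zero ℚ.* pm (b zero) ℚ.+ S b)) (trans (cong fromℤ (ℤₚ.pos-* (suc D) (suc D₀))) (fromℤ-* (+ suc D) (+ suc D₀))) ⟩
    fD ℚ.* fD₀ ℚ.* (w zero ℚ.* pm (b zero) ℚ.+ S b)
      ≡⟨ ℚₚ.*-distribˡ-+ (fD ℚ.* fD₀) (w zero ℚ.* pm (b zero)) (S b) ⟩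
    fD ℚ.* fD₀ ℚ.* (w zero ℚ.* pm (b zero)) ℚ.+ fD ℚ.* fD₀ ℚ.* S b
      ≡⟨ cong₂ ℚ._+_ (first b) (second b) ⟩
    fromℤ (+ suc D ℤ.* ℚ.↥ w zero ℤ.* sgn (b zero)) ℚ.+ fromℤ (+ suc D₀ ℤ.* Z b)
      ≡⟨ fromℤ-+ (+ suc D ℤ.* ℚ.↥ w zero ℤ.* sgn (b zero)) (+ suc D₀ ℤ.* Z b) ⟨
    fromℤ (+ suc D ℤ.* ℚ.↥ w zero ℤ.* sgn (b zero) ℤ.+ + suc D₀ ℤ.* Z b)
      ≡⟨ cong (λ a → fromℤ (+ suc D ℤ.* ℚ.↥ w zero ℤ.* sgn (b zero) ℤ.+ a)) (tail b) ⟩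
    fromℤ (∑ (List.allFin (suc s)) (λ i → W′ i ℤ.* sgn (b i))) ∎
  where
  open ≡-Reasoning
  D₀ : ℕ
  D₀ = ℚ.denominator-1 (w zero)
  fD fD₀ : ℚ
  fD  = fromℤ (+ suc D)
  fD₀ = fromℤ (+ suc D₀)
  W′ : Fin (suc s) → ℤ
  W′ zero    = + suc D ℤ.* ℚ.↥ w zero
  W′ (suc i) = + suc D₀ ℤ.* W i
  S : (Fin (suc s) → Bool) → ℚ
  S b = sumFin s (λ i → w (suc i) ℚ.* pm (b (suc i)))
  Z : (Fin (suc s) → Bool) → ℤ
  Z b = ∑ (List.allFin s) (λ i → W i ℤ.* sgn (b (suc i)))
  first : ∀ b → fD ℚ.* fD₀ ℚ.* (w zero ℚ.* pm (b zero)) ≡ fromℤ (+ suc D ℤ.* ℚ.↥ w zero ℤ.* sgn (b zero))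
  first b = begin
    fD ℚ.* fD₀ ℚ.* (w zero ℚ.* pm (b zero))       ≡⟨ ℚₚ.*-assoc (fD ℚ.* fD₀) (w zero) (pm (b zero)) ⟨
    fD ℚ.* fD₀ ℚ.* w zero ℚ.* pm (b zero)         ≡⟨ cong (ℚ._* pm (b zero)) (ℚₚ.*-assoc fD fD₀ (w zero)) ⟩
    fD ℚ.* (fD₀ ℚ.* w zero) ℚ.* pm (b zero)       ≡⟨ cong₂ (λ a c → fD ℚ.* a ℚ.* c) (denominator-* (w zero)) (pm-fromℤ (b zero)) ⟩
    fD ℚ.* fromℤ (ℚ.↥ w zero) ℚ.* fromℤ (sgn (b zero)) ≡⟨ cong (ℚ._* fromℤ (sgn (b zero))) (fromℤ-* (+ suc D) (ℚ.↥ w zero)) ⟨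
    fromℤ (+ suc D ℤ.* ℚ.↥ w zero) ℚ.* fromℤ (sgn (b zero)) ≡⟨ fromℤ-* (+ suc D ℤ.* ℚ.↥ w zero) (sgn (b zero)) ⟨
    fromℤ (+ suc D ℤ.* ℚ.↥ w zero ℤ.* sgn (b zero)) ∎
  second : ∀ b → fD ℚ.* fD₀ ℚ.* S b ≡ fromℤ (+ suc D₀ ℤ.* Z b)
  second b = begin
    fD ℚ.* fD₀ ℚ.* S b            ≡⟨ cong (ℚ._* S b) (ℚₚ.*-comm fD fD₀) ⟩
    fD₀ ℚ.* fD ℚ.* S b            ≡⟨ ℚₚ.*-assoc fD₀ fD (S b) ⟩
    fD₀ ℚ.* (fD ℚ.* S b)          ≡⟨ cong (fD₀ ℚ.*_) (eq (λ i → b (suc i))) ⟩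
    fD₀ ℚ.* fromℤ (Z b)           ≡⟨ fromℤ-* (+ suc D₀) (Z b) ⟨
    fromℤ (+ suc D₀ ℤ.* Z b)      ∎
  tail : ∀ b → + suc D₀ ℤ.* Z b ≡ ∑ (List.tabulate (suc {s})) (λ i → W′ i ℤ.* sgn (b i))
  tail b = begin
    + suc D₀ ℤ.* Z b                                                        ≡⟨ ∑-*ˡ (List.allFin s) (+ suc D₀) (λ i → W i ℤ.* sgn (b (suc i))) ⟨
    ∑ (List.allFin s) (λ i → + suc D₀ ℤ.* (W i ℤ.* sgn (b (suc i))))        ≡⟨ ∑-cong (List.allFin s) (λ i → sym (ℤₚ.*-assoc (+ suc D₀) (W i) (sgn (b (suc i))))) ⟩
    ∑ (List.allFin s) (λ i → W′ (suc i) ℤ.* sgn (b (suc i)))                ≡⟨ ∑-tabulate (suc {s}) (λ i → W′ i ℤ.* sgn (b i)) ⟨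
    ∑ (List.tabulate (suc {s})) (λ i → W′ i ℤ.* sgn (b i))                        ∎

fromℤ-sign : ∀ D q z → fromℤ (+ suc D) ℚ.* q ≡ fromℤ z → (q ℚ.< 0ℚ → z ℤ.< 0ℤ) × (0ℚ ℚ.≤ q → 0ℤ ℤ.≤ z)
fromℤ-sign D q z eq = negative , nonnegative
  where
  fD : ℚ
  fD = fromℤ (+ suc D)
  negative : q ℚ.< 0ℚ → z ℤ.< 0ℤ
  negative q<0 with subst (ℚ._< 0ℚ) eq (subst (fD ℚ.* q ℚ.<_) (ℚₚ.*-zeroʳ fD) (ℚₚ.*-monoʳ-<-pos fD q<0))
  ... | ℚ.*<* z<0 = subst (ℤ._< 0ℤ) (ℤₚ.*-identityʳ z) z<0
  nonnegative : 0ℚ ℚ.≤ q → 0ℤ ℤ.≤ z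
  nonnegative 0≤q with subst (0ℚ ℚ.≤_) eq (subst (ℚ._≤ fD ℚ.* q) (ℚₚ.*-zeroʳ fD) (ℚₚ.*-monoˡ-≤-nonNeg fD 0≤q))
  ... | ℚ.*≤* 0≤z = subst (0ℤ ℤ.≤_) (ℤₚ.*-identityʳ z) 0≤z

integral-weights : ∀ s (β : ℚ) (w : Fin s → ℚ) → Σ ℤ λ B → Σ (Fin s → ℤ) λ W → (b : Fin s → Bool) →
  let q = β ℚ.+ sumFin s (λ i → w i ℚ.* pm (b i))
      z = B ℤ.+ ∑ (List.allFin s) (λ i → W i ℤ.* sgn (b i))
  in (q ℚ.< 0ℚ → z ℤ.< 0ℤ) × (0ℚ ℚ.≤ q → 0ℤ ℤ.≤ z)
integral-weights s β w = W zero , (λ i → W (suc i)) , λ b →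
  fromℤ-sign D (β ℚ.+ sumFin s (λ i → w i ℚ.* pm (b i))) (W zero ℤ.+ ∑ (List.allFin s) (λ i → W (suc i) ℤ.* sgn (b i))) (trans
    (cong (λ a → fromℤ (+ suc D) ℚ.* (a ℚ.+ sumFin s (λ i → w i ℚ.* pm (b i)))) (sym (ℚₚ.*-identityʳ β)))
    (trans (proj₂ (proj₂ integral) (extend b))
      (cong fromℤ (cong₂ ℤ._+_ (ℤₚ.*-identityʳ (W zero)) (∑-tabulate (suc {s}) (λ i → W i ℤ.* sgn (extend b i)))))))
  where
  w′ : Fin (suc s) → ℚ
  w′ zero    = β
  w′ (suc i) = w i
  extend : (Fin s → Bool) → Fin (suc s) → Bool
  -- The bias becomes the weight of an extra gate with constant output `false`, that is, +1.
  extend b zero    = false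
  extend b (suc i) = b i
  integral : Σ ℕ λ D → Σ (Fin (suc s) → ℤ) λ W → (b : Fin (suc s) → Bool) →
    fromℤ (+ suc D) ℚ.* sumFin (suc s) (λ i → w′ i ℚ.* pm (b i)) ≡ fromℤ (∑ (List.allFin (suc s)) (λ i → W i ℤ.* sgn (b i)))
  integral = sum-integral (suc s) w′
  D : ℕ
  D = proj₁ integral
  W : Fin (suc s) → ℤ
  W = proj₁ (proj₂ integral)

-- Rank of a threshold circuit

-- A list of pairs (α, β) stands for the sum of the rank-one matrices α βᵀ; its length bounds the
-- rank.
evaluate : List ((A → ℤ) × (B → ℤ)) → A → B → ℤ
evaluate R x y = ∑ R (λ αβ → proj₁ αβ x ℤ.* proj₂ αβ y)

scaleˡ : (A → ℤ) → (A → ℤ) × (B → ℤ) → (A → ℤ) × (B → ℤ)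
scaleˡ f (α , β) = (λ x → f x ℤ.* α x) , β

scaleʳ : (B → ℤ) → (A → ℤ) × (B → ℤ) → (A → ℤ) × (B → ℤ)
scaleʳ f (α , β) = α , (λ y → f y ℤ.* β y)

evaluate-scaleˡ : ∀ (f : A → ℤ) (R : List ((A → ℤ) × (B → ℤ))) x y → evaluate (List.map (scaleˡ f) R) x y ≡ f x ℤ.* evaluate R x y
evaluate-scaleˡ f R x y = trans (∑-map (scaleˡ f) R _) (trans (∑-cong R (λ (α , β) → ℤₚ.*-assoc (f x) (α x) (β y))) (∑-*ˡ R (f x) _))

evaluate-scaleʳ : ∀ (f : B → ℤ) (R : List ((A → ℤ) × (B → ℤ))) x y → evaluate (List.map (scaleʳ f) R) x y ≡ f y ℤ.* evaluate R x y
evaluate-scaleʳ f R x y = trans (∑-map (scaleʳ f) R _) (trans (∑-cong R (λ (α , β) → exchange (α x) (f y) (β y))) (∑-*ˡ R (f y) _))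
  where
  exchange : ∀ a b c → a ℤ.* (b ℤ.* c) ≡ b ℤ.* (a ℤ.* c)
  exchange = ℤ-Solver.solve-∀

indicator : Bool → ℤ
indicator true  = 1ℤ
indicator false = 0ℤ

-- One rank-one term per leaf: the indicators of Alice's and of Bob's answers along the path, times
-- the sign of the leaf. On each input exactly one term is nonzero.
rectangles : Protocol A B → List ((A → ℤ) × (B → ℤ))
rectangles (leaf b)      = ((λ _ → 1ℤ) , (λ _ → sgn b)) ∷ []
rectangles (alice a l r) = List.map (scaleˡ (λ x → indicator (a x))) (rectangles r)
                        ++ List.map (scaleˡ (λ x → indicator (not (a x)))) (rectangles l)
rectangles (bob b l r)   = List.map (scaleʳ (λ y → indicator (b y))) (rectangles r)
                        ++ List.map (scaleʳ (λ y → indicator (not (b y)))) (rectangles l)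

select : ∀ c b b′ → indicator c ℤ.* sgn b ℤ.+ indicator (not c) ℤ.* sgn b′ ≡ sgn (if c then b else b′)
select true  b b′ = trans (ℤₚ.+-identityʳ _) (ℤₚ.*-identityˡ (sgn b))
select false b b′ = trans (ℤₚ.+-identityˡ _) (ℤₚ.*-identityˡ (sgn b′))

evaluate-rectangles : ∀ (π : Protocol A B) x y → evaluate (rectangles π) x y ≡ sgn (run π x y)
evaluate-rectangles (leaf b) x y = trans (ℤₚ.+-identityʳ _) (ℤₚ.*-identityˡ (sgn b))
evaluate-rectangles (alice a l r) x y = begin
  evaluate (rectangles (alice a l r)) x y
    ≡⟨ ∑-++ (List.map (scaleˡ (λ x → indicator (a x))) (rectangles r)) _ _ ⟩
  evaluate (List.map (scaleˡ (λ x → indicator (a x))) (rectangles r)) x y ℤ.+ evaluate (List.map (scaleˡ (λ x → indicator (not (a x)))) (rectangles l)) x y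
    ≡⟨ cong₂ ℤ._+_ (evaluate-scaleˡ (λ x → indicator (a x)) (rectangles r) x y) (evaluate-scaleˡ (λ x → indicator (not (a x))) (rectangles l) x y) ⟩
  indicator (a x) ℤ.* evaluate (rectangles r) x y ℤ.+ indicator (not (a x)) ℤ.* evaluate (rectangles l) x y
    ≡⟨ cong₂ (λ e e′ → indicator (a x) ℤ.* e ℤ.+ indicator (not (a x)) ℤ.* e′) (evaluate-rectangles r x y) (evaluate-rectangles l x y) ⟩
  indicator (a x) ℤ.* sgn (run r x y) ℤ.+ indicator (not (a x)) ℤ.* sgn (run l x y)
    ≡⟨ select (a x) (run r x y) (run l x y) ⟩
  sgn (run (alice a l r) x y) ∎
  where open ≡-Reasoning
evaluate-rectangles (bob b l r) x y = begin
  evaluate (rectangles (bob b l r)) x y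
    ≡⟨ ∑-++ (List.map (scaleʳ (λ y → indicator (b y))) (rectangles r)) _ _ ⟩
  evaluate (List.map (scaleʳ (λ y → indicator (b y))) (rectangles r)) x y ℤ.+ evaluate (List.map (scaleʳ (λ y → indicator (not (b y)))) (rectangles l)) x y
    ≡⟨ cong₂ ℤ._+_ (evaluate-scaleʳ (λ y → indicator (b y)) (rectangles r) x y) (evaluate-scaleʳ (λ y → indicator (not (b y))) (rectangles l) x y) ⟩
  indicator (b y) ℤ.* evaluate (rectangles r) x y ℤ.+ indicator (not (b y)) ℤ.* evaluate (rectangles l) x y
    ≡⟨ cong₂ (λ e e′ → indicator (b y) ℤ.* e ℤ.+ indicator (not (b y)) ℤ.* e′) (evaluate-rectangles r x y) (evaluate-rectangles l x y) ⟩
  indicator (b y) ℤ.* sgn (run r x y) ℤ.+ indicator (not (b y)) ℤ.* sgn (run l x y)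
    ≡⟨ select (b y) (run r x y) (run l x y) ⟩
  sgn (run (bob b l r) x y) ∎
  where open ≡-Reasoning

length-branches : ∀ {f g : A → B} (R R′ : List A) e e′ → List.length R ≤ 2 ^ e → List.length R′ ≤ 2 ^ e′ →
  List.length (List.map f R ++ List.map g R′) ≤ 2 ^ suc (e′ ℕ.⊔ e)
length-branches {f = f} {g} R R′ e e′ R≤ R′≤ = begin
  List.length (List.map f R ++ List.map g R′)              ≡⟨ Listₚ.length-++ (List.map f R) ⟩
  List.length (List.map f R) + List.length (List.map g R′) ≡⟨ cong₂ _+_ (Listₚ.length-map f R) (Listₚ.length-map g R′) ⟩
  List.length R + List.length R′                           ≤⟨ ℕₚ.+-mono-≤ (ℕₚ.≤-trans R≤ (ℕₚ.^-monoʳ-≤ 2 (ℕₚ.m≤n⊔m e′ e))) (ℕₚ.≤-trans R′≤ (ℕₚ.^-monoʳ-≤ 2 (ℕₚ.m≤m⊔n e′ e))) ⟩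
  2 ^ (e′ ℕ.⊔ e) + 2 ^ (e′ ℕ.⊔ e)                          ≡⟨ cong (_+_ (2 ^ (e′ ℕ.⊔ e))) (ℕₚ.+-identityʳ _) ⟨
  2 ^ suc (e′ ℕ.⊔ e)                                       ∎
  where open ℕₚ.≤-Reasoning

length-rectangles : ∀ (π : Protocol A B) → List.length (rectangles π) ≤ 2 ^ depth π
length-rectangles (leaf b)      = ℕₚ.≤-refl
length-rectangles (alice a l r) = length-branches (rectangles r) (rectangles l) (depth r) (depth l) (length-rectangles r) (length-rectangles l)
length-rectangles (bob b l r)   = length-branches (rectangles r) (rectangles l) (depth r) (depth l) (length-rectangles r) (length-rectangles l)

combination-lookup : ∀ (R : List ((A → ℤ) × (B → ℤ))) x y →
  combination (λ k x → proj₁ (List.lookup R k) x) (λ k → proj₂ (List.lookup R k) y) x ≡ evaluate R x y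
combination-lookup R x y = trans (sym (∑-tabulate (List.lookup R) (λ αβ → proj₁ αβ x ℤ.* proj₂ αβ y)))
                                 (cong (λ zs → evaluate zs x y) (Listₚ.tabulate-lookup R))

length-concatMap-≤ : ∀ (h : A → List B) k (zs : List A) → (∀ z → List.length (h z) ≤ k) → List.length (concatMap h zs) ≤ List.length zs * k
length-concatMap-≤ h k []       le = z≤n
length-concatMap-≤ h k (z ∷ zs) le = ℕₚ.≤-trans (ℕₚ.≤-reflexive (Listₚ.length-++ (h z))) (ℕₚ.+-mono-≤ (le z) (length-concatMap-≤ h k zs le))

-- The integral total T is replaced by 2 T + 1, whose sign is strict in both cases.
circuit-rank : ∀ {n c s} {C : TwoParty n → Set} → (∀ f → C f → CCatMost c f) → (circ : THRCircuit n C s) →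
  ∀ {F} → Computes circ F →
  Σ ℕ λ d → d ≤ s * 2 ^ c ×
    (Σ (Fin (suc d) → Vec Bool n → ℤ) λ u → Σ (Vec Bool n → Fin (suc d) → ℤ) λ v →
     ∀ x y → 1ℤ ℤ.≤ sgn (F x y) ℤ.* combination u (v y) x)
circuit-rank {n} {c} {s} cc circ {F} computes = List.length gates , length-gates ,
    (λ k x → proj₁ (List.lookup all k) x) , (λ y k → proj₂ (List.lookup all k) y) ,
    λ x y → subst (λ a → 1ℤ ℤ.≤ sgn (F x y) ℤ.* a) (sym (trans (combination-lookup all x y) (evaluate-all x y))) (sign-T x y)
  where
  open THRCircuit circ
  integral : Σ ℤ λ B → Σ (Fin s → ℤ) λ W → (b : Fin s → Bool) →
    let q = bias ℚ.+ sumFin s (λ i → weight' i ℚ.* pm (b i))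
        z = B ℤ.+ ∑ (List.allFin s) (λ i → W i ℤ.* sgn (b i))
    in (q ℚ.< 0ℚ → z ℤ.< 0ℤ) × (0ℚ ℚ.≤ q → 0ℤ ℤ.≤ z)
  integral = integral-weights s bias weight'
  W₀ : ℤ
  W₀ = proj₁ integral
  W : Fin s → ℤ
  W = proj₁ (proj₂ integral)
  π : Fin s → Protocol (Vec Bool n) (Vec Bool n)
  π i = proj₁ (cc (gate i) (gateC i))
  terms : Fin s → List ((Vec Bool n → ℤ) × (Vec Bool n → ℤ))
  terms i = List.map (scaleʳ (λ _ → + 2 ℤ.* W i)) (rectangles (π i))
  gates all : List ((Vec Bool n → ℤ) × (Vec Bool n → ℤ))
  gates = concatMap terms (List.allFin s)
  -- The additional rank-one term carries the bias and the shift by 1.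
  all   = ((λ _ → 1ℤ) , (λ _ → + 2 ℤ.* W₀ ℤ.+ 1ℤ)) ∷ gates
  length-gates : List.length gates ≤ s * 2 ^ c
  length-gates = ℕₚ.≤-trans (length-concatMap-≤ terms (2 ^ c) (List.allFin s) (λ i →
      ℕₚ.≤-trans (ℕₚ.≤-reflexive (Listₚ.length-map _ (rectangles (π i))))
      (ℕₚ.≤-trans (length-rectangles (π i)) (ℕₚ.^-monoʳ-≤ 2 (proj₁ (proj₂ (cc (gate i) (gateC i))))))))
    (ℕₚ.≤-reflexive (cong (_* 2 ^ c) (Listₚ.length-tabulate {n = s} (λ i → i))))
  T : Vec Bool n → Vec Bool n → ℤ
  T x y = W₀ ℤ.+ ∑ (List.allFin s) (λ i → W i ℤ.* sgn (gate i x y))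
  evaluate-all : ∀ x y → evaluate all x y ≡ + 2 ℤ.* T x y ℤ.+ 1ℤ
  evaluate-all x y = begin
    1ℤ ℤ.* (+ 2 ℤ.* W₀ ℤ.+ 1ℤ) ℤ.+ evaluate gates x y
      ≡⟨ cong (ℤ._+_ (1ℤ ℤ.* (+ 2 ℤ.* W₀ ℤ.+ 1ℤ))) (∑-concatMap terms (List.allFin s) _) ⟩
    1ℤ ℤ.* (+ 2 ℤ.* W₀ ℤ.+ 1ℤ) ℤ.+ ∑ (List.allFin s) (λ i → evaluate (terms i) x y)
      ≡⟨ cong (ℤ._+_ (1ℤ ℤ.* (+ 2 ℤ.* W₀ ℤ.+ 1ℤ))) (∑-cong (List.allFin s) term) ⟩
    1ℤ ℤ.* (+ 2 ℤ.* W₀ ℤ.+ 1ℤ) ℤ.+ ∑ (List.allFin s) (λ i → + 2 ℤ.* (W i ℤ.* sgn (gate i x y)))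
      ≡⟨ cong (ℤ._+_ (1ℤ ℤ.* (+ 2 ℤ.* W₀ ℤ.+ 1ℤ))) (∑-*ˡ (List.allFin s) (+ 2) (λ i → W i ℤ.* sgn (gate i x y))) ⟩
    1ℤ ℤ.* (+ 2 ℤ.* W₀ ℤ.+ 1ℤ) ℤ.+ + 2 ℤ.* ∑ (List.allFin s) (λ i → W i ℤ.* sgn (gate i x y))
      ≡⟨ collect W₀ _ ⟩
    + 2 ℤ.* T x y ℤ.+ 1ℤ ∎
    where
    open ≡-Reasoning
    collect : ∀ B S → 1ℤ ℤ.* (+ 2 ℤ.* B ℤ.+ 1ℤ) ℤ.+ + 2 ℤ.* S ≡ + 2 ℤ.* (B ℤ.+ S) ℤ.+ 1ℤ
    collect = ℤ-Solver.solve-∀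
    term : ∀ i → evaluate (terms i) x y ≡ + 2 ℤ.* (W i ℤ.* sgn (gate i x y))
    term i = trans (evaluate-scaleʳ (λ _ → + 2 ℤ.* W i) (rectangles (π i)) x y)
      (trans (cong ((+ 2 ℤ.* W i) ℤ.*_) (trans (evaluate-rectangles (π i) x y) (cong sgn (proj₂ (proj₂ (cc (gate i) (gateC i))) x y))))
             (ℤₚ.*-assoc (+ 2) (W i) (sgn (gate i x y))))
  negative : ∀ z → z ℤ.< 0ℤ → 1ℤ ℤ.≤ ℤ.-1ℤ ℤ.* (+ 2 ℤ.* z ℤ.+ 1ℤ)
  negative (+ n)        (ℤ.+<+ ())
  negative ℤ.-[1+ n ]   _ = subst (1ℤ ℤ.≤_) (sym (identity (+ n))) (ℤ.+≤+ (s≤s z≤n))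
    where
    identity : ∀ a → ℤ.-1ℤ ℤ.* (+ 2 ℤ.* (ℤ.- (1ℤ ℤ.+ a)) ℤ.+ 1ℤ) ≡ 1ℤ ℤ.+ (a ℤ.+ a)
    identity = ℤ-Solver.solve-∀
  nonnegative : ∀ z → 0ℤ ℤ.≤ z → 1ℤ ℤ.≤ 1ℤ ℤ.* (+ 2 ℤ.* z ℤ.+ 1ℤ)
  nonnegative (+ n) _ = subst (1ℤ ℤ.≤_) (sym (identity (+ n))) (ℤ.+≤+ (s≤s z≤n))
    where
    identity : ∀ a → 1ℤ ℤ.* (+ 2 ℤ.* a ℤ.+ 1ℤ) ≡ 1ℤ ℤ.+ (a ℤ.+ a)
    identity = ℤ-Solver.solve-∀
  sign-T : ∀ x y → 1ℤ ℤ.≤ sgn (F x y) ℤ.* (+ 2 ℤ.* T x y ℤ.+ 1ℤ)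
  sign-T x y = signed (F x y) (T x y)
    (λ eq → proj₁ (proj₂ (proj₂ integral) (λ i → gate i x y)) (proj₁ (computes x y) eq))
    (λ eq → proj₂ (proj₂ (proj₂ integral) (λ i → gate i x y)) (proj₂ (computes x y) eq))
    where
    signed : ∀ b z → (b ≡ true → z ℤ.< 0ℤ) → (b ≡ false → 0ℤ ℤ.≤ z) → 1ℤ ℤ.≤ sgn b ℤ.* (+ 2 ℤ.* z ℤ.+ 1ℤ)
    signed true  z below _ = negative z (below refl)
    signed false z _ above = nonnegative z (above refl)

-- Periods of the residue function

residue : (m : ℕ) .{{_ : NonZero m}} → Subset m → ℕ → Bool
residue m A w = Vec.lookup A (Fin.fromℕ< (m%n<n w m))

Periodic : (ℕ → Bool) → ℕ → Set
Periodic F e = ∀ w → F (w + e) ≡ F w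

residue-periodic : ∀ m .{{_ : NonZero m}} (A : Subset m) → Periodic (residue m A) m
residue-periodic m A w = cong (Vec.lookup A) (Finₚ.fromℕ<-cong _ _ ([m+n]%n≡m%n w m) (m%n<n (w + m) m) (m%n<n w m))

periodic-* : ∀ {F m} → Periodic F m → ∀ k → Periodic F (k * m)
periodic-* {F} per zero    w = cong F (ℕₚ.+-identityʳ w)
periodic-* {F} {m} per (suc k) w = trans (cong F (sym (ℕₚ.+-assoc w m (k * m)))) (trans (periodic-* per k (w + m)) (per w))

periodic? : ∀ {F} m .{{_ : NonZero m}} → Periodic F m → ∀ e → Periodic F e ⊎ (∃[ a ] (a < m × F (a + e) ≢ F a))
periodic? {F} m per e with Finₚ.all? (λ (i : Fin m) → F (Fin.toℕ i + e) Boolₚ.≟ F (Fin.toℕ i))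
... | no ¬all = let i , neq = Finₚ.¬∀⟶∃¬ m _ (λ i → F (Fin.toℕ i + e) Boolₚ.≟ F (Fin.toℕ i)) ¬all
                in inj₂ (Fin.toℕ i , Finₚ.toℕ<n i , neq)
... | yes all = inj₁ λ w → begin
  F (w + e)                          ≡⟨ cong (λ v → F (v + e)) (m≡m%n+[m/n]*n w m) ⟩
  F (w % m + (w / m) * m + e)        ≡⟨ cong F (exchange (w % m) ((w / m) * m) e) ⟩
  F (w % m + e + (w / m) * m)        ≡⟨ periodic-* per (w / m) (w % m + e) ⟩
  F (w % m + e)                      ≡⟨ small (w % m) (m%n<n w m) ⟩
  F (w % m)                          ≡⟨ periodic-* per (w / m) (w % m) ⟨
  F (w % m + (w / m) * m)            ≡⟨ cong F (m≡m%n+[m/n]*n w m) ⟨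
  F w                                ∎
  where
  open ≡-Reasoning
  exchange : ∀ a b c → a + b + c ≡ a + c + b
  exchange = ℕ-Solver.solve-∀
  small : ∀ w → w < m → F (w + e) ≡ F w
  small w w<m = subst (λ v → F (v + e) ≡ F v) (Finₚ.toℕ-fromℕ< w<m) (all (Fin.fromℕ< w<m))

periodic-2⇒simple : ∀ n (F : ℕ → Bool) → Periodic F 2 → Simple n (λ x → F (weight x))
periodic-2⇒simple n F per = classify (F 0) (F 1) refl refl
  where
  by-parity : ∀ {n} k (x : Vec Bool n) → F (k + weight x) ≡ (if parity x then F (k + 1) else F k)
  by-parity k []          = cong F (ℕₚ.+-identityʳ k)
  by-parity k (false ∷ x) = by-parity k x
  by-parity k (true  ∷ x) = trans (cong F (ℕₚ.+-suc k (weight x))) (trans (by-parity (suc k) x) (flip (parity x)))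
    where
    flip : ∀ b → (if b then F (suc k + 1) else F (suc k)) ≡ (if not b then F (k + 1) else F k)
    flip true  = trans (cong F (sym (ℕₚ.+-suc k 1))) (per k)
    flip false = cong F (ℕₚ.+-comm 1 k)
  classify : ∀ b₀ b₁ → F 0 ≡ b₀ → F 1 ≡ b₁ → Simple n (λ x → F (weight x))
  classify b₀ b₁ eq₀ eq₁ = cases b₀ b₁ (λ x → trans (by-parity 0 x) (cong₂ (if parity x then_else_) eq₁ eq₀))
    where
    if-not : ∀ b → (if b then false else true) ≡ not b
    if-not true  = refl
    if-not false = refl
    if-id : ∀ b → (if b then true else false) ≡ b
    if-id true  = refl
    if-id false = refl
    cases : ∀ b₀ b₁ → (∀ x → F (weight x) ≡ (if parity {n} x then b₁ else b₀)) → Simple n (λ x → F (weight x))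
    cases true  true  e = inj₁ (true  , λ x → trans (e x) (Boolₚ.if-eta (parity x)))
    cases false false e = inj₁ (false , λ x → trans (e x) (Boolₚ.if-eta (parity x)))
    cases false true  e = inj₂ (inj₁ λ x → trans (e x) (if-id (parity x)))
    cases true  false e = inj₂ (inj₂ λ x → trans (e x) (if-not (parity x)))

-- Then z ↦ F (a + 2 u z) has period p and differs at 0 and 1. `p≤j` controls the norm of the rows,
-- `up≤m` the length of a block.
record Progression (F : ℕ → Bool) (m j : ℕ) : Set where
  field
    u p a    : ℕ
    p≥2      : 2 ≤ p
    p≤j      : p ≤ j
    up≤m     : u * p ≤ m
    a<m      : a < m
    varies   : F (a + (u + u)) ≢ F a
    periodic : Periodic F ((u + u) * p)

2^-suc : ∀ i → 2 ^ i + 2 ^ i ≡ 2 ^ suc i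
2^-suc i = cong (_+_ (2 ^ i)) (sym (ℕₚ.+-identityʳ (2 ^ i)))

-- Halve the period 2^(i+1) as long as the result is a period. This must stop before 2, and where it
-- stops F alternates along some progression, whence p = 2.
dyadic-progression : ∀ {F} m j .{{_ : NonZero m}} → 2 ≤ j → Periodic F m → ¬ Periodic F 2 →
  ∀ i → 2 ^ i ≤ m → Periodic F (2 ^ suc i) → Progression F m j
dyadic-progression m j 2≤j per ¬per2 zero    le per2 = contradiction per2 ¬per2
dyadic-progression {F} m j 2≤j per ¬per2 (suc i) le per′ with periodic? m per (2 ^ suc i)
... | inj₁ smaller = dyadic-progression m j 2≤j per ¬per2 i (ℕₚ.≤-trans (ℕₚ.m≤m+n (2 ^ i) _) le) smaller
... | inj₂ (a , a<m , neq) = record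
  { u = 2 ^ i ; p = 2 ; a = a ; p≥2 = ℕₚ.≤-refl ; p≤j = 2≤j
  ; up≤m = ℕₚ.≤-trans (ℕₚ.≤-reflexive (ℕₚ.*-comm (2 ^ i) 2)) le ; a<m = a<m
  ; varies = λ eq → neq (trans (cong (λ e → F (a + e)) (sym (2^-suc i))) eq)
  ; periodic = subst (Periodic F) (trans (ℕₚ.*-comm 2 (2 ^ suc i)) (cong (_* 2) (sym (2^-suc i)))) per′ }

-- For k ≥ 1, test whether 2^k is a period. If not, steps of 2^k from some a see a change and close
-- up after j steps at m. If so, the period is a power of two and the dyadic descent applies. For k
-- = 0 the step is 2 and the period used is 2 m.
progression : ∀ {F} m j k .{{_ : NonZero m}} → 2 ≤ j → m ≡ j * 2 ^ k → Periodic F m → ¬ Periodic F 2 → Progression F m j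
progression {F} m j zero 2≤j eq per ¬per2 with periodic? m per 2
... | inj₁ per2 = contradiction per2 ¬per2
... | inj₂ (a , a<m , neq) = record
  { u = 1 ; p = j ; a = a ; p≥2 = 2≤j ; p≤j = ℕₚ.≤-refl
  ; up≤m = ℕₚ.≤-reflexive (trans (ℕₚ.*-comm 1 j) (sym eq)) ; a<m = a<m ; varies = neq
  ; periodic = subst (λ e → Periodic F (2 * e)) (trans eq (ℕₚ.*-identityʳ j)) (periodic-* per 2) }
progression {F} m j (suc k) 2≤j eq per ¬per2 with periodic? m per (2 ^ suc k)
... | inj₁ per2k = dyadic-progression m j 2≤j per ¬per2 k 2^k≤m per2k
  where
  2^k≤m : 2 ^ k ≤ m
  2^k≤m = begin
    2 ^ k           ≤⟨ ℕₚ.m≤m+n (2 ^ k) _ ⟩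
    2 * 2 ^ k       ≡⟨ ℕₚ.*-identityˡ (2 ^ suc k) ⟨
    1 * 2 ^ suc k   ≤⟨ ℕₚ.*-monoˡ-≤ (2 ^ suc k) (ℕₚ.≤-trans (s≤s z≤n) 2≤j) ⟩
    j * 2 ^ suc k   ≡⟨ eq ⟨
    m               ∎
    where open ℕₚ.≤-Reasoning
... | inj₂ (a , a<m , neq) = record
  { u = 2 ^ k ; p = j ; a = a ; p≥2 = 2≤j ; p≤j = ℕₚ.≤-refl
  ; up≤m = ℕₚ.≤-trans (ℕₚ.*-monoˡ-≤ j (ℕₚ.m≤m+n (2 ^ k) _)) (ℕₚ.≤-reflexive (trans (ℕₚ.*-comm (2 ^ suc k) j) (sym eq)))
  ; a<m = a<m
  ; varies = λ e → neq (trans (cong (λ z → F (a + z)) (sym (2^-suc k))) e)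
  ; periodic = subst (Periodic F) (trans eq (trans (ℕₚ.*-comm j (2 ^ suc k)) (cong (_* j) (sym (2^-suc k))))) per }

-- Embedding an inner product into the weight of x ⊕ y

weight-xor-++ : ∀ {a b} (x x′ : Vec Bool a) (y y′ : Vec Bool b) →
  weight (Vec.zipWith _xor_ (x Vec.++ y) (x′ Vec.++ y′)) ≡ weight (Vec.zipWith _xor_ x x′) + weight (Vec.zipWith _xor_ y y′)
weight-xor-++ []      []        y y′ = refl
weight-xor-++ (b ∷ x) (b′ ∷ x′) y y′ with b xor b′
... | true  = cong suc (weight-xor-++ x x′ y y′)
... | false = weight-xor-++ x x′ y y′

zipWith-xor-replicate : ∀ {n} b (x : Vec Bool n) → Vec.zipWith _xor_ (Vec.replicate n b) x ≡ (if b then Vec.map not x else x)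
zipWith-xor-replicate true  []      = refl
zipWith-xor-replicate true  (c ∷ x) = cong (not c ∷_) (zipWith-xor-replicate true x)
zipWith-xor-replicate false []      = refl
zipWith-xor-replicate false (c ∷ x) = cong (c ∷_) (zipWith-xor-replicate false x)

weight-not : ∀ {n} (x : Vec Bool n) → weight x + weight (Vec.map not x) ≡ n
weight-not []          = refl
weight-not (true  ∷ x) = cong suc (weight-not x)
weight-not (false ∷ x) = trans (ℕₚ.+-suc (weight x) _) (cong suc (weight-not x))

weight-replicate-false : ∀ n → weight (Vec.replicate n false) ≡ 0
weight-replicate-false zero    = refl
weight-replicate-false (suc n) = weight-replicate-false n

weight-replicate-true : ∀ n → weight (Vec.replicate n true) ≡ n
weight-replicate-true zero    = refl
weight-replicate-true (suc n) = cong suc (weight-replicate-true n)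

coThreshold : ∀ L → ℕ → Vec Bool L
coThreshold zero    k       = []
coThreshold (suc L) zero    = true  ∷ coThreshold L zero
coThreshold (suc L) (suc k) = false ∷ coThreshold L k

weight-threshold : ∀ L k → k ≤ L → weight (Vec.map not (coThreshold L k)) ≡ k
weight-threshold zero    zero    le       = refl
weight-threshold (suc L) zero    le       = weight-threshold L zero z≤n
weight-threshold (suc L) (suc k) (s≤s le) = cong suc (weight-threshold L k le)

aliceBlock : ∀ L → Bool → Vec Bool (L + L)
aliceBlock L b = Vec.replicate L b Vec.++ Vec.replicate L false

-- Against a zero of Alice the string and its complement weigh L together, whatever k is; against a
-- one the first half is complemented and both halves weigh k.
bobBlock : ∀ L → ℕ → Vec Bool (L + L)
bobBlock L k = coThreshold L k Vec.++ Vec.map not (coThreshold L k)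

-- With k = u y and L a period of F, the block contributes 2 u x y to the weight modulo L.
weight-block : ∀ L b k → k ≤ L → weight (Vec.zipWith _xor_ (aliceBlock L b) (bobBlock L k)) ≡ (if b then k + k else L)
weight-block L b k k≤L = trans
  (weight-xor-++ (Vec.replicate L b) (coThreshold L k) (Vec.replicate L false) (Vec.map not (coThreshold L k)))
  (trans (cong₂ (λ x y → weight x + weight y) (zipWith-xor-replicate b (coThreshold L k)) (zipWith-xor-replicate false (Vec.map not (coThreshold L k)))) (cases b))
  where
  cases : ∀ b → weight (if b then Vec.map not (coThreshold L k) else coThreshold L k) + weight (Vec.map not (coThreshold L k)) ≡ (if b then k + k else L)
  cases true  = cong₂ _+_ (weight-threshold L k k≤L) (weight-threshold L k k≤L)
  cases false = weight-not (coThreshold L k)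

aliceBlocks : ∀ L {t} → Vec Bool t → Vec Bool (t * (L + L))
aliceBlocks L []      = []
aliceBlocks L (b ∷ x) = aliceBlock L b Vec.++ aliceBlocks L x

bobBlocks : ∀ L u {p t} → Vec (Fin p) t → Vec Bool (t * (L + L))
bobBlocks L u []      = []
bobBlocks L u (i ∷ y) = bobBlock L (u * Fin.toℕ i) Vec.++ bobBlocks L u y

-- The general offset b collects the contributions 2 u y_i of the blocks already read; blocks for
-- zeros of Alice add a full period L and disappear.
blocks-dot : ∀ {F} L u p → u * p ≤ L → Periodic F L → ∀ b {t} (x : Vec Bool t) (y : Vec (Fin p) t) →
  F (b + weight (Vec.zipWith _xor_ (aliceBlocks L x) (bobBlocks L u y))) ≡ F (b + (u + u) * dot x y)
blocks-dot {F} L u p up≤L per b []      []      = cong (λ e → F (b + e)) (sym (ℕₚ.*-zeroʳ (u + u)))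
blocks-dot {F} L u p up≤L per b (c ∷ x) (i ∷ y) =
  trans (cong (λ e → F (b + e)) (trans
      (weight-xor-++ (aliceBlock L c) (bobBlock L (u * Fin.toℕ i)) (aliceBlocks L x) (bobBlocks L u y))
      (cong (_+ W) (weight-block L c (u * Fin.toℕ i) (ℕₚ.≤-trans (ℕₚ.*-monoʳ-≤ u (ℕₚ.<⇒≤ (Finₚ.toℕ<n i))) up≤L)))))
    (cases c)
  where
  W : ℕ
  W = weight (Vec.zipWith _xor_ (aliceBlocks L x) (bobBlocks L u y))
  rotate : ∀ b L W → b + (L + W) ≡ b + W + L
  rotate = ℕ-Solver.solve-∀
  collect : ∀ b u i e → b + (u * i + u * i) + (u + u) * e ≡ b + (u + u) * (i + e)
  collect = ℕ-Solver.solve-∀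
  cases : ∀ c → F (b + ((if c then u * Fin.toℕ i + u * Fin.toℕ i else L) + W)) ≡ F (b + (u + u) * dot (c ∷ x) (i ∷ y))
  cases false = trans (cong F (rotate b L W)) (trans (per (b + W)) (blocks-dot {F} L u p up≤L per b x y))
  cases true  = trans (cong F (sym (ℕₚ.+-assoc b (u * Fin.toℕ i + u * Fin.toℕ i) W)))
    (trans (blocks-dot {F} L u p up≤L per (b + (u * Fin.toℕ i + u * Fin.toℕ i)) x y) (cong F (collect b u (Fin.toℕ i) (dot x y))))

-- The leading ones shift the weight to the start a of the progression; the last r zeros are padding
-- up to length n.
aliceInput : ∀ a L r {t} → Vec Bool t → Vec Bool (a + (t * (L + L) + r))
aliceInput a L r x = Vec.replicate a true Vec.++ (aliceBlocks L x Vec.++ Vec.replicate r false)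

bobInput : ∀ a L r u {p t} → Vec (Fin p) t → Vec Bool (a + (t * (L + L) + r))
bobInput a L r u y = Vec.replicate a false Vec.++ (bobBlocks L u y Vec.++ Vec.replicate r false)

inputs-dot : ∀ {F} a L r u p → u * p ≤ L → Periodic F L → ∀ {t} (x : Vec Bool t) (y : Vec (Fin p) t) →
  F (weight (Vec.zipWith _xor_ (aliceInput a L r x) (bobInput a L r u y))) ≡ F (a + (u + u) * dot x y)
inputs-dot {F} a L r u p up≤L per x y = trans (cong F total) (blocks-dot {F} L u p up≤L per a x y)
  where
  W : ℕ
  W = weight (Vec.zipWith _xor_ (aliceBlocks L x) (bobBlocks L u y))
  prefix : weight (Vec.zipWith _xor_ (Vec.replicate a true) (Vec.replicate a false)) ≡ a
  prefix = trans (cong weight (trans (zipWith-xor-replicate true (Vec.replicate a false)) (negate a))) (weight-replicate-true a)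
    where
    negate : ∀ a → Vec.map not (Vec.replicate a false) ≡ Vec.replicate a true
    negate zero    = refl
    negate (suc a) = cong (true ∷_) (negate a)
  suffix : weight (Vec.zipWith _xor_ (Vec.replicate r false) (Vec.replicate r false)) ≡ 0
  suffix = trans (cong weight (zipWith-xor-replicate false (Vec.replicate r false))) (weight-replicate-false r)
  total : weight (Vec.zipWith _xor_ (aliceInput a L r x) (bobInput a L r u y)) ≡ a + W
  total = trans (weight-xor-++ (Vec.replicate a true) (Vec.replicate a false) _ _)
    (cong₂ _+_ prefix (trans (weight-xor-++ (aliceBlocks L x) (bobBlocks L u y) (Vec.replicate r false) (Vec.replicate r false))
      (trans (cong (_+_ W) suffix) (ℕₚ.+-identityʳ W))))

-- Circuits with constant gates

sumFin-cong : ∀ s {f g : Fin s → ℚ} → (∀ i → f i ≡ g i) → sumFin s f ≡ sumFin s g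
sumFin-cong zero    e = refl
sumFin-cong (suc s) e = cong₂ ℚ._+_ (e zero) (sumFin-cong s (λ i → e (suc i)))

constant-gates⇒constant : ∀ {n s} {C : TwoParty n → Set} (circ : THRCircuit n C s) {F} → Computes circ F →
  (∀ i x y x′ y′ → THRCircuit.gate circ i x y ≡ THRCircuit.gate circ i x′ y′) → ∀ x y x′ y′ → F x y ≡ F x′ y′
constant-gates⇒constant {s = s} circ {F} computes const x y x′ y′ = cases (F x y) (F x′ y′) refl refl
  where
  open THRCircuit circ
  total-const : total x y ≡ total x′ y′
  total-const = cong (bias ℚ.+_) (sumFin-cong s (λ i → cong (λ b → weight' i ℚ.* pm b) (const i x y x′ y′)))
  cases : ∀ b b′ → F x y ≡ b → F x′ y′ ≡ b′ → b ≡ b′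
  cases true  true  _ _    = refl
  cases false false _ _    = refl
  cases true  false e e′   = contradiction (ℚₚ.<-≤-trans (subst (ℚ._< ℚ.0ℚ) total-const (proj₁ (computes x y) e)) (proj₂ (computes x′ y′) e′)) (ℚₚ.<-irrefl refl)
  cases false true  e e′   = contradiction (ℚₚ.<-≤-trans (proj₁ (computes x′ y′) e′) (subst (ℚ.0ℚ ℚ.≤_) total-const (proj₂ (computes x y) e))) (ℚₚ.<-irrefl refl)

-- Supplies the base s 2^c ≥ 2 whose powers absorb all constants later. With no gates, or with gates
-- of cost 0, the circuit is constant; fixing Alice's input to zero then makes mod_m^A constant.
nontrivial-size : ∀ m .{{_ : NonZero m}} {n} (A : Subset m) → ¬ Simple n (modA m A {n}) →
  ∀ c (C : TwoParty n → Set) → (∀ f → C f → CCatMost c f) →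
  ∀ s (circ : THRCircuit n C s) → Computes circ (modXOR m A {n}) → 2 ≤ s * 2 ^ c
nontrivial-size m {n} A nonsimple c C cc s circ computes = split s c refl refl
  where
  open THRCircuit circ
  absurd : (∀ i x y x′ y′ → gate i x y ≡ gate i x′ y′) → 2 ≤ s * 2 ^ c
  absurd const = contradiction (inj₁ (modXOR m A zeros zeros , λ x →
      trans (cong (modA m A) (sym (zipWith-xor-replicate false x)))
            (constant-gates⇒constant circ {modXOR m A} computes const zeros x zeros zeros))) nonsimple
    where
    zeros : Vec Bool n
    zeros = Vec.replicate n false
  leaf-constant : ∀ {f : TwoParty n} → CCatMost 0 f → ∀ x y x′ y′ → f x y ≡ f x′ y′
  leaf-constant (leaf b , _ , e) x y x′ y′ = trans (sym (e x y)) (e x′ y′)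
  split : ∀ s′ c′ → s ≡ s′ → c ≡ c′ → 2 ≤ s * 2 ^ c
  split zero    _       refl refl = absurd λ ()
  split (suc _) zero    refl refl = absurd λ i → leaf-constant (cc (gate i) (gateC i))
  split (suc s) (suc c) refl refl = ℕₚ.≤-trans (ℕₚ.*-monoʳ-≤ 2 (ℕₚ.m^n>0 2 c)) (ℕₚ.m≤m+n (2 ^ suc c) _)

-- The numerical bound

rank-bound : ∀ {F : ℕ → Bool} {m j n} (P : Progression F m j) → let open Progression P in
  ∀ t r → n ≡ a + (t * ((u + u) * p + (u + u) * p) + r) → ∀ d →
  (α : Fin (suc d) → Vec Bool n → ℤ) (β : Vec Bool n → Fin (suc d) → ℤ) →
  (∀ x y → 1ℤ ℤ.≤ sgn (F (weight (Vec.zipWith _xor_ x y))) ℤ.* combination α (β y) x) →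
  2 ^ t < suc (12 * suc d ^ 4 * (p * p)) * suc d
rank-bound {F} P t r refl d α β sign =
  inner-product-bound p t d H p≥2 H-periodic H-varies
    (λ k x → α k (aliceInput a L r x)) (λ y → β (bobInput a L r u y))
    (λ x y → subst (λ b → 1ℤ ℤ.≤ sgn b ℤ.* combination α (β (bobInput a L r u y)) (aliceInput a L r x))
                   (inputs-dot {F} a L r u p up≤L periodic x y) (sign (aliceInput a L r x) (bobInput a L r u y)))
  where
  open Progression P
  L : ℕ
  L = (u + u) * p
  H : ℕ → Bool
  H z = F (a + (u + u) * z)
  up≤L : u * p ≤ L
  up≤L = ℕₚ.*-monoˡ-≤ p (ℕₚ.m≤m+n u u)
  H-periodic : ∀ z → H (z + p) ≡ H z
  H-periodic z = trans (cong F (distribute a (u + u) z p)) (periodic (a + (u + u) * z))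
    where
    distribute : ∀ a v z p → a + v * (z + p) ≡ a + v * z + v * p
    distribute = ℕ-Solver.solve-∀
  H-varies : H 0 ≢ H 1
  H-varies eq = varies (trans (cong (λ e → F (a + e)) (sym (ℕₚ.*-identityʳ (u + u))))
    (trans (sym eq) (cong F (trans (cong (_+_ a) (ℕₚ.*-zeroʳ (u + u))) (ℕₚ.+-identityʳ a)))))

-- A block has 2 L = 4 u p ≤ 4 m bits and the shift uses a < m, so ⌊(n - m)/(4 m)⌋ blocks fit. The
-- shift allowance m and a remainder below 4 m make up the 5 m.
blocks-fit : ∀ {F : ℕ → Bool} {m j n} .{{_ : NonZero m}} → m < n → (P : Progression F m j) → let open Progression P in
  ∃[ t ] ∃[ r ] (n ≡ a + (t * ((u + u) * p + (u + u) * p) + r) × n ≤ 5 * m + 4 * m * t)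
blocks-fit {m = m} {n = n} m<n P = t , r , sym (trans (sym (ℕₚ.+-assoc a (t * (L + L)) r)) (ℕₚ.m+[n∸m]≡n fits)) , large
  where
  open Progression P
  instance
    4m-nonZero : NonZero (4 * m)
    4m-nonZero = ℕₚ.m*n≢0 4 m
  L t r : ℕ
  L = (u + u) * p
  t = (n ∸ m) / (4 * m)
  r = n ∸ (a + t * (L + L))
  2L≤4m : L + L ≤ 4 * m
  2L≤4m = ℕₚ.≤-trans (ℕₚ.≤-reflexive (quadruple u p)) (ℕₚ.*-monoʳ-≤ 4 up≤m)
    where
    quadruple : ∀ u p → (u + u) * p + (u + u) * p ≡ 4 * (u * p)
    quadruple = ℕ-Solver.solve-∀
  fits : a + t * (L + L) ≤ n
  fits = begin
    a + t * (L + L)   ≤⟨ ℕₚ.+-mono-≤ (ℕₚ.<⇒≤ a<m) (ℕₚ.*-monoʳ-≤ t 2L≤4m) ⟩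
    m + t * (4 * m)   ≤⟨ ℕₚ.+-monoʳ-≤ m (m/n*n≤m (n ∸ m) (4 * m)) ⟩
    m + (n ∸ m)       ≡⟨ ℕₚ.m+[n∸m]≡n (ℕₚ.<⇒≤ m<n) ⟩
    n                 ∎
    where open ℕₚ.≤-Reasoning
  large : n ≤ 5 * m + 4 * m * t
  large = begin
    n                                            ≡⟨ ℕₚ.m+[n∸m]≡n (ℕₚ.<⇒≤ m<n) ⟨
    m + (n ∸ m)                                  ≡⟨ cong (_+_ m) (m≡m%n+[m/n]*n (n ∸ m) (4 * m)) ⟩
    m + ((n ∸ m) % (4 * m) + t * (4 * m))        ≤⟨ ℕₚ.+-monoʳ-≤ m (ℕₚ.+-monoˡ-≤ (t * (4 * m)) (ℕₚ.<⇒≤ (m%n<n (n ∸ m) (4 * m)))) ⟩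
    m + (4 * m + t * (4 * m))                    ≡⟨ collect m t ⟩
    5 * m + 4 * m * t                            ∎
    where
    open ℕₚ.≤-Reasoning
    collect : ∀ m t → m + (4 * m + t * (4 * m)) ≡ 5 * m + 4 * m * t
    collect = ℕ-Solver.solve-∀

-- 13 ≤ 2^4 ≤ ρ^4, d + 1 ≤ 2 ρ ≤ ρ² and p ≤ j < 2^j ≤ ρ^j; the exponents add up to 4 + 5 · 2 + 2 j.
rank-arithmetic : ∀ ρ d p j → 2 ≤ ρ → d ≤ ρ → 2 ≤ p → p ≤ j → suc (12 * suc d ^ 4 * (p * p)) * suc d ≤ ρ ^ (14 + 2 * j)
rank-arithmetic ρ d p j ρ≥2 d≤ρ p≥2 p≤j = begin
  suc (12 * e ^ 4 * (p * p)) * e          ≤⟨ ℕₚ.*-monoˡ-≤ e (ℕₚ.+-monoˡ-≤ (12 * e ^ 4 * (p * p)) one≤) ⟩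
  (e ^ 4 * (p * p) + 12 * e ^ 4 * (p * p)) * e ≡⟨ collect e p ⟩
  13 * (e ^ 5 * (p * p))                  ≤⟨ ℕₚ.*-mono-≤ 13≤ρ⁴ (ℕₚ.*-mono-≤ (ℕₚ.^-monoˡ-≤ 5 e≤ρ²) (ℕₚ.*-mono-≤ p≤ρ^j p≤ρ^j)) ⟩
  ρ ^ 4 * ((ρ ^ 2) ^ 5 * (ρ ^ j * ρ ^ j)) ≡⟨ cong (λ a → ρ ^ 4 * (a * (ρ ^ j * ρ ^ j))) (ℕₚ.^-*-assoc ρ 2 5) ⟩
  ρ ^ 4 * (ρ ^ 10 * (ρ ^ j * ρ ^ j))      ≡⟨ cong (λ a → ρ ^ 4 * (ρ ^ 10 * a)) (ℕₚ.^-distribˡ-+-* ρ j j) ⟨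
  ρ ^ 4 * (ρ ^ 10 * ρ ^ (j + j))          ≡⟨ cong (ρ ^ 4 *_) (ℕₚ.^-distribˡ-+-* ρ 10 (j + j)) ⟨
  ρ ^ 4 * ρ ^ (10 + (j + j))              ≡⟨ ℕₚ.^-distribˡ-+-* ρ 4 (10 + (j + j)) ⟨
  ρ ^ (14 + (j + j))                      ≡⟨ cong (λ z → ρ ^ (14 + (j + z))) (ℕₚ.+-identityʳ j) ⟨
  ρ ^ (14 + 2 * j)                        ∎
  where
  open ℕₚ.≤-Reasoning
  e : ℕ
  e = suc d
  1≤p : 1 ≤ p
  1≤p = ℕₚ.<⇒≤ p≥2
  one≤ : 1 ≤ e ^ 4 * (p * p)
  one≤ = ℕₚ.*-mono-≤ (ℕₚ.m^n>0 e 4) (ℕₚ.*-mono-≤ 1≤p 1≤p)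
  collect : ∀ e p → (e * (e * (e * (e * 1))) * (p * p) + 12 * (e * (e * (e * (e * 1)))) * (p * p)) * e
          ≡ 13 * (e * (e * (e * (e * (e * 1)))) * (p * p))
  collect = ℕ-Solver.solve-∀
  13≤ρ⁴ : 13 ≤ ρ ^ 4
  13≤ρ⁴ = ℕₚ.≤-trans (ℕₚ.m≤m+n 13 3) (ℕₚ.^-monoˡ-≤ 4 ρ≥2)
  e≤ρ² : e ≤ ρ ^ 2
  e≤ρ² = begin
    suc d       ≤⟨ ℕₚ.+-mono-≤ (ℕₚ.<⇒≤ ρ≥2) d≤ρ ⟩
    ρ + ρ       ≡⟨ cong (_+_ ρ) (ℕₚ.+-identityʳ ρ) ⟨
    2 * ρ       ≤⟨ ℕₚ.*-monoˡ-≤ ρ ρ≥2 ⟩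
    ρ * ρ       ≡⟨ cong (ρ *_) (ℕₚ.*-identityʳ ρ) ⟨
    ρ ^ 2       ∎
  p≤ρ^j : p ≤ ρ ^ j
  p≤ρ^j = ℕₚ.≤-trans p≤j (ℕₚ.≤-trans (ℕₚ.<⇒≤ (n<2^n j)) (ℕₚ.^-monoˡ-≤ j ρ≥2))

-- The bound on 2^t is raised to the power 4 m. The exponent becomes 5 m + 4 m (14 + 2 j) = 61 m + 8
-- j m, and m ≤ j m yields the constant 69.
size-arithmetic : ∀ ρ m j n t → 2 ≤ ρ → 1 ≤ j → n ≤ 5 * m + 4 * m * t → 2 ^ t ≤ ρ ^ (14 + 2 * j) → 2 ^ n ≤ ρ ^ (69 * j * m)
size-arithmetic ρ@(suc _) m j n t ρ≥2 j≥1 n≤ 2^t≤ = begin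
  2 ^ n                                          ≤⟨ ℕₚ.^-monoʳ-≤ 2 n≤ ⟩
  2 ^ (5 * m + 4 * m * t)                        ≡⟨ ℕₚ.^-distribˡ-+-* 2 (5 * m) (4 * m * t) ⟩
  2 ^ (5 * m) * 2 ^ (4 * m * t)                  ≡⟨ cong (2 ^ (5 * m) *_) (trans (cong (2 ^_) (ℕₚ.*-comm (4 * m) t)) (sym (ℕₚ.^-*-assoc 2 t (4 * m)))) ⟩
  2 ^ (5 * m) * (2 ^ t) ^ (4 * m)                ≤⟨ ℕₚ.*-mono-≤ (ℕₚ.^-monoˡ-≤ (5 * m) ρ≥2) (ℕₚ.^-monoˡ-≤ (4 * m) 2^t≤) ⟩
  ρ ^ (5 * m) * (ρ ^ (14 + 2 * j)) ^ (4 * m)     ≡⟨ cong (ρ ^ (5 * m) *_) (ℕₚ.^-*-assoc ρ (14 + 2 * j) (4 * m)) ⟩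
  ρ ^ (5 * m) * ρ ^ ((14 + 2 * j) * (4 * m))     ≡⟨ ℕₚ.^-distribˡ-+-* ρ (5 * m) ((14 + 2 * j) * (4 * m)) ⟨
  ρ ^ (5 * m + (14 + 2 * j) * (4 * m))           ≤⟨ ℕₚ.^-monoʳ-≤ ρ exponent ⟩
  ρ ^ (69 * j * m)                               ∎
  where
  open ℕₚ.≤-Reasoning
  expand : ∀ m j → 5 * m + (14 + 2 * j) * (4 * m) ≡ 61 * (1 * m) + 8 * (j * m)
  expand = ℕ-Solver.solve-∀
  collect : ∀ m j → 61 * (j * m) + 8 * (j * m) ≡ 69 * j * m
  collect = ℕ-Solver.solve-∀
  exponent : 5 * m + (14 + 2 * j) * (4 * m) ≤ 69 * j * m
  exponent = begin
    5 * m + (14 + 2 * j) * (4 * m)   ≡⟨ expand m j ⟩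
    61 * (1 * m) + 8 * (j * m)       ≤⟨ ℕₚ.+-monoˡ-≤ (8 * (j * m)) (ℕₚ.*-monoʳ-≤ 61 (ℕₚ.*-monoˡ-≤ m j≥1)) ⟩
    61 * (j * m) + 8 * (j * m)       ≡⟨ collect m j ⟩
    69 * j * m                       ∎

-- This is s ≥ 2^(n/(69 j m) - c) with roots and quotients cleared.
threshold-size : ∀ (m j k n : ℕ) .{{_ : NonZero m}} → m < n → m ≡ j * 2 ^ k → 2 ≤ j →
  (A : Subset m) → ¬ Simple n (modA m A {n}) →
  (c : ℕ) (C : TwoParty n → Set) → (∀ f → C f → CCatMost c f) →
  (s : ℕ) (circ : THRCircuit n C s) → Computes circ (modXOR m A {n}) → 2 ^ n ≤ (s * 2 ^ c) ^ (69 * j * m)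
threshold-size m j k n m<n m≡ 2≤j A nonsimple c C cc s circ computes =
  size-arithmetic (s * 2 ^ c) m j n t ρ≥2 (ℕₚ.<⇒≤ 2≤j) (proj₂ (proj₂ (proj₂ fit)))
    (ℕₚ.≤-trans (ℕₚ.<⇒≤ (rank-bound P t (proj₁ (proj₂ fit)) (proj₁ (proj₂ (proj₂ fit))) (proj₁ rank) (proj₁ (proj₂ (proj₂ rank))) (proj₁ (proj₂ (proj₂ (proj₂ rank)))) (proj₂ (proj₂ (proj₂ (proj₂ rank))))))
      (rank-arithmetic (s * 2 ^ c) (proj₁ rank) p j ρ≥2 (proj₁ (proj₂ rank)) p≥2 p≤j))
  where
  P : Progression (residue m A) m j
  P = progression m j k 2≤j m≡ (residue-periodic m A) (λ per2 → nonsimple (periodic-2⇒simple n (residue m A) per2))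
  open Progression P using (u; p; a; p≥2; p≤j)
  fit : ∃[ t ] ∃[ r ] (n ≡ a + (t * ((u + u) * p + (u + u) * p) + r) × n ≤ 5 * m + 4 * m * t)
  fit = blocks-fit m<n P
  t : ℕ
  t = proj₁ fit
  rank : Σ ℕ λ d → d ≤ s * 2 ^ c ×
    (Σ (Fin (suc d) → Vec Bool n → ℤ) λ u → Σ (Vec Bool n → Fin (suc d) → ℤ) λ v →
     ∀ x y → 1ℤ ℤ.≤ sgn (modXOR m A x y) ℤ.* combination u (v y) x)
  rank = circuit-rank cc circ computes
  ρ≥2 : 2 ≤ s * 2 ^ c
  ρ≥2 = nontrivial-size m A nonsimple c C cc s circ computes

-- The bound on s raised to the power q j m, where 1/q is the constant hidden in Ω: then 2 j log j /
-- m turns into j^(2 j² q), the term c into 2^(c q j m), and k m moves to the right as 2^(k m).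
mainTheorem11 : ∃[ q ] (1 ≤ q ×
    (∀ (m j k n : ℕ) .{{_ : NonZero m}} → 3 ≤ m → m < n → m ≡ j * 2 ^ k →
    ((j % 2 ≡ 1 × 3 ≤ j) ⊎ j ≡ 4) →
    (A : Subset m) → ¬ Simple n (modA m A {n}) →
    (c : ℕ) (C : TwoParty n → Set) → (∀ f → C f → CCatMost c f) →
    (s : ℕ) (circ : THRCircuit n C s) → Computes circ (modXOR m A {n}) →
    2 ^ n ≤ s ^ (q * j * m) * j ^ (2 * j * j * q) * 2 ^ (c * q * j * m) * 2 ^ (k * m)))
mainTheorem11 = 69 , s≤s z≤n , λ m j k n _ m<n m≡ shape A nonsimple c C cc s circ computes →
  let E   = 69 * j * m
      2≤j = at-least-2 j shape
      open ℕₚ.≤-Reasoning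
  in begin
    2 ^ n                                        ≤⟨ threshold-size m j k n m<n m≡ 2≤j A nonsimple c C cc s circ computes ⟩
    (s * 2 ^ c) ^ E                              ≡⟨ trans (^-distrib-* s (2 ^ c) E) (cong (s ^ E *_) (trans (ℕₚ.^-*-assoc 2 c E) (cong (2 ^_) (regroup c j m)))) ⟩
    s ^ E * 2 ^ (c * 69 * j * m)                 ≡⟨ cong (_* 2 ^ (c * 69 * j * m)) (ℕₚ.*-identityʳ (s ^ E)) ⟨
    -- The factors j^(2 j² q) and 2^(k m) are at least 1, so the right side only grows.
    s ^ E * 1 * 2 ^ (c * 69 * j * m)             ≤⟨ ℕₚ.*-monoˡ-≤ (2 ^ (c * 69 * j * m)) (ℕₚ.*-monoʳ-≤ (s ^ E) (1≤^ j (2 * j * j * 69) (ℕₚ.<⇒≤ 2≤j))) ⟩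
    s ^ E * j ^ (2 * j * j * 69) * 2 ^ (c * 69 * j * m) ≡⟨ ℕₚ.*-identityʳ _ ⟨
    s ^ E * j ^ (2 * j * j * 69) * 2 ^ (c * 69 * j * m) * 1 ≤⟨ ℕₚ.*-monoʳ-≤ (s ^ E * j ^ (2 * j * j * 69) * 2 ^ (c * 69 * j * m)) (ℕₚ.m^n>0 2 (k * m)) ⟩
    s ^ E * j ^ (2 * j * j * 69) * 2 ^ (c * 69 * j * m) * 2 ^ (k * m) ∎
  where
  at-least-2 : ∀ j → (j % 2 ≡ 1 × 3 ≤ j) ⊎ j ≡ 4 → 2 ≤ j
  at-least-2 j (inj₁ (_ , 3≤j)) = ℕₚ.<⇒≤ 3≤j
  at-least-2 j (inj₂ refl)      = s≤s (s≤s z≤n)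
  regroup : ∀ c j m → c * (69 * j * m) ≡ c * 69 * j * m
  regroup = ℕ-Solver.solve-∀
  1≤^ : ∀ a e → 1 ≤ a → 1 ≤ a ^ e
  1≤^ (suc a) e _ = ℕₚ.m^n>0 (suc a) e
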